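{- Let $t\ge2$, $r\ge1$, $N=t+2r$, and let $N_\delta=\det(x_i^{\delta_j})_{i,j=1}^N$ with $\delta=(N-1,N-2,\dots,0)$ and $x=(1,\zeta,\dots,\zeta^{t-1},z_1,z_1^{ -1},\dots,z_r,z_r^{ -1})$, $\zeta=e^{2\pi i/t}$, a Laurent polynomial in $z_1,\dots,z_r$. Then, as a polytope in $\mathbb R^r$: (i) $\mathrm{Newt}(N_\delta)$ is the zonotope $$\bigoplus_{k=1}^r\bigl[-(t+1)e_k,(t+1)e_k\bigr]\ \oplus\ \bigoplus_{k<l}\Bigl(\bigl[-(e_k-e_l),e_k-e_l\bigr]\oplus\bigl[-(e_k+e_l),e_k+e_l\bigr]\Bigr).$$ (ii) Equivalently, it is the orbit polytope $\mathrm{conv}\bigl(W(C_r)\cdot(N-1,N-3,\dots,N-2r+1)\bigr)$, and it has exactly $2^r r!$ vertices, one for each element of $W(C_r)$. (iii) In particular the dominant vertex of $\mathrm{Newt}(N_\delta)$ is $(N-1,N-3,\dots,N-2r+1)$.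
   Context: $\mathrm{Newt}(f)$ is the Newton polytope of a Laurent polynomial $f$ in $z_1,\dots,z_r$: the convex hull of the exponent vectors with nonzero coefficient. $\oplus$ is Minkowski sum, $e_k$ the standard basis of $\mathbb R^r$, $[a,b]$ the segment from $a$ to $b$. $W(C_r)$ is the group of signed permutations of the coordinates. The dominant vertex is the vertex in the chamber $x_1\ge x_2\ge\dots\ge x_r\ge0$. -}

module Defs where

open import Level using (Level; _⊔_) renaming (suc to lsuc)
open import Algebra.Bundles.Raw using (RawRing)
open import Algebra.Bundles using (CommutativeRing; module Semiring)
open import Algebra.Apartness.Bundles using (HeytingField; module HeytingCommutativeRing)
import Algebra.Definitions.RawSemiring as RawSemiringOps
open import Data.Bool.Base using (if_then_else_)
open import Data.Fin.Base using (Fin; zero; suc; toℕ; opposite; punchIn; Fin′; inject)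
import Data.Fin.Base as Fin
import Data.Fin.Properties as Fin
open import Data.Fin.Permutation using (Permutation′; _⟨$⟩ʳ_)
open import Data.Integer.Base as ℤ using (ℤ; +_; -[1+_])
import Data.Integer.Properties as ℤ
open import Data.List.Base as List using (List; []; _∷_)
open import Data.Nat.Base as ℕ using (ℕ; zero; suc)
open import Data.Product.Base using (Σ; ∃; _×_; _,_; proj₁)
open import Data.Sign.Base using (Sign)
open import Data.Sum.Base using (_⊎_)
open import Data.Vec.Base as Vec using (Vec)
import Data.Vec.Properties as Vec
open import Data.Vec.Functional as Vector using (Vector)
import Data.Vec.Functional.Relation.Binary.Pointwise.Properties as Pointwise
open import Relation.Binary.Bundles using (Setoid)
open import Relation.Binary.Core using (Rel)
import Relation.Binary.Construct.On as On
open import Relation.Binary.PropositionalEquality as ≡ using (_≡_; _→-setoid_)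
open import Relation.Binary.Structures using (IsStrictPartialOrder)
open import Relation.Nullary.Decidable.Core using (does)
open import Relation.Nullary.Negation.Core using (¬_)
open import Relation.Unary using (Pred)

commutativeRing : ∀ {c ℓ₁ ℓ₂} → HeytingField c ℓ₁ ℓ₂ → CommutativeRing c ℓ₁
commutativeRing K =
  HeytingCommutativeRing.commutativeRing (HeytingField.heytingCommutativeRing K)

-- Stands for ℝ; no completeness or Archimedean property is assumed.
-- The apartness `x # y` is "x ≠ y" in positive form.  A field with
-- decidable equality is the case x # y = ¬ (x ≈ y), and its order is then
-- an ordinary total order; constructive ℝ, whose order is not decidable,
-- is also covered.

record OrderedField c ℓ₁ ℓ₂ ℓ₃ : Set (lsuc (c ⊔ ℓ₁ ⊔ ℓ₂ ⊔ ℓ₃)) where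
  infix 4 _<_ _≤_
  field
    heytingField : HeytingField c ℓ₁ ℓ₂

  open HeytingField heytingField public

  field
    _<_                  : Rel Carrier ℓ₃
    isStrictPartialOrder : IsStrictPartialOrder _≈_ _<_
    #⇒<⊎>                : ∀ {x y} → x # y → x < y ⊎ y < x
    <⇒#                  : ∀ {x y} → x < y → x # y
    +-monoˡ-<            : ∀ {x y} z → x < y → x + z < y + z
    *-pos                : ∀ {x y} → 0# < x → 0# < y → 0# < x * y

  _≤_ : Rel Carrier ℓ₃
  x ≤ y = ¬ (y < x)

module Determinant {a ℓ} (R : RawRing a ℓ) where
  open RawRing R
  open RawSemiringOps rawSemiring using (_^_; sum)

  -- Laplace expansion along the first row.
  det : ∀ {n} → Vector (Vector Carrier n) n → Carrier
  det {zero}  A = 1#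
  det {suc n} A =
    sum λ j → (- 1#) ^ toℕ j * A zero j * det (λ i k → A (suc i) (punchIn j k))

module RootOfUnity {a ℓ₁ ℓ₂} (K : HeytingField a ℓ₁ ℓ₂) where
  open HeytingField K
  open CommutativeRing (commutativeRing K) using (semiring)
  open RawSemiringOps (Semiring.rawSemiring semiring) public using (_^_)

  -- Stands for ζ = e^(2πi/t), which satisfies this in K = ℂ.
  IsPrimitiveRoot : ℕ → Carrier → Set (ℓ₁ ⊔ ℓ₂)
  IsPrimitiveRoot t ζ = ζ ^ t ≈ 1# × (∀ k → 0 ℕ.< k → k ℕ.< t → ζ ^ k # 1#)

Exponent : ℕ → Set
Exponent r = Vec ℤ r

basis : ∀ {r} → Fin r → Exponent r
basis k = Vec.tabulate λ i → if does (i Fin.≟ k) then + 1 else + 0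

module Laurent {a ℓ₁ ℓ₂} (K : HeytingField a ℓ₁ ℓ₂) (r : ℕ) where
  open HeytingField K
  open RootOfUnity K using () renaming (_^_ to _^ᴷ_)

  -- A formal sum of terms a·z^m.  Exponents may repeat and coefficients may
  -- vanish: a polynomial is determined only by its coefficient function.
  LaurentPoly : Set a
  LaurentPoly = List (Carrier × Exponent r)

  coeff : LaurentPoly → Exponent r → Carrier
  coeff []            m = 0#
  coeff ((a , n) ∷ f) m =
    (if does (Vec.≡-dec ℤ._≟_ n m) then a else 0#) + coeff f m

  constant : Carrier → LaurentPoly
  constant a = (a , Vec.replicate r (+ 0)) ∷ []

  z z⁻¹ : Fin r → LaurentPoly
  z   k = (1# , basis k) ∷ []
  z⁻¹ k = (1# , Vec.map ℤ.-_ (basis k)) ∷ []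

  rawRing : RawRing a ℓ₁
  rawRing = record
    { Carrier = LaurentPoly
    ; _≈_     = λ f g → ∀ m → coeff f m ≈ coeff g m
    ; _+_     = List._++_
    ; _*_     = List.cartesianProductWith
                  λ (a , m) (b , n) → a * b , Vec.zipWith ℤ._+_ m n
    ; -_      = List.map λ (a , m) → - a , m
    ; 0#      = []
    ; 1#      = constant 1#
    }

  open Determinant rawRing
  open RawSemiringOps (RawRing.rawSemiring rawRing) using (_^_)

  -- x = (1, ζ, …, ζ^(t-1), z₁, z₁⁻¹, …, z_r, z_r⁻¹)
  variables : (t : ℕ) → Carrier → Vector LaurentPoly (t ℕ.+ r ℕ.* 2)
  variables t ζ =
    (λ (i : Fin t) → constant (ζ ^ᴷ toℕ i))
    Vector.++
    Vector.concat (λ (k : Fin r) → z k Vector.∷ z⁻¹ k Vector.∷ Vector.[])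

  -- `toℕ (opposite j)` is the entry N - 1 - j of δ, for j counted from 0.
  Nδ : (t : ℕ) → Carrier → LaurentPoly
  Nδ t ζ = det λ i j → variables t ζ i ^ toℕ (opposite j)

-- The hyperoctahedral group W(C_r): w = (ε , σ) sends x to (ε_k x_σ(k))_k.

SignedPermutation : ℕ → Set
SignedPermutation r = (Fin r → Sign) × Permutation′ r

signedPermutations : ℕ → Setoid _ _
signedPermutations r =
  On.setoid {B = SignedPermutation r} (Fin r →-setoid (Sign × Fin r))
    λ (ε , σ) k → ε k , σ ⟨$⟩ʳ k

module Polytope {c ℓ₁ ℓ₂ ℓ₃} (F : OrderedField c ℓ₁ ℓ₂ ℓ₃) (r : ℕ) where
  open OrderedField F
  open CommutativeRing (commutativeRing heytingField) using (semiring)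
  open RawSemiringOps (Semiring.rawSemiring semiring)
    using (sum) renaming (_×_ to _×ℕ_)

  fromℤ : ℤ → Carrier
  fromℤ (+ n)    = n ×ℕ 1#
  fromℤ -[1+ n ] = - (suc n ×ℕ 1#)

  points : Setoid c ℓ₁
  points = Pointwise.setoid setoid r

  open Setoid points public using () renaming (Carrier to Point; _≈_ to _≋_)

  infixl 6 _+ₚ_ _-ₚ_
  infixr 7 _·_
  infix  8 -ₚ_

  _+ₚ_ _-ₚ_ : Point → Point → Point
  (x +ₚ y) k = x k + y k
  (x -ₚ y) k = x k - y k

  -ₚ_ : Point → Point
  (-ₚ x) k = - x k

  _·_ : Carrier → Point → Point
  (s · x) k = s * x k

  ∑ : ∀ {n} → Vector Point n → Point
  ∑ x k = sum λ i → x i k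

  ⟨_,_⟩ : Point → Point → Carrier
  ⟨ x , y ⟩ = sum λ k → x k * y k

  fromExponent : Exponent r → Point
  fromExponent m k = fromℤ (Vec.lookup m k)

  e : Fin r → Point
  e k = fromExponent (basis k)

  conv : ∀ {ℓ} → Pred Point ℓ → Pred Point (c ⊔ ℓ₁ ⊔ ℓ₃ ⊔ ℓ)
  conv S p = ∃ λ n → Σ (Vector Carrier n) λ w → Σ (Vector Point n) λ q →
    (∀ i → 0# ≤ w i) × sum w ≈ 1# × (∀ i → S (q i)) × p ≋ ∑ (λ i → w i · q i)

  segment : Point → Point → Pred Point (c ⊔ ℓ₁ ⊔ ℓ₃)
  segment a b p =
    ∃ λ s → 0# ≤ s × s ≤ 1# × p ≋ ((1# - s) · a) +ₚ (s · b)

  infixl 6 _⊕_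
  _⊕_ : ∀ {ℓ ℓ′} → Pred Point ℓ → Pred Point ℓ′ → Pred Point (c ⊔ ℓ₁ ⊔ ℓ ⊔ ℓ′)
  (A ⊕ B) p = ∃ λ a → ∃ λ b → A a × B b × p ≋ a +ₚ b

  ⨁ : ∀ {ℓ n} → (Fin n → Pred Point ℓ) → Pred Point (c ⊔ ℓ₁ ⊔ ℓ)
  ⨁ A p = ∃ λ a → (∀ i → A i (a i)) × p ≋ ∑ a

  -- The inner sum of the second summand runs over all k < l.
  zonotope : ℕ → Pred Point _
  zonotope t =
    ⨁ (λ (k : Fin r) →
         segment (-ₚ (fromℤ (+ (t ℕ.+ 1)) · e k)) (fromℤ (+ (t ℕ.+ 1)) · e k))
    ⊕
    ⨁ (λ (l : Fin r) → ⨁ (λ (k′ : Fin′ l) → let k = inject k′ in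
         segment (-ₚ (e k -ₚ e l)) (e k -ₚ e l)
         ⊕ segment (-ₚ (e k +ₚ e l)) (e k +ₚ e l)))

  -- A zero-dimensional face: some linear functional attains its maximum over
  -- P at v and nowhere else.
  IsVertex : ∀ {ℓ} → Pred Point ℓ → Pred Point _
  IsVertex P v = P v × ∃ λ y → ∀ p → P p →
    ⟨ y , p ⟩ ≤ ⟨ y , v ⟩ × (⟨ y , p ⟩ ≈ ⟨ y , v ⟩ → p ≋ v)

  vertices : ∀ {ℓ} → Pred Point ℓ → Setoid _ _
  vertices P = On.setoid {B = ∃ (IsVertex P)} points proj₁

  Dominant : Pred Point _
  Dominant x = (∀ k l → k Fin.≤ l → x l ≤ x k) × (∀ k → 0# ≤ x k)

  IsDominantVertex : ∀ {ℓ} → Pred Point ℓ → Pred Point _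
  IsDominantVertex P v = IsVertex P v × Dominant v ×
    (∀ u → IsVertex P u → Dominant u → u ≋ v)

  signed : Sign → Carrier → Carrier
  signed Sign.+ x = x
  signed Sign.- x = - x

  infixr 7 _•_
  _•_ : SignedPermutation r → Point → Point
  ((ε , σ) • x) k = signed (ε k) (x (σ ⟨$⟩ʳ k))

  orbit : Point → Pred Point _
  orbit x p = ∃ λ w → p ≋ w • x

  -- (N - 1, N - 3, …, N - 2r + 1)
  top : ℕ → Point
  top N k = fromℤ (+ N ℤ.- + (2 ℕ.* toℕ k ℕ.+ 1))

  Newt : ∀ {a a₁ a₂} (K : HeytingField a a₁ a₂) →
         Laurent.LaurentPoly K r → Pred Point _
  Newt K f = conv λ p → ∃ λ m → coeff f m #ᴷ 0ᴷ × p ≋ fromExponent m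
    where open Laurent K r using (coeff)
          open HeytingField K using () renaming (_#_ to _#ᴷ_; 0# to 0ᴷ)

module Submission where

-- It suffices that Newt(N_δ) ⊆ zonotope ⊆ conv(W·top) ⊆ Newt(N_δ).
--
-- N_δ is a Vandermonde determinant, hence the product of all x_i − x_j, and
-- its support lies in the sum of the segments joining the exponents of x_i
-- and x_j.  Grouped by opposite pairs, these segments add up to the zonotope.
--
-- A point of the zonotope is put into the orbit polytope one coordinate at a
-- time.  An orbit point is a list of signed basis vectors with coefficients
-- t+1, t+3, …; when the segments of a new vector n are added, the coefficient
-- of some list element or of n is moved by 2, and it is enough to resolve the
-- coincidence of two coefficients by a convex combination of the two ways of
-- ordering the vectors concerned.
--
-- For w ∈ W, a linear functional that orders the variables as w does selects
-- one monomial in every factor x_i − x_j with i or j not a constant; the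
-- selected exponents add up to w·top, and the coefficient is, up to sign, the
-- Vandermonde product of the powers of ζ, which is invertible.
--
-- All of W·top lies on one sphere around the origin, so ⟨v, ·⟩ is maximal on
-- conv(W·top) exactly at v for each v in the orbit: these are the vertices.

open import Defs
open import Algebra.Apartness.Bundles using (HeytingField)
open import Algebra.Bundles using (CommutativeRing)
open import Algebra.Bundles.Raw using (RawRing)
import Algebra.Apartness.Properties.HeytingCommutativeRing as HeytingProperties
import Algebra.Definitions.RawSemiring as RawSemiringOps
import Algebra.Properties.AbelianGroup as AbelianGroupProperties
import Algebra.Properties.CommutativeMonoid.Sum as CommutativeMonoidSum
import Algebra.Solver.Ring
open import Algebra.Solver.Ring.AlmostCommutativeRing
  using (fromCommutativeRing; _-Raw-AlmostCommutative⟶_; Induced-equivalence)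
open import Algebra.Structures using (IsCommutativeRing)
open import Data.Bool.Base using (if_then_else_; true; false)
open import Data.Fin.Base as Fin
  using (Fin; zero; suc; toℕ; Fin′; inject; inject₁; fromℕ; cast; opposite; punchIn; punchOut;
         splitAt; combine; remQuot; funToFin; finToFun)
import Data.Fin.Permutation as Perm
open import Data.Fin.Permutation
  using (Permutation′; _⟨$⟩ʳ_; _⟨$⟩ˡ_; inverseˡ; inverseʳ; permutation)
import Data.Fin.Properties as Fin
open import Data.Integer.Base as ℤ using (ℤ; +_; -[1+_]; _⊖_)
import Data.Integer.Properties as ℤ
import Data.Integer.Solver
open import Data.List.Base as List
  using (List; []; _∷_; _++_; length; tabulate; allFin; lookup)
import Data.List.Properties as List
open import Data.List.Membership.Propositional using (_∈_)
open import Data.List.Membership.Propositional.Properties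
  using (∈-∃++; ∈-map⁻; ∈-map⁺; ∈-tabulate⁺; ∈-tabulate⁻; ∈-allFin; ∈-lookup)
open import Data.List.Membership.Propositional.Properties.WithK using (unique∧set⇒bag)
open import Data.List.Relation.Binary.BagAndSetEquality using (∼bag⇒↭)
open import Data.List.Relation.Binary.Permutation.Propositional as ↭
  using (_↭_; ↭-refl; ↭-sym; ↭-trans; ↭-reflexive; prep; swap)
open import Data.List.Relation.Binary.Permutation.Propositional.Properties
  using (shift; shifts; map⁺; ∈-resp-↭; ↭-length; ++⁺ˡ; drop-∷)
open import Data.List.Relation.Binary.Permutation.Setoid.Properties using (Unique-resp-↭)
open import Data.List.Relation.Unary.All as All using (All; []; _∷_)
import Data.List.Relation.Unary.All.Properties as All
open import Data.List.Relation.Unary.AllPairs as AllPairs using (AllPairs; []; _∷_)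
import Data.List.Relation.Unary.AllPairs.Properties as AllPairs
open import Data.List.Relation.Unary.Any as Any using (here; there)
open import Data.List.Relation.Unary.Any.Properties using (lookup-index)
import Data.List.Relation.Unary.Unique.Propositional.Properties as Unique
open import Data.Maybe.Base using (just; nothing)
open import Data.Nat.Base as ℕ using (ℕ; zero; suc; s≤s; _!)
import Data.Nat.Properties as ℕ
import Data.Nat.Solver
open import Data.Product.Base using (Σ; ∃; _×_; _,_; proj₁; proj₂)
open import Data.Sign.Base as Sign using (Sign)
open import Data.Sum.Base using (_⊎_; inj₁; inj₂)
open import Data.Vec.Base as Vec using (Vec)
open import Data.Vec.Functional as Vector using (Vector)
import Data.Vec.Properties as Vec
open import Function.Base using (_∘_; case_of_; id)
open import Function.Bundles using (Bijection; mk⇔)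
open import Level using (Level; _⊔_)
open import Relation.Binary.Core using (Rel)
open import Relation.Binary.Definitions using (WeaklyDecidable)
open import Relation.Binary.PropositionalEquality as ≡ using (_≡_)
open import Relation.Binary.Structures using (module IsStrictPartialOrder)
open import Relation.Nullary.Decidable using (yes; no; does; dec-true; dec-false)
open import Relation.Nullary.Negation.Core using (¬_; contradiction)
open import Relation.Unary using (Pred; _≐_)

-- Classically all the inclusions follow by comparing support functions, and generic functionals
-- give the vertices of a zonotope. Here the order of `F` need not be decidable: coordinates cannot
-- be sorted, and a point is not put into a hull by testing it against functionals. Membership in
-- the orbit polytope is therefore shown by explicit weights, which is why the zonotope is taken
-- apart vector by vector.
--
-- The constant t + 1 counts factors. For each of the t constants ζ^i, the exponents of (ζ^i -
-- z_k)(ζ^i - 1/z_k) span [-e_k, e_k]; the factor z_k - 1/z_k spans the same segment once more.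
--
-- Laurent polynomials are formal sums in which terms may cancel. The upper bound on the support is
-- indifferent to this, since it concerns all listed terms. For the lower bound the extremal
-- monomial is isolated: every other listed exponent has a strictly smaller value of the functional,
-- so nothing can cancel it.

private module ℤGroup = AbelianGroupProperties ℤ.+-0-abelianGroup

-- Integer multiples of 1 and a ring solver with integer coefficients.

module IntegerScalars {c ℓ} (R : CommutativeRing c ℓ) where
  open CommutativeRing R hiding (zero)
  open import Algebra.Properties.Ring ring
    using (-0#≈0#; -‿distribˡ-*; -‿distribʳ-*; -‿involutive; -‿+-comm)
  open import Algebra.Properties.Semiring.Mult semiring
    using (×-homo-+; ×1-homo-*) renaming (_×_ to _×ℕ_)
  open import Relation.Binary.Reasoning.Setoid setoid

  -- The clauses are those of `fromℤ`, so the two agree by `refl` on each constructor. The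
  -- homomorphism laws also justify integer coefficients in the solver.
  scalar : ℤ → Carrier
  scalar (+ n)    = n ×ℕ 1#
  scalar -[1+ n ] = - (suc n ×ℕ 1#)

  private
    cancel-1 : ∀ a b → (1# + a) - (1# + b) ≈ a - b
    cancel-1 a b = begin
      (1# + a) - (1# + b)       ≈⟨ +-congˡ (-‿+-comm 1# b) ⟨
      (1# + a) + (- 1# + - b)   ≈⟨ +-congʳ (+-comm 1# a) ⟩
      (a + 1#) + (- 1# + - b)   ≈⟨ +-assoc a 1# _ ⟩
      a + (1# + (- 1# + - b))   ≈⟨ +-congˡ (+-assoc 1# _ _) ⟨
      a + ((1# + - 1#) + - b)   ≈⟨ +-congˡ (+-congʳ (-‿inverseʳ 1#)) ⟩
      a + (0# + - b)            ≈⟨ +-congˡ (+-identityˡ _) ⟩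
      a - b                     ∎

    scalar-⊖ : ∀ m n → scalar (m ⊖ n) ≈ m ×ℕ 1# - n ×ℕ 1#
    scalar-⊖ m       zero    = sym (trans (+-congˡ -0#≈0#) (+-identityʳ _))
    scalar-⊖ zero    (suc n) = sym (+-identityˡ _)
    scalar-⊖ (suc m) (suc n) = begin
      scalar (suc m ⊖ suc n)             ≡⟨ ≡.cong scalar (ℤ.[1+m]⊖[1+n]≡m⊖n m n) ⟩
      scalar (m ⊖ n)                     ≈⟨ scalar-⊖ m n ⟩
      m ×ℕ 1# - n ×ℕ 1#                    ≈⟨ cancel-1 _ _ ⟨
      suc m ×ℕ 1# - suc n ×ℕ 1#            ∎

  scalar-+ : ∀ i j → scalar (i ℤ.+ j) ≈ scalar i + scalar j
  scalar-+ (+ m)    (+ n)    = ×-homo-+ 1# m n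
  scalar-+ (+ m)    -[1+ n ] = scalar-⊖ m (suc n)
  scalar-+ -[1+ m ] (+ n)    = trans (scalar-⊖ n (suc m)) (+-comm _ _)
  scalar-+ -[1+ m ] -[1+ n ] = begin
    - (suc (suc (m ℕ.+ n)) ×ℕ 1#)       ≡⟨ ≡.cong (λ k → - (k ×ℕ 1#)) (ℕ.+-suc (suc m) n) ⟨
    - ((suc m ℕ.+ suc n) ×ℕ 1#)         ≈⟨ -‿cong (×-homo-+ 1# (suc m) (suc n)) ⟩
    - (suc m ×ℕ 1# + suc n ×ℕ 1#)        ≈⟨ -‿+-comm _ _ ⟨
    - (suc m ×ℕ 1#) + - (suc n ×ℕ 1#)    ∎

  scalar-neg : ∀ i → scalar (ℤ.- i) ≈ - scalar i
  scalar-neg (+ zero)  = sym -0#≈0#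
  scalar-neg (+ suc n) = refl
  scalar-neg -[1+ n ]  = sym (-‿involutive _)

  private
    scalar-neg◃ : ∀ n → scalar (Sign.- ℤ.◃ n) ≈ - (n ×ℕ 1#)
    scalar-neg◃ n = trans (reflexive (≡.cong scalar (ℤ.-◃n≡-n n))) (scalar-neg (+ n))

    scalar-pos◃ : ∀ n → scalar (Sign.+ ℤ.◃ n) ≈ n ×ℕ 1#
    scalar-pos◃ n = reflexive (≡.cong scalar (ℤ.+◃n≡+n n))

  scalar-* : ∀ i j → scalar (i ℤ.* j) ≈ scalar i * scalar j
  scalar-* (+ m)    (+ n)    = trans (scalar-pos◃ (m ℕ.* n)) (×1-homo-* m n)
  scalar-* (+ m)    -[1+ n ] = begin
    scalar (Sign.- ℤ.◃ (m ℕ.* suc n)) ≈⟨ scalar-neg◃ (m ℕ.* suc n) ⟩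
    - ((m ℕ.* suc n) ×ℕ 1#)            ≈⟨ -‿cong (×1-homo-* m (suc n)) ⟩
    - (m ×ℕ 1# * suc n ×ℕ 1#)           ≈⟨ -‿distribʳ-* _ _ ⟩
    m ×ℕ 1# * - (suc n ×ℕ 1#)           ∎
  scalar-* -[1+ m ] (+ n)    = begin
    scalar (Sign.- ℤ.◃ (suc m ℕ.* n)) ≈⟨ scalar-neg◃ (suc m ℕ.* n) ⟩
    - ((suc m ℕ.* n) ×ℕ 1#)            ≈⟨ -‿cong (×1-homo-* (suc m) n) ⟩
    - (suc m ×ℕ 1# * n ×ℕ 1#)           ≈⟨ -‿distribˡ-* _ _ ⟩
    - (suc m ×ℕ 1#) * n ×ℕ 1#           ∎
  scalar-* -[1+ m ] -[1+ n ] = begin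
    scalar (Sign.+ ℤ.◃ (suc m ℕ.* suc n)) ≈⟨ scalar-pos◃ (suc m ℕ.* suc n) ⟩
    (suc m ℕ.* suc n) ×ℕ 1#                ≈⟨ ×1-homo-* (suc m) (suc n) ⟩
    suc m ×ℕ 1# * suc n ×ℕ 1#               ≈⟨ -‿involutive _ ⟨
    - - (suc m ×ℕ 1# * suc n ×ℕ 1#)         ≈⟨ -‿cong (-‿distribˡ-* _ _) ⟩
    - (- (suc m ×ℕ 1#) * suc n ×ℕ 1#)       ≈⟨ -‿distribʳ-* _ _ ⟩
    - (suc m ×ℕ 1#) * - (suc n ×ℕ 1#)       ∎

  private
    -- Unlike `scalar`, sends 0 and 1 to 0# and 1# definitionally.
    literalℕ : ℕ → Carrier
    literalℕ 0             = 0#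
    literalℕ 1             = 1#
    literalℕ (suc (suc n)) = 1# + literalℕ (suc n)

    literalℕ≈×ℕ : ∀ n → literalℕ n ≈ n ×ℕ 1#
    literalℕ≈×ℕ 0             = refl
    literalℕ≈×ℕ 1             = sym (+-identityʳ 1#)
    literalℕ≈×ℕ (suc (suc n)) = +-congˡ (literalℕ≈×ℕ (suc n))

    literal : ℤ → Carrier
    literal (+ n)    = literalℕ n
    literal -[1+ n ] = - literalℕ (suc n)

    literal≈scalar : ∀ i → literal i ≈ scalar i
    literal≈scalar (+ n)    = literalℕ≈×ℕ n
    literal≈scalar -[1+ n ] = -‿cong (literalℕ≈×ℕ (suc n))

    morphism : ℤ.+-*-rawRing -Raw-AlmostCommutative⟶ fromCommutativeRing R
    morphism = record
      { ⟦_⟧    = literal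
      ; +-homo = λ i j → trans (literal≈scalar (i ℤ.+ j)) (trans (scalar-+ i j)
                   (sym (+-cong (literal≈scalar i) (literal≈scalar j))))
      ; *-homo = λ i j → trans (literal≈scalar (i ℤ.* j)) (trans (scalar-* i j)
                   (sym (*-cong (literal≈scalar i) (literal≈scalar j))))
      ; -‿homo = λ i → trans (literal≈scalar (ℤ.- i)) (trans (scalar-neg i)
                   (sym (-‿cong (literal≈scalar i))))
      ; 0-homo = refl
      ; 1-homo = refl
      }

    _≟_ : WeaklyDecidable (Induced-equivalence morphism)
    i ≟ j with i ℤ.≟ j
    ... | yes i≡j = just (reflexive (≡.cong literal i≡j))
    ... | no  _   = nothing

  open Algebra.Solver.Ring ℤ.+-*-rawRing (fromCommutativeRing R) morphism _≟_ public
    using (solve; _:=_; con; _:+_; _:*_; _:-_; :-_; Polynomial)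

-- Apartness from zero as invertibility.

module HeytingFieldProperties {a ℓ₁ ℓ₂} (K : HeytingField a ℓ₁ ℓ₂) where
  open HeytingField K hiding (zero)
  open HeytingProperties (HeytingField.heytingCommutativeRing K) public
    using (1#0; x#0y#0→xy#0; #-congʳ; #-congˡ)
  open IntegerScalars (commutativeRing K)
    using (solve; _:=_; _:+_; _:*_; _:-_; :-_; con)

  #0⇒inverse : ∀ {x} → x # 0# → ∃ λ y → x * y ≈ 1#
  #0⇒inverse {x} x#0 with #⇒invertible x#0
  ... | y , _ , x-0*y≈1 = y , trans
    (solve 2 (λ x y → x :* y := (x :- con (+ 0)) :* y) refl x y) x-0*y≈1

  inverse⇒#0 : ∀ {x y} → x * y ≈ 1# → x # 0#
  inverse⇒#0 {x} {y} xy≈1 = invertible⇒# (y ,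
    trans (solve 2 (λ x y → y :* (x :- con (+ 0)) := x :* y) refl x y) xy≈1 ,
    trans (solve 2 (λ x y → (x :- con (+ 0)) :* y := x :* y) refl x y) xy≈1)

  -- A factor of an invertible element is invertible: y times the inverse of xy inverts x.
  *#0⇒#0ˡ : ∀ {x y} → x * y # 0# → x # 0#
  *#0⇒#0ˡ {x} {y} xy#0 with #0⇒inverse xy#0
  ... | z , xyz≈1 = inverse⇒#0 (trans (sym (*-assoc x y z)) xyz≈1)

  *#0⇒#0ʳ : ∀ {x y} → x * y # 0# → y # 0#
  *#0⇒#0ʳ {x} {y} xy#0 = *#0⇒#0ˡ (#-congʳ (*-comm x y) xy#0)

  -‿#0 : ∀ {x} → x # 0# → - x # 0#
  -‿#0 {x} x#0 with #0⇒inverse x#0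
  ... | y , xy≈1 = inverse⇒#0
    (trans (solve 2 (λ x y → :- x :* :- y := x :* y) refl x y) xy≈1)

  #⇒-#0 : ∀ {x y} → x # y → x - y # 0#
  #⇒-#0 {x} {y} x#y with #⇒invertible x#y
  ... | z , _ , eq = inverse⇒#0 eq

  -#0⇒# : ∀ {x y} → x - y # 0# → x # y
  -#0⇒# {x} {y} x-y#0 with #0⇒inverse x-y#0
  ... | z , eq = invertible⇒# (z , trans (*-comm z (x - y)) eq , eq)

-- Inequalities in an ordered field without decidable order.

module OrderedFieldProperties {c ℓ₁ ℓ₂ ℓ₃} (F : OrderedField c ℓ₁ ℓ₂ ℓ₃) where
  open OrderedField F hiding (zero)
  open HeytingFieldProperties heytingField public
  open IntegerScalars (commutativeRing heytingField) public
  open IsStrictPartialOrder isStrictPartialOrder public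
    using () renaming (irrefl to <-irrefl; trans to <-trans; <-respˡ-≈ to <-respˡ; <-respʳ-≈ to <-respʳ;
        asym to <-asym)
  open import Algebra.Properties.Semiring.Sum
    (CommutativeRing.semiring (commutativeRing heytingField)) public
    using (sum; sum-cong-≋; ∑-distrib-+; *-distribˡ-sum; *-distribʳ-sum; ∑-comm)

  ≤-respʳ : ∀ {x y z} → y ≈ z → x ≤ y → x ≤ z
  ≤-respʳ y≈z x≤y z<x = x≤y (<-respˡ (sym y≈z) z<x)

  ≤-respˡ : ∀ {x y z} → y ≈ z → y ≤ x → z ≤ x
  ≤-respˡ y≈z y≤x x<z = y≤x (<-respʳ (sym y≈z) x<z)

  <⇒≤ : ∀ {x y} → x < y → x ≤ y
  <⇒≤ = <-asym

  ≈⇒≤ : ∀ {x y} → x ≈ y → x ≤ y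
  ≈⇒≤ x≈y y<x = <-irrefl (sym x≈y) y<x

  -- As `≤` is a negation, equality can only come from tightness: elements that are not apart are
  -- equal.
  ≤-antisym : ∀ {x y} → x ≤ y → y ≤ x → x ≈ y
  ≤-antisym x≤y y≤x = proj₁ (tight _ _) λ x#y → case #⇒<⊎> x#y of λ where
    (inj₁ x<y) → y≤x x<y
    (inj₂ y<x) → x≤y y<x

  <-shift : ∀ {x y} → x < y → 0# < y - x
  <-shift {x} {y} x<y = <-respˡ (-‿inverseʳ x) (+-monoˡ-< (- x) x<y)

  <-unshift : ∀ {x y} → 0# < y - x → x < y
  <-unshift {x} {y} p = <-respˡ (+-identityˡ x)
    (<-respʳ (solve 2 (λ x y → y :- x :+ x := y) refl x y) (+-monoˡ-< x p))

  ≤⇒0≤- : ∀ {x y} → x ≤ y → 0# ≤ y - x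
  ≤⇒0≤- {x} {y} x≤y y-x<0 = x≤y (<-unshift
    (<-respʳ (solve 2 (λ x y → con (+ 0) :- (y :- x) := x :- y) refl x y) (<-shift y-x<0)))

  0≤-⇒≤ : ∀ {x y} → 0# ≤ y - x → x ≤ y
  0≤-⇒≤ {x} {y} p y<x = p (<-unshift
    (<-respʳ (solve 2 (λ x y → x :- y := con (+ 0) :- (y :- x)) refl x y) (<-shift y<x)))

  +-pos : ∀ {x y} → 0# < x → 0# < y → 0# < x + y
  +-pos {x} {y} 0<x 0<y = <-trans 0<y (<-respˡ (+-identityˡ y) (+-monoˡ-< y 0<x))

  -- The signs of x and y cannot be decided. Cotransitivity compares the apart elements x + y and 0
  -- with y, and each outcome contradicts one of the hypotheses.
  +-nonNeg : ∀ {x y} → 0# ≤ x → 0# ≤ y → 0# ≤ x + y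
  +-nonNeg {x} {y} 0≤x 0≤y x+y<0 = case #-cotrans (<⇒# x+y<0) y of λ where
      (inj₁ x+y#y) → case #⇒<⊎> x+y#y of λ where
        (inj₁ x+y<y) → x+y≮y x+y<y
        (inj₂ y<x+y) → 0≤y (<-trans y<x+y x+y<0)
      (inj₂ y#0) → case #⇒<⊎> y#0 of λ where
        (inj₁ y<0) → 0≤y y<0
        (inj₂ 0<y) → x+y≮y (<-trans x+y<0 0<y)
    where
    x+y≮y : ¬ (x + y < y)
    x+y≮y x+y<y = 0≤x (<-unshift (<-respʳ
      (solve 2 (λ x y → y :- (x :+ y) := con (+ 0) :- x) refl x y) (<-shift x+y<y)))

  -- The conclusion is strict, hence not a negation, and must be produced by a comparison: 0 and y
  -- are apart, so x + y is apart from one of them.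
  +-nonNeg-pos : ∀ {x y} → 0# ≤ x → 0# < y → 0# < x + y
  +-nonNeg-pos {x} {y} 0≤x 0<y = case #-cotrans (<⇒# 0<y) (x + y) of λ where
    (inj₁ 0#x+y) → case #⇒<⊎> 0#x+y of λ where
      (inj₁ 0<x+y) → 0<x+y
      (inj₂ x+y<0) → contradiction x+y<0 (+-nonNeg 0≤x (<⇒≤ 0<y))
    (inj₂ x+y#y) → case #⇒<⊎> x+y#y of λ where
      (inj₁ x+y<y) → contradiction (<-unshift (<-respʳ
        (solve 2 (λ x y → y :- (x :+ y) := con (+ 0) :- x) refl x y) (<-shift x+y<y))) 0≤x
      (inj₂ y<x+y) → <-trans 0<y y<x+y

  neg-pos : ∀ {x} → x < 0# → 0# < - x
  neg-pos {x} x<0 = <-respʳ (+-identityˡ _) (<-shift x<0)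

  *-nonNeg : ∀ {x y} → 0# ≤ x → 0# ≤ y → 0# ≤ x * y
  *-nonNeg {x} {y} 0≤x 0≤y xy<0 = case (#⇒<⊎> (*#0⇒#0ˡ xy#0) , #⇒<⊎> (*#0⇒#0ʳ xy#0)) of λ where
      (inj₁ x<0 , _)        → 0≤x x<0
      (inj₂ _   , inj₁ y<0) → 0≤y y<0
      (inj₂ 0<x , inj₂ 0<y) → <-asym xy<0 (*-pos 0<x 0<y)
    where xy#0 = <⇒# xy<0

  0≤x² : ∀ x → 0# ≤ x * x
  0≤x² x x²<0 = case #⇒<⊎> (*#0⇒#0ˡ (<⇒# x²<0)) of λ where
    (inj₁ x<0) → <-asym x²<0 (<-respʳ (solve 1 (λ x → :- x :* :- x := x :* x) refl x)
                   (*-pos (neg-pos x<0) (neg-pos x<0)))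
    (inj₂ 0<x) → <-asym x²<0 (*-pos 0<x 0<x)

  x²≈0⇒x≈0 : ∀ {x} → x * x ≈ 0# → x ≈ 0#
  x²≈0⇒x≈0 x²≈0 = proj₁ (tight _ _) λ x#0 →
    proj₂ (tight _ _) x²≈0 (x#0y#0→xy#0 x#0 x#0)

  0<1 : 0# < 1#
  0<1 = case #⇒<⊎> 1#0 of λ where
    (inj₁ 1<0) → <-respʳ (solve 0 (:- con (+ 1) :* :- con (+ 1) := con (+ 1)) refl)
                   (*-pos (neg-pos 1<0) (neg-pos 1<0))
    (inj₂ 0<1) → 0<1

  0≤1 : 0# ≤ 1#
  0≤1 = <⇒≤ 0<1

  0≤0 : 0# ≤ 0#
  0≤0 = ≈⇒≤ refl

  x+y≈0⇒x≈0 : ∀ {x y} → 0# ≤ x → 0# ≤ y → x + y ≈ 0# → x ≈ 0#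
  x+y≈0⇒x≈0 {x} {y} 0≤x 0≤y x+y≈0 = sym (≤-antisym 0≤x (0≤-⇒≤ (≤-respʳ
    (trans (solve 2 (λ x y → y := x :+ y :+ (con (+ 0) :- x)) refl x y)
      (trans (+-congʳ x+y≈0) (+-identityˡ _))) 0≤y)))

  sum-nonNeg : ∀ {n} {x : Vector Carrier n} → (∀ i → 0# ≤ x i) → 0# ≤ sum x
  sum-nonNeg {zero}  0≤x = 0≤0
  sum-nonNeg {suc n} 0≤x = +-nonNeg (0≤x zero) (sum-nonNeg (0≤x ∘ suc))

  sum≈0⇒≈0 : ∀ {n} {x : Vector Carrier n} → (∀ i → 0# ≤ x i) → sum x ≈ 0# → ∀ i → x i ≈ 0#
  sum≈0⇒≈0 0≤x eq zero    = x+y≈0⇒x≈0 (0≤x zero) (sum-nonNeg (0≤x ∘ suc)) eq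
  sum≈0⇒≈0 0≤x eq (suc i) = sum≈0⇒≈0 (0≤x ∘ suc)
    (x+y≈0⇒x≈0 (sum-nonNeg (0≤x ∘ suc)) (0≤x zero) (trans (+-comm _ _) eq)) i

  scalar-pos : ∀ n → 0# < scalar (+ suc n)
  scalar-pos zero    = <-respʳ (sym (+-identityʳ 1#)) 0<1
  scalar-pos (suc n) = +-pos 0<1 (scalar-pos n)

  scalar-nonNeg : ∀ n → 0# ≤ scalar (+ n)
  scalar-nonNeg zero    = 0≤0
  scalar-nonNeg (suc n) = <⇒≤ (scalar-pos n)

  scalar-mono-< : ∀ {i j} → i ℤ.< j → scalar i < scalar j
  scalar-mono-< {i} {j} i<j = <-unshift (<-respʳ
      (trans (scalar-+ j (ℤ.- i)) (+-congˡ (scalar-neg i)))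
          (pos (j ℤ.- i) (≡.subst (ℤ._< (j ℤ.- i)) (ℤ.+-inverseʳ i) (ℤ.+-monoˡ-< (ℤ.- i) i<j))))
    where
    pos : ∀ k → + 0 ℤ.< k → 0# < scalar k
    pos (+ suc n) _ = scalar-pos n
    pos (+ zero) (ℤ.+<+ ())

  -- The order of ℤ is decidable, so it suffices to refute the reverse strict inequality.
  scalar-cancel-≤ : ∀ {i j} → scalar i ≤ scalar j → i ℤ.≤ j
  scalar-cancel-≤ i≤j = ℤ.≮⇒≥ (i≤j ∘ scalar-mono-<)

  scalar-injective : ∀ {i j} → scalar i ≈ scalar j → i ≡ j
  scalar-injective eq = ℤ.≤-antisym (scalar-cancel-≤ (≈⇒≤ eq)) (scalar-cancel-≤ (≈⇒≤ (sym eq)))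

  pos⇒inverse : ∀ {x} → 0# < x → ∃ λ y → x * y ≈ 1# × 0# ≤ y
  pos⇒inverse {x} 0<x with #0⇒inverse (#-sym (<⇒# 0<x))
  ... | y , xy≈1 = y , xy≈1 , λ y<0 → <-asym 0<1 (<-unshift (<-respʳ
    (trans (solve 2 (λ x y → x :* :- y := :- (x :* y)) refl x y) (trans (-‿cong xy≈1)
      (sym (+-identityˡ _)))) (*-pos 0<x (neg-pos y<0))))

-- Kept as an integer vector because it serves both as a point of the polytope and as the exponent
-- of a variable.
unit : ∀ {r} → Sign × Fin r → Exponent r
unit (Sign.+ , k) = basis k
unit (Sign.- , k) = Vec.map ℤ.-_ (basis k)

-- Convex hulls as inductively generated cones.

module Convexity {c ℓ₁ ℓ₂ ℓ₃} (F : OrderedField c ℓ₁ ℓ₂ ℓ₃) (r : ℕ) where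
  open OrderedField F hiding (zero)
  open OrderedFieldProperties F
  open Polytope F r

  private variable
    ℓ ℓ′ : Level
    S T : Pred Point ℓ
    p q : Point
    α β : Carrier

  0ₚ : Point
  0ₚ _ = 0#

  -- Nonnegative combinations of points of S with total weight α. The weight is left free because
  -- removing one term from a convex combination leaves a combination whose weight is no longer 1.
  data Cone (S : Pred Point ℓ) : Carrier → Point → Set (c ⊔ ℓ₁ ⊔ ℓ₃ ⊔ ℓ) where
    nil  : α ≈ 0# → p ≋ 0ₚ → Cone S α p
    cons : ∀ {w x} → 0# ≤ w → S x → Cone S β q → α ≈ w + β → p ≋ w · x +ₚ q → Cone S α p

  conv⇒hull : conv S p → Cone S 1# p
  conv⇒hull (n , w , x , 0≤w , Σw≈1 , Sx , eq) = go w x 0≤w Σw≈1 Sx eq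
    where
    go : ∀ {n} (w : Vector Carrier n) (x : Vector Point n) → (∀ i → 0# ≤ w i) → sum w ≈ α →
         (∀ i → S (x i)) → p ≋ ∑ (λ i → w i · x i) → Cone S α p
    go {n = zero}  w x 0≤w Σw Sx eq = nil (sym Σw) eq
    go {n = suc n} w x 0≤w Σw Sx eq = cons (0≤w zero) (Sx zero)
      (go (w ∘ suc) (x ∘ suc) (0≤w ∘ suc) refl (Sx ∘ suc) (λ _ → refl)) (sym Σw) eq

  hull⇒conv : Cone S 1# p → conv S p
  hull⇒conv = go
    where
    go : Cone S α p → ∃ λ n → Σ (Vector Carrier n) λ w → Σ (Vector Point n) λ q →
      (∀ i → 0# ≤ w i) × sum w ≈ α × (∀ i → S (q i)) × p ≋ ∑ (λ i → w i · q i)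
    go (nil α≈0 p≋0) = 0 , (λ ()) , (λ ()) , (λ ()) , sym α≈0 , (λ ()) , p≋0
    go (cons {w = w} {x = x} 0≤w Sx C α≈ p≋) with go C
    ... | n , ws , xs , 0≤ws , Σws , Sxs , q≋ =
      suc n , w Vector.∷ ws , x Vector.∷ xs ,
      (λ { zero → 0≤w ; (suc i) → 0≤ws i }) ,
      trans (+-congˡ Σws) (sym α≈) ,
      (λ { zero → Sx ; (suc i) → Sxs i }) ,
      λ k → trans (p≋ k) (+-congˡ (q≋ k))

  cone-resp : α ≈ β → p ≋ q → Cone S α p → Cone S β q
  cone-resp α≈β p≋q (nil α≈0 p≋0) = nil (trans (sym α≈β) α≈0) (λ k → trans (sym (p≋q k)) (p≋0 k))
  cone-resp α≈β p≋q (cons 0≤w Sx C α≈ p≋) =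
    cons 0≤w Sx C (trans (sym α≈β) α≈) (λ k → trans (sym (p≋q k)) (p≋ k))

  cone-+ : Cone S α p → Cone S β q → Cone S (α + β) (p +ₚ q)
  cone-+ (nil α≈0 p≋0) C = cone-resp
    (sym (trans (+-congʳ α≈0) (+-identityˡ _)))
    (λ k → sym (trans (+-congʳ (p≋0 k)) (+-identityˡ _))) C
  cone-+ (cons 0≤w Sx C α≈ p≋) C′ = cons 0≤w Sx (cone-+ C C′)
    (trans (+-congʳ α≈) (+-assoc _ _ _)) (λ k → trans (+-congʳ (p≋ k)) (+-assoc _ _ _))

  cone-· : ∀ {s} → 0# ≤ s → Cone S α p → Cone S (s * α) (s · p)
  cone-· {s = s} 0≤s (nil α≈0 p≋0) =
    nil (trans (*-congˡ α≈0) (zeroʳ s)) (λ k → trans (*-congˡ (p≋0 k)) (zeroʳ s))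
  cone-· {s = s} 0≤s (cons {w = w} {x = x} 0≤w Sx C α≈ p≋) =
    cons (*-nonNeg 0≤s 0≤w) Sx (cone-· 0≤s C)
      (trans (*-congˡ α≈) (distribˡ _ _ _))
      (λ k → trans (*-congˡ (p≋ k)) (trans (distribˡ _ _ _) (+-congʳ (sym (*-assoc s w (x k))))))

  Hull : Pred Point ℓ → Pred Point _
  Hull S = Cone S 1#

  hull-resp : p ≋ q → Hull S p → Hull S q
  hull-resp = cone-resp refl

  hull-return : S p → Hull S p
  hull-return Sp = cons 0≤1 Sp (nil refl (λ _ → refl)) (sym (+-identityʳ _))
    (λ k → sym (trans (+-identityʳ _) (*-identityˡ _)))

  -- Allows a point of a hull to be treated as if it were a generator, also when v is added to it: a
  -- part of weight α carries α · v, and the weights add up to 1.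
  hull-bind : ∀ v → (∀ {x} → S x → Hull T (x +ₚ v)) → Hull S p → Hull T (p +ₚ v)
  hull-bind {S = S} {T = T} v f C =
    (cone-resp refl (λ k → +-congˡ (*-identityˡ _)) (go C))
    where
    go : Cone S α p → Cone T α (p +ₚ α · v)
    go (nil α≈0 p≋0) = nil α≈0 λ k →
      trans (+-cong (p≋0 k) (trans (*-congʳ α≈0) (zeroˡ _))) (+-identityˡ _)
    go {α = α} (cons {β = β} {q = q} {w = w} {x = x} 0≤w Sx C α≈ p≋) = cone-resp
      (trans (+-congʳ (*-identityʳ w)) (sym α≈))
      (λ k → trans
        (solve 5 (λ w x v q β → w :* (x :+ v) :+ (q :+ β :* v) := (w :* x :+ q) :+ (w :+ β) :* v)
          refl w (x k) (v k) (q k) β)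
        (sym (+-cong (p≋ k) (*-congʳ α≈))))
      (cone-+ (cone-· 0≤w (f Sx)) (go C))

  hull-join : (∀ {x} → S x → Hull T x) → Hull S p → Hull T p
  hull-join f C = hull-resp (λ k → +-identityʳ _)
    (hull-bind 0ₚ (λ Sx → hull-resp (λ k → sym (+-identityʳ _)) (f Sx)) C)

  hull-mono : (∀ {x} → S x → T x) → Hull S p → Hull T p
  hull-mono f = hull-join (hull-return ∘ f)

  hull-combine : ∀ {a b x} → 0# ≤ a → 0# ≤ b → a + b ≈ 1# → Hull S p → Hull S q →
                 x ≋ a · p +ₚ b · q → Hull S x
  hull-combine {a = a} {b} 0≤a 0≤b a+b≈1 Cp Cq x≋ = (cone-resp
    (trans (+-cong (*-identityʳ a) (*-identityʳ b)) a+b≈1) (λ k → sym (x≋ k))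
    (cone-+ (cone-· 0≤a Cp) (cone-· 0≤b Cq)))

  hull-segment : ∀ {s x} → 0# ≤ s → s ≤ 1# → Hull S p → Hull S q →
                 x ≋ (1# - s) · p +ₚ s · q → Hull S x
  hull-segment {s = s} 0≤s s≤1 = hull-combine (≤⇒0≤- s≤1) 0≤s
    (solve 1 (λ s → con (+ 1) :- s :+ s := con (+ 1)) refl s)

  -- The point divides the segment in the ratio κ / h; positivity of h provides the inverse.
  hull-between : ∀ {h κ} d → 0# < h → 0# ≤ κ → κ ≤ h →
                 Hull S p → Hull S (p +ₚ h · d) → Hull S (p +ₚ κ · d)
  hull-between {p = p} {h = h} {κ} d 0<h 0≤κ κ≤h C C′ with pos⇒inverse 0<h
  ... | g , hg≈1 , 0≤g = hull-segment {s = κ * g} (*-nonNeg 0≤κ 0≤g)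
    (0≤-⇒≤ (≤-respʳ (trans (solve 3 (λ h κ g → (h :- κ) :* g := h :* g :- κ :* g) refl h κ g) (+-congʳ hg≈1))
      (*-nonNeg (≤⇒0≤- κ≤h) 0≤g)))
    C C′ (λ k → sym (trans
      (solve 5 (λ h κ g p d → (con (+ 1) :- κ :* g) :* p :+ κ :* g :* (p :+ h :* d) :=
                              p :+ κ :* (h :* g) :* d) refl h κ g (p k) (d k))
      (+-congˡ (*-congʳ (trans (*-congˡ hg≈1) (*-identityʳ κ))))))

  fromℤ≈scalar : ∀ i → fromℤ i ≈ scalar i
  fromℤ≈scalar (+ n)    = refl
  fromℤ≈scalar -[1+ n ] = refl

-- Points given by an ordering of signed basis vectors.

module Ranking {c ℓ₁ ℓ₂ ℓ₃} (F : OrderedField c ℓ₁ ℓ₂ ℓ₃) (r : ℕ) where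
  open OrderedField F hiding (zero)
  open OrderedFieldProperties F
  open Polytope F r
  open Convexity F r

  fromℤ-neg : ∀ i → fromℤ (ℤ.- i) ≈ - fromℤ i
  fromℤ-neg i = trans (fromℤ≈scalar (ℤ.- i)) (trans (scalar-neg i) (-‿cong (sym (fromℤ≈scalar i))))

  fromℤ-+ : ∀ i j → fromℤ (i ℤ.+ j) ≈ fromℤ i + fromℤ j
  fromℤ-+ i j = trans (fromℤ≈scalar (i ℤ.+ j)) (trans (scalar-+ i j)
    (sym (+-cong (fromℤ≈scalar i) (fromℤ≈scalar j))))

  fromℤ-* : ∀ i j → fromℤ (i ℤ.* j) ≈ fromℤ i * fromℤ j
  fromℤ-* i j = trans (fromℤ≈scalar (i ℤ.* j)) (trans (scalar-* i j)
    (sym (*-cong (fromℤ≈scalar i) (fromℤ≈scalar j))))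

  vec : Sign × Fin r → Point
  vec o = fromExponent (unit o)

  vec-neg : ∀ (o : Sign × Fin r) → vec (Sign.opposite (proj₁ o) , proj₂ o) ≋ -ₚ vec o
  vec-neg (Sign.+ , k) i = trans (reflexive (≡.cong fromℤ (Vec.lookup-map i ℤ.-_ (basis k))))
    (fromℤ-neg (Vec.lookup (basis k) i))
  vec-neg (Sign.- , k) i = trans
    (sym (solve 1 (λ x → :- :- x := x) refl _)) (-‿cong (sym (vec-neg (Sign.+ , k) i)))

  value : ℕ → ℕ → Carrier
  value c l = fromℤ (+ (c ℕ.+ 2 ℕ.* l))

  -- The head of the list carries the largest coefficient, the last element c.
  rank : ℕ → List (Sign × Fin r) → Point
  rank c []      = 0ₚ
  rank c (o ∷ L) = value c (length L) · vec o +ₚ rank c L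

  two : Carrier
  two = 1# + 1#

  0<two : 0# < two
  0<two = +-pos 0<1 0<1

  value-suc : ∀ c l → value c (suc l) ≈ value c l + two
  value-suc c l = trans
    (reflexive (≡.cong (λ m → fromℤ (+ m)) (≡.trans (≡.cong (c ℕ.+_) (ℕ.*-suc 2 l))
      (≡.trans (≡.sym (ℕ.+-assoc c 2 _)) (≡.trans (≡.cong (ℕ._+ 2 ℕ.* l) (ℕ.+-comm c 2))
          (ℕ.+-assoc 2 c _))))))
    (solve 1 (λ x → con (+ 1) :+ (con (+ 1) :+ x) := x :+ con (+ 2)) refl _)

  fromℕ-nonNeg : ∀ n → 0# ≤ fromℤ (+ n)
  fromℕ-nonNeg n = ≤-respʳ (sym (fromℤ≈scalar (+ n))) (scalar-nonNeg n)

  fromℕ-pos : ∀ n → 0# < fromℤ (+ suc n)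
  fromℕ-pos n = <-respʳ (sym (fromℤ≈scalar (+ suc n))) (scalar-pos n)

  value-nonNeg : ∀ c l → 0# ≤ value c l
  value-nonNeg c l = fromℕ-nonNeg (c ℕ.+ 2 ℕ.* l)

  value-+ : ∀ c k l → value c (k ℕ.+ l) ≈ value c l + (fromℤ (+ k) + fromℤ (+ k))
  value-+ c zero    l = solve 1 (λ x → x := x :+ (con (+ 0) :+ con (+ 0))) refl _
  value-+ c (suc k) l = trans (value-suc c (k ℕ.+ l)) (trans (+-congʳ (value-+ c k l))
    (solve 2 (λ v k → v :+ (k :+ k) :+ con (+ 2) :=
                      v :+ (con (+ 1) :+ k :+ (con (+ 1) :+ k))) refl _ _))

  length-middle : ∀ {A : Set} (xs : List A) {y z : A} ys →
    length (xs ++ y ∷ ys) ≡ length (xs ++ z ∷ ys)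
  length-middle []       ys = ≡.refl
  length-middle (x ∷ xs) ys = ≡.cong suc (length-middle xs ys)

  -- A coefficient depends only on how many vectors follow, so exchanging one vector for another
  -- leaves all coefficients in place.
  rank-middle : ∀ c A n o B →
    rank c (A ++ n ∷ B) ≋ rank c (A ++ o ∷ B) +ₚ value c (length B) · (vec n -ₚ vec o)
  rank-middle c []      n o B k =
    solve 4 (λ v n o R → v :* n :+ R := v :* o :+ R :+ v :* (n :- o)) refl _ _ _ _
  rank-middle c (a ∷ A) n o B k = trans
    (+-cong (*-congʳ (reflexive (≡.cong (value c) (length-middle A {n} {o} B)))) (rank-middle c A n o B k))
    (sym (+-assoc _ _ _))

  -- For c = t + 1 and `xs` all coordinates these are points of the orbit of `top`; shorter lists
  -- are the stages of the induction.
  Ranked : ℕ → List (Fin r) → Pred Point _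
  Ranked c xs p = ∃ λ L → List.map proj₂ L ↭ xs × p ≋ rank c L

  -- The coefficients (M , m + 2) of o and n lie on the segment from
  -- (M + 2 , m) to (m , M + 2).
  raise-middle : ∀ c xs (A : List (Sign × Fin r)) n o B →
    List.map proj₂ (A ++ n ∷ B) ↭ proj₂ n ∷ xs →
    Hull (Ranked c (proj₂ n ∷ proj₂ o ∷ xs))
         (value c (length (A ++ B)) · vec o +ₚ rank c (A ++ n ∷ B) +ₚ two · vec n)
  raise-middle c xs A n o B perm = hull-resp total
    (hull-between {κ = two} (vec n -ₚ vec o) 0<h (<⇒≤ 0<two) two≤h
      (hull-return (o ∷ A ++ n ∷ B , ↭-trans (prep _ perm) (swap _ _ ↭-refl) , λ _ → refl))
      (hull-return (n ∷ A ++ o ∷ B , prep _ permo , swapped)))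
    where
    a = length A
    -- There are a vectors between o and n, so their coefficients differ by 2(a + 1). This is the
    -- length of the full exchange, of which only 2 is wanted.
    h = fromℤ (+ suc a) + fromℤ (+ suc a)

    0<h : 0# < h
    0<h = +-pos (fromℕ-pos a) (fromℕ-pos a)

    two≤h : two ≤ h
    two≤h = 0≤-⇒≤ (≤-respʳ
      (solve 1 (λ x → x :+ x := con (+ 1) :+ x :+ (con (+ 1) :+ x) :- con (+ 2)) refl (fromℤ (+ a)))
      (+-nonNeg (fromℕ-nonNeg a) (fromℕ-nonNeg a)))

    permo : List.map proj₂ (A ++ o ∷ B) ↭ proj₂ o ∷ xs
    permo = ↭-trans (↭-reflexive (List.map-++ proj₂ A (o ∷ B)))
      (↭-trans (shift (proj₂ o) (List.map proj₂ A) (List.map proj₂ B))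
        (prep _ (drop-∷ (↭-trans (↭-sym (shift (proj₂ n) (List.map proj₂ A) (List.map proj₂ B)))
          (↭-trans (↭-reflexive (≡.sym (List.map-++ proj₂ A (n ∷ B)))) perm)))))

    length-A++B : ∀ m → length (A ++ m ∷ B) ≡ suc a ℕ.+ length B
    length-A++B m = ≡.trans (List.length-++ A) (ℕ.+-suc a (length B))

    top-value : ∀ m → value c (length (A ++ m ∷ B)) ≈ value c (length B) + h
    top-value m = trans (reflexive (≡.cong (value c) (length-A++B m))) (value-+ c (suc a) (length B))

    swapped : rank c (o ∷ A ++ n ∷ B) +ₚ h · (vec n -ₚ vec o) ≋ rank c (n ∷ A ++ o ∷ B)
    swapped k = trans
      (+-congʳ (+-cong (*-congʳ (top-value n)) (rank-middle c A n o B k)))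
      (trans (solve 5 (λ v h n o R → (v :+ h) :* o :+ (R :+ v :* (n :- o)) :+ h :* (n :- o) := (v :+ h) :*
          n :+ R)
        refl (value c (length B)) h (vec n k) (vec o k) _)
      (+-congʳ (*-congʳ (sym (top-value o)))))

    total : rank c (o ∷ A ++ n ∷ B) +ₚ two · (vec n -ₚ vec o) ≋
            value c (length (A ++ B)) · vec o +ₚ rank c (A ++ n ∷ B) +ₚ two · vec n
    total k = trans
      (+-congʳ (+-congʳ (*-congʳ (trans (reflexive (≡.cong (value c)
        (≡.trans (length-A++B n) (≡.cong suc (≡.sym (List.length-++ A))))))
            (value-suc c (length (A ++ B)))))))
      (solve 4 (λ v n o R → (v :+ con (+ 2)) :* o :+ R :+ con (+ 2) :* (n :- o) :=
                 v :* o :+ R :+ con (+ 2) :* n) refl _ (vec n k) (vec o k) _)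

  -- Lies between the raised n and the raised opposite of n.
  lower-middle : ∀ c xs (A : List (Sign × Fin r)) n o B →
    List.map proj₂ (A ++ n ∷ B) ↭ proj₂ n ∷ xs →
    Hull (Ranked c (proj₂ n ∷ proj₂ o ∷ xs))
         (value c (length (A ++ B)) · vec o +ₚ rank c (A ++ n ∷ B) +ₚ - two · vec n)
  lower-middle c xs A n o B perm = hull-resp
    (λ k → solve 4 (λ M R n m → M :+ R :- (m :+ m :+ con (+ 2)) :* n :+ (m :+ m) :* n :=
                                M :+ R :+ :- con (+ 2) :* n) refl _ _ (vec n k) m)
    -- Along `vec n` the three coefficients are -(m + 2), m - 2 and m + 2, so the step is 2m out of
    -- 2m + 4.
    (hull-between {h = m + m + (two + two)} {κ = m + m} (vec n)
      (+-nonNeg-pos 0≤2m (+-pos 0<two 0<two)) 0≤2m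
      (0≤-⇒≤ (≤-respʳ (solve 2 (λ m t → t :+ t := m :+ m :+ (t :+ t) :- (m :+ m)) refl m two)
        (<⇒≤ (+-pos 0<two 0<two))))
      (hull-resp (λ k → trans (+-cong (+-congˡ (rank-middle c A n⁻ n B k)) (*-congˡ (vec-neg n k)))
          (trans (+-congʳ (+-congˡ (+-congˡ (*-congˡ (+-congʳ (vec-neg n k))))))
            (solve 4 (λ M R n m → M :+ (R :+ m :* (:- n :- n)) :+ con (+ 2) :* :- n :=
              M :+ R :- (m :+ m :+ con (+ 2)) :* n) refl _ _ (vec n k) m)))
        (raise-middle c xs A n⁻ o B perm⁻))
      (hull-resp (λ k → solve 4 (λ M R n m → M :+ R :+ con (+ 2) :* n :=
          M :+ R :- (m :+ m :+ con (+ 2)) :* n :+ (m :+ m :+ (con (+ 2) :+ con (+ 2))) :* n)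
          refl _ _ (vec n k) m)
        (raise-middle c xs A n o B perm)))
    where
    m = value c (length B)
    0≤2m = +-nonNeg (value-nonNeg c (length B)) (value-nonNeg c (length B))
    n⁻ = Sign.opposite (proj₁ n) , proj₂ n
    perm⁻ : List.map proj₂ (A ++ n⁻ ∷ B) ↭ proj₂ n ∷ xs
    perm⁻ = ≡.subst (_↭ proj₂ n ∷ xs)
      (≡.trans (List.map-++ proj₂ A (n ∷ B)) (≡.sym (List.map-++ proj₂ A (n⁻ ∷ B)))) perm

-- Adding one vector to an ordering: the segments of the zonotope.

module Zonotopes {c ℓ₁ ℓ₂ ℓ₃} (F : OrderedField c ℓ₁ ℓ₂ ℓ₃) (r : ℕ) where
  open OrderedField F hiding (zero)
  open OrderedFieldProperties F
  open Polytope F r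
  open Convexity F r
  open Ranking F r

  private variable
    ℓ : Level
    S : Pred Point ℓ
    p q u v : Point
    n : ℕ

  PairSegments : Point → Point → Pred Point _
  PairSegments u v = segment (-ₚ (u -ₚ v)) (u -ₚ v) ⊕ segment (-ₚ (u +ₚ v)) (u +ₚ v)

  -- Scale and vectors are variable so that vectors can be split off and constants added one by one.
  -- For `fromℤ (+ (t + 1))` and `e` it unfolds to `zonotope t`.
  Zonotope : Carrier → Vector Point n → Pred Point _
  Zonotope τ u =
    ⨁ (λ k → segment (-ₚ (τ · u k)) (τ · u k))
    ⊕
    ⨁ (λ l → ⨁ (λ k′ → PairSegments (u (inject {i = l} k′)) (u l)))

  -- The pairs that involve vector 0 stand at the head of every inner sum except the empty one at l
  -- = 0; they are gathered into y.
  uncons : ∀ {τ} {u : Vector Point (suc n)} → Zonotope τ u p →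
    ∃ λ x → ∃ λ y → ∃ λ q →
      segment (-ₚ (τ · u zero)) (τ · u zero) x ×
      (∀ l → PairSegments (u zero) (u (suc l)) (y l)) ×
      Zonotope τ (u ∘ suc) q × p ≋ x +ₚ (∑ y +ₚ q)
  uncons {u = u} (a , b , (as , as∈ , a≋) , (bs , bs∈ , b≋) , p≋) =
    as zero , (λ l → proj₁ (bs∈ (suc l)) zero) , ∑ (as ∘ suc) +ₚ ∑ rest ,
    as∈ zero , (λ l → proj₁ (proj₂ (bs∈ (suc l))) zero) ,
    (∑ (as ∘ suc) , ∑ rest , (as ∘ suc , as∈ ∘ suc , λ _ → refl) ,
      (rest , (λ l → (λ k′ → proj₁ (bs∈ (suc l)) (suc k′)) , (λ k′ → proj₁ (proj₂ (bs∈ (suc l))) (suc k′))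
          , λ _ → refl) , λ _ → refl) ,
      λ _ → refl) ,
    λ k → trans (p≋ k) (trans (+-cong (a≋ k) (trans (b≋ k) (+-cong (proj₂ (proj₂ (bs∈ zero)) k)
      (trans (sum-cong-≋ (λ l → proj₂ (proj₂ (bs∈ (suc l))) k)) (∑-distrib-+ _ (λ l → rest l k))))))
      (solve 4 (λ x a y b → x :+ a :+ (con (+ 0) :+ (y :+ b)) := x :+ (y :+ (a :+ b))) refl _ _ _ _))
    where
    rest : ∀ l → Point
    rest l = ∑ (λ k′ → proj₁ (bs∈ (suc l)) (suc k′))

  cons-zonotope : ∀ {τ x} {u : Vector Point (suc n)} {y : Vector Point n} →
    segment (-ₚ (τ · u zero)) (τ · u zero) x →
    (∀ l → PairSegments (u zero) (u (suc l)) (y l)) →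
    Zonotope τ (u ∘ suc) q → p ≋ x +ₚ (∑ y +ₚ q) → Zonotope τ u p
  cons-zonotope {x = x} {u = u} {y = y} x∈ y∈ (a , b , (as , as∈ , a≋) , (bs , bs∈ , b≋) , q≋) p≋ =
    x +ₚ a , ∑ y +ₚ b ,
    ((λ { zero → x ; (suc k) → as k }) , (λ { zero → x∈ ; (suc k) → as∈ k }) , λ k → +-congˡ (a≋ k)) ,
    ((λ { zero → 0ₚ ; (suc l) → y l +ₚ bs l }) ,
      (λ { zero → (λ ()) , (λ ()) , λ _ → refl
         ; (suc l) → (λ { zero → y l ; (suc k′) → proj₁ (bs∈ l) k′ }) ,
                     (λ { zero → y∈ l ; (suc k′) → proj₁ (proj₂ (bs∈ l)) k′ }) ,
                     λ k → +-congˡ (proj₂ (proj₂ (bs∈ l)) k) }) ,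
      λ k → trans (+-congˡ (b≋ k)) (sym (trans (+-identityˡ _) (∑-distrib-+ (λ l → y l k) (λ l → bs l k))))) ,
    λ k → trans (p≋ k) (trans (+-congˡ (+-congˡ (q≋ k)))
      (solve 4 (λ x y a b → x :+ (y :+ (a :+ b)) := x :+ a :+ (y :+ b)) refl _ _ _ _))

  -- The sums of end points of the two segments are ±2u and ±2v, the corners of a parallelogram.
  -- Hence it is enough to move a single coefficient by 2.
  hull-pair : PairSegments u v p →
    Hull S (q +ₚ two · u) → Hull S (q +ₚ - two · u) →
    Hull S (q +ₚ two · v) → Hull S (q +ₚ - two · v) → Hull S (q +ₚ p)
  hull-pair {u = u} {v} {q = q} (a , b , (s , 0≤s , s≤1 , a≋) , (s′ , 0≤s′ , s′≤1 , b≋) , p≋) u⁺ u⁻ v⁺ v⁻ =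
    hull-segment 0≤s s≤1
      (hull-segment 0≤s′ s′≤1 u⁻ v⁺ λ _ → refl)
      (hull-segment 0≤s′ s′≤1 v⁻ u⁺ λ _ → refl)
      λ k → trans (+-congˡ (trans (p≋ k) (+-cong (a≋ k) (b≋ k))))
        (solve 5 (λ s t q u v →
          q :+ ((con (+ 1) :- s) :* (:- (u :- v)) :+ s :* (u :- v) :+
            ((con (+ 1) :- t) :* (:- (u :+ v)) :+ t :* (u :+ v))) :=
          (con (+ 1) :- s) :* ((con (+ 1) :- t) :* (q :+ :- con (+ 2) :* u) :+ t :* (q :+ con (+ 2) :* v)) :+
          s :* ((con (+ 1) :- t) :* (q :+ :- con (+ 2) :* v) :+ t :* (q :+ con (+ 2) :* u)))
          refl s s′ (q k) (u k) (v k))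

  -- Orderings carry signed vectors, segments the plain ones; a negative sign exchanges the two
  -- shifts.
  unsign : ∀ (o : Sign × Fin r) →
    Hull S (q +ₚ two · vec o) → Hull S (q +ₚ - two · vec o) →
    Hull S (q +ₚ two · e (proj₂ o)) × Hull S (q +ₚ - two · e (proj₂ o))
  unsign (Sign.+ , k) raised lowered = raised , lowered
  unsign (Sign.- , k) raised lowered =
    hull-resp (λ i → +-congˡ (trans (*-congˡ (vec-neg (Sign.+ , k) i))
      (solve 1 (λ x → :- con (+ 2) :* :- x := con (+ 2) :* x) refl _))) lowered ,
    hull-resp (λ i → +-congˡ (trans (*-congˡ (vec-neg (Sign.+ , k) i))
      (solve 1 (λ x → con (+ 2) :* :- x := :- con (+ 2) :* x) refl _))) raised

  ∑ₗ : (Fin r → Point) → List (Fin r) → Point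
  ∑ₗ f []       = 0ₚ
  ∑ₗ f (k ∷ ks) = f k +ₚ ∑ₗ f ks

  ∑ₗ-↭ : ∀ f {ks ls} → ks ↭ ls → ∑ₗ f ks ≋ ∑ₗ f ls
  ∑ₗ-↭ f ↭.refl         i = refl
  ∑ₗ-↭ f (prep k p)     i = +-congˡ (∑ₗ-↭ f p i)
  ∑ₗ-↭ f (swap k l p)   i = trans (+-congˡ (+-congˡ (∑ₗ-↭ f p i)))
    (solve 3 (λ x y z → x :+ (y :+ z) := y :+ (x :+ z)) refl _ _ _)
  ∑ₗ-↭ f (↭.trans p p′) i = trans (∑ₗ-↭ f p i) (∑ₗ-↭ f p′ i)

  -- Induction that sets aside the vector o of largest coefficient M. At the four corners of the
  -- pair (m, o), the shifted o goes to the top, where ±(M + 2) is available, and a shifted m is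
  -- handled by `raise-middle` or `lower-middle`. For empty L only the segment of m remains, between
  -- -c and c.
  insert-ranked : ∀ c m (x : Point) (f : Fin r → Point) L →
    segment (-ₚ (fromℤ (+ c) · e m)) (fromℤ (+ c) · e m) x →
    (∀ o → o ∈ L → PairSegments (e m) (e (proj₂ o)) (f (proj₂ o))) →
    Hull (Ranked c (m ∷ List.map proj₂ L)) (rank c L +ₚ (x +ₚ ∑ₗ f (List.map proj₂ L)))
  insert-ranked c m x f [] (s , 0≤s , s≤1 , x≋) f∈ = hull-segment 0≤s s≤1
    (hull-return ((Sign.- , m) ∷ [] , ↭-refl , λ _ → refl))
    (hull-return ((Sign.+ , m) ∷ [] , ↭-refl , λ _ → refl))
    λ k → trans (+-congˡ (+-congʳ (x≋ k))) (trans
      (solve 3 (λ s C e → con (+ 0) :+ ((con (+ 1) :- s) :* (:- (C :* e)) :+ s :* (C :* e) :+ con (+ 0)) :=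
        (con (+ 1) :- s) :* (C :* (:- e) :+ con (+ 0)) :+ s :* (C :* e :+ con (+ 0))) refl s (fromℤ (+ c))
            (e m k))
      (+-cong (*-congˡ (+-congʳ (*-cong C≡ (sym (vec-neg (Sign.+ , m) k)))))
          (*-congˡ (+-congʳ (*-congʳ C≡)))))
    where
    C≡ : fromℤ (+ c) ≈ value c 0
    C≡ = reflexive (≡.cong (λ n → fromℤ (+ n)) (≡.sym (ℕ.+-identityʳ c)))
  insert-ranked c m x f (o ∷ L) x∈ f∈ = hull-resp
    (λ k → solve 5 (λ M R x y S → M :+ (R :+ (x :+ S)) :+ y := M :+ R :+ (x :+ (y :+ S))) refl _ _ _ _ _)
    (hull-pair (f∈ o (here ≡.refl)) (proj₁ m±) (proj₂ m±) (proj₁ o±) (proj₂ o±))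
    where
    xs = List.map proj₂ L
    M = value c (length L)
    base = rank c L +ₚ (x +ₚ ∑ₗ f xs)
    T = Ranked c (m ∷ proj₂ o ∷ xs)

    rec : Hull (Ranked c (m ∷ xs)) base
    rec = insert-ranked c m x f L x∈ (λ o′ o′∈ → f∈ o′ (there o′∈))

    value-length : ∀ L′ → List.map proj₂ L′ ↭ m ∷ xs → value c (length L′) ≈ M + two
    value-length L′ perm = trans (reflexive (≡.cong (value c) (≡.trans (≡.sym (List.length-map proj₂ L′))
      (≡.trans (↭-length perm) (≡.cong suc (List.length-map proj₂ L)))))) (value-suc c (length L))

    prepend : ∀ o′ → proj₂ o′ ≡ proj₂ o → Hull T (base +ₚ (M + two) · vec o′)
    prepend o′ eq = hull-bind _ (λ { {y} (L′ , perm , y≋) → hull-return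
      (o′ ∷ L′ , ↭-trans (↭-trans (↭-reflexive (≡.cong (_∷ _) eq)) (prep _ perm)) (swap _ _ ↭-refl) ,
       λ k → trans (+-comm _ _) (+-cong (*-congʳ (sym (value-length L′ perm))) (y≋ k))) }) rec

    shift-o : ∀ κ → 0# ≤ M + two + κ → κ ≤ two → Hull T (M · vec o +ₚ base +ₚ κ · vec o)
    shift-o κ 0≤ κ≤two = hull-resp
      (λ k → trans (+-congʳ (+-congˡ (*-congˡ (vec-neg o k))))
        (solve 4 (λ B M κ o → B :+ (M :+ con (+ 2)) :* :- o :+ (M :+ M :+ con (+ 2) :+ κ) :* o :=
                              M :* o :+ B :+ κ :* o) refl (base k) M κ (vec o k)))
      -- The wanted coefficient M + κ of o lies between -(M + 2) and M + 2, the two values that a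
      -- top position allows.
      (hull-between {h = M + two + (M + two)} {κ = M + M + two + κ} (vec o)
        (+-pos 0<M+2 0<M+2)
        (≤-respʳ (solve 2 (λ M κ → M :+ (M :+ con (+ 2) :+ κ) := M :+ M :+ con (+ 2) :+ κ) refl M κ)
          (+-nonNeg (value-nonNeg c (length L)) 0≤))
        (0≤-⇒≤ (≤-respʳ (solve 2 (λ M κ → con (+ 2) :- κ := M :+ con (+ 2) :+ (M :+ con (+ 2)) :-
            (M :+ M :+ con (+ 2) :+ κ)) refl M κ)
          (≤⇒0≤- κ≤two)))
        (prepend (Sign.opposite (proj₁ o) , proj₂ o) ≡.refl)
        (hull-resp (λ k → trans (solve 3 (λ B M o → B :+ (M :+ con (+ 2)) :* o :=
             B :+ (M :+ con (+ 2)) :* :- o :+ (M :+ con (+ 2) :+ (M :+ con (+ 2))) :* o) refl (base k) M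
                 (vec o k))
             (+-congʳ (+-congˡ (*-congˡ (sym (vec-neg o k))))))
          (prepend o ≡.refl)))
      where
      0<M+2 = +-nonNeg-pos (value-nonNeg c (length L)) 0<two

    o± = unsign o
      (shift-o two (+-nonNeg (+-nonNeg (value-nonNeg c (length L)) (<⇒≤ 0<two)) (<⇒≤ 0<two)) (≈⇒≤ refl))
      (shift-o (- two) (≤-respʳ (solve 1 (λ M → M := M :+ con (+ 2) :+ :- con (+ 2)) refl M)
          (value-nonNeg c (length L)))
        (0≤-⇒≤ (≤-respʳ (solve 0 (con (+ 2) :+ con (+ 2) := con (+ 2) :- :- con (+ 2)) refl)
          (<⇒≤ (+-pos 0<two 0<two)))))

    shift-m : ∀ {y} → Ranked c (m ∷ xs) y →
      Hull T (y +ₚ (M · vec o +ₚ two · e m)) × Hull T (y +ₚ (M · vec o +ₚ - two · e m))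
    -- The position of m differs from one generator of the hull to the next, so each ordering is
    -- split at its own occurrence of m.
    shift-m {y} (L′ , perm , y≋) with ∈-map⁻ proj₂ (∈-resp-↭ (↭-sym perm) (here ≡.refl))
    ... | ν , ν∈L′ , ≡.refl with ∈-∃++ ν∈L′
    ...   | A , B , ≡.refl = hull-resp assoc (proj₁ ν±) , hull-resp assoc (proj₂ ν±)
      where
      length-AB : length (A ++ B) ≡ length L
      length-AB = ℕ.suc-injective (≡.trans (≡.cong suc (List.length-++ A))
        (≡.trans (≡.sym (ℕ.+-suc (length A) (length B))) (≡.trans (≡.sym (List.length-++ A))
        (≡.trans (≡.sym (List.length-map proj₂ (A ++ ν ∷ B)))
            (≡.trans (↭-length perm) (≡.cong suc (List.length-map proj₂ L)))))))
      ν± = unsign ν (raise-middle c xs A ν o B perm) (lower-middle c xs A ν o B perm)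
      assoc : ∀ {z} → value c (length (A ++ B)) · vec o +ₚ rank c (A ++ ν ∷ B) +ₚ z ≋ y +ₚ (M · vec o +ₚ z)
      assoc k = trans (+-congʳ (trans (+-comm _ _)
          (+-cong (sym (y≋ k)) (*-congʳ (reflexive (≡.cong (value c) length-AB))))))
        (+-assoc _ _ _)

    m± : Hull T (M · vec o +ₚ base +ₚ two · e m) × Hull T (M · vec o +ₚ base +ₚ - two · e m)
    m± = hull-resp reorder (hull-bind _ (proj₁ ∘ shift-m) rec) ,
         hull-resp reorder (hull-bind _ (proj₂ ∘ shift-m) rec)
      where
      reorder : ∀ {z} → base +ₚ (M · vec o +ₚ z) ≋ M · vec o +ₚ base +ₚ z
      reorder k = solve 3 (λ B M z → B :+ (M :+ z) := M :+ B :+ z) refl _ _ _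

-- Orderings of signed basis vectors correspond to signed permutations.

module SignedRankings {r : ℕ} where

  exponent-ext : {m n : Exponent r} → (∀ k → Vec.lookup m k ≡ Vec.lookup n k) → m ≡ n
  exponent-ext {m} {n} eq = ≡.trans (≡.sym (Vec.tabulate∘lookup m))
    (≡.trans (Vec.tabulate-cong eq) (Vec.tabulate∘lookup n))

  basis-same : ∀ (k : Fin r) → Vec.lookup (basis k) k ≡ + 1
  basis-same k = ≡.trans (Vec.lookup∘tabulate _ k)
    (≡.cong (if_then + 1 else + 0) (dec-true (k Fin.≟ k) ≡.refl))

  basis-other : ∀ {j k : Fin r} → ¬ k ≡ j → Vec.lookup (basis j) k ≡ + 0
  basis-other {j} {k} k≢j = ≡.trans (Vec.lookup∘tabulate _ k)
    (≡.cong (if_then + 1 else + 0) (dec-false (k Fin.≟ j) k≢j))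

  unit-same : ∀ ε (k : Fin r) → Vec.lookup (unit (ε , k)) k ≡ ε ℤ.◃ 1
  unit-same Sign.+ k = basis-same k
  unit-same Sign.- k = ≡.trans (Vec.lookup-map k ℤ.-_ (basis k)) (≡.cong ℤ.-_ (basis-same k))

  unit-other : ∀ ε {j k : Fin r} → ¬ k ≡ j → Vec.lookup (unit (ε , j)) k ≡ + 0
  unit-other Sign.+ k≢j = basis-other k≢j
  unit-other Sign.- {j} {k} k≢j =
    ≡.trans (Vec.lookup-map k ℤ.-_ (basis j)) (≡.cong ℤ.-_ (basis-other k≢j))

  -- The integral form of `rank`, which is needed without any ordered field: it is the leading
  -- exponent of the Vandermonde product.
  rankExponent : ℕ → List (Sign × Fin r) → Exponent r
  rankExponent c []      = Vec.replicate r (+ 0)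
  rankExponent c (o ∷ L) = Vec.zipWith ℤ._+_
    (Vec.map (+ (c ℕ.+ 2 ℕ.* length L) ℤ.*_) (unit o)) (rankExponent c L)

  lookup-rankExponent-∷ : ∀ c o L k → Vec.lookup (rankExponent c (o ∷ L)) k ≡
    + (c ℕ.+ 2 ℕ.* length L) ℤ.* Vec.lookup (unit o) k ℤ.+ Vec.lookup (rankExponent c L) k
  lookup-rankExponent-∷ c o L k = ≡.trans
    (Vec.lookup-zipWith ℤ._+_ k (Vec.map (+ (c ℕ.+ 2 ℕ.* length L) ℤ.*_) (unit o)) (rankExponent c L))
    (≡.cong (ℤ._+ Vec.lookup (rankExponent c L) k)
      (Vec.lookup-map k (+ (c ℕ.+ 2 ℕ.* length L) ℤ.*_) (unit o)))

  Distinct : List (Sign × Fin r) → Set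
  Distinct = AllPairs λ o o′ → ¬ proj₂ o ≡ proj₂ o′

  rankExponent-∉ : ∀ c {k} L → All (λ o → ¬ k ≡ proj₂ o) L → Vec.lookup (rankExponent c L) k ≡ + 0
  rankExponent-∉ c {k} []      []           = Vec.lookup-replicate k (+ 0)
  rankExponent-∉ c {k} (o ∷ L) (k≢o ∷ k∉L) = ≡.trans (lookup-rankExponent-∷ c o L k)
    (≡.cong₂ ℤ._+_ (≡.trans (≡.cong (+ (c ℕ.+ 2 ℕ.* length L) ℤ.*_) (unit-other (proj₁ o) k≢o))
        (ℤ.*-zeroʳ (+ (c ℕ.+ 2 ℕ.* length L))))
      (rankExponent-∉ c L k∉L))

  *-◃1 : ∀ v ε → + v ℤ.* (ε ℤ.◃ 1) ≡ ε ℤ.◃ v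
  *-◃1 v Sign.+ = ≡.trans (ℤ.*-identityʳ (+ v)) (≡.sym (ℤ.+◃n≡+n v))
  *-◃1 v Sign.- = ≡.cong (Sign.- ℤ.◃_) (ℕ.*-identityʳ v)

  lookup-rankExponent : ∀ c {L} → Distinct L → ∀ i →
    Vec.lookup (rankExponent c L) (proj₂ (lookup L i)) ≡
    proj₁ (lookup L i) ℤ.◃ (c ℕ.+ 2 ℕ.* (length L ℕ.∸ suc (toℕ i)))
  lookup-rankExponent c {o ∷ L} (o∉L ∷ _) zero = ≡.trans (lookup-rankExponent-∷ c o L (proj₂ o))
    (≡.trans (≡.cong₂ ℤ._+_ (≡.trans (≡.cong (+ (c ℕ.+ 2 ℕ.* length L) ℤ.*_)
        (unit-same (proj₁ o) (proj₂ o))) (*-◃1 (c ℕ.+ 2 ℕ.* length L) (proj₁ o)))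
      (rankExponent-∉ c L o∉L)) (ℤ.+-identityʳ _))
  lookup-rankExponent c {o ∷ L} (o∉L ∷ distinct) (suc i) =
    ≡.trans (lookup-rankExponent-∷ c o L k)
    (≡.trans (≡.cong₂ ℤ._+_ (≡.trans (≡.cong (+ (c ℕ.+ 2 ℕ.* length L) ℤ.*_) (unit-other (proj₁ o) k≢o))
        (ℤ.*-zeroʳ (+ (c ℕ.+ 2 ℕ.* length L))))
      (lookup-rankExponent c distinct i)) (ℤ.+-identityˡ _))
    where
    k = proj₂ (lookup L i)
    k≢o : ¬ k ≡ proj₂ o
    k≢o eq = All.lookup o∉L (∈-lookup i) (≡.sym eq)

  -- For c = t + 1 this is N - 1 - 2i, written so that the subtraction is not truncated for i < r.
  topEntry : ℕ → Fin r → ℕ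
  topEntry c i = c ℕ.+ 2 ℕ.* (r ℕ.∸ suc (toℕ i))

  signedTop : ℕ → SignedPermutation r → Exponent r
  signedTop c (ε , σ) = Vec.tabulate λ k → ε k ℤ.◃ topEntry c (σ ⟨$⟩ʳ k)

  lookup-injective : ∀ {L} → Distinct L → ∀ i j → proj₂ (lookup L i) ≡ proj₂ (lookup L j) → i ≡ j
  lookup-injective (o∉L ∷ d) zero    zero    eq = ≡.refl
  lookup-injective (o∉L ∷ d) zero    (suc j) eq = contradiction eq (All.lookup o∉L (∈-lookup j))
  lookup-injective (o∉L ∷ d) (suc i) zero    eq = contradiction (≡.sym eq) (All.lookup o∉L (∈-lookup i))
  lookup-injective (o∉L ∷ d) (suc i) (suc j) eq = ≡.cong suc (lookup-injective d i j eq)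

  -- The permutation sends a coordinate to its position in the list, since the coefficient of a
  -- vector is the entry of `top` at that position.
  ranking⇒signedPermutation : ∀ c {L} → List.map proj₂ L ↭ allFin r →
    ∃ λ w → rankExponent c L ≡ signedTop c w
  ranking⇒signedPermutation c {L} perm = (ε , permutation to from to∘from from∘to) , exponent-ext at
    where
    distinct : Distinct L
    distinct = AllPairs.map⁻ (Unique-resp-↭ (≡.setoid _) (↭.↭⇒↭ₛ (↭-sym perm)) (Unique.allFin⁺ r))

    length≡r : length L ≡ r
    length≡r = ≡.trans (≡.sym (List.length-map proj₂ L)) (≡.trans (↭-length perm) (List.length-tabulate id))

    position : ∀ k → ∃ λ i → proj₂ (lookup L i) ≡ k
    position k with ∈-map⁻ proj₂ (∈-resp-↭ (↭-sym perm) (∈-allFin k))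
    ... | o , o∈L , k≡o = Any.index o∈L , ≡.trans (≡.cong proj₂ (≡.sym (lookup-index o∈L))) (≡.sym k≡o)

    ε : Fin r → Sign
    ε k = proj₁ (lookup L (proj₁ (position k)))

    to from : Fin r → Fin r
    to k = cast length≡r (proj₁ (position k))
    from i = proj₂ (lookup L (cast (≡.sym length≡r) i))

    from∘to : ∀ k → from (to k) ≡ k
    from∘to k = ≡.trans (≡.cong (proj₂ ∘ lookup L)
        (Fin.cast-involutive (≡.sym length≡r) length≡r (proj₁ (position k))))
      (proj₂ (position k))

    to∘from : ∀ i → to (from i) ≡ i
    to∘from i = ≡.trans (≡.cong (cast length≡r) (lookup-injective distinct _ _ (proj₂ (position (from i)))))
      (Fin.cast-involutive length≡r (≡.sym length≡r) i)

    at : ∀ k → Vec.lookup (rankExponent c L) k ≡ Vec.lookup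
        (signedTop c (ε , permutation to from to∘from from∘to)) k
    at k = ≡.trans (≡.cong (Vec.lookup (rankExponent c L)) (≡.sym (proj₂ (position k))))
      (≡.trans (lookup-rankExponent c distinct (proj₁ (position k)))
      (≡.trans (≡.cong (λ m → ε k ℤ.◃ (c ℕ.+ 2 ℕ.* m))
        (≡.cong₂ (λ l j → l ℕ.∸ suc j) length≡r (≡.sym (Fin.toℕ-cast length≡r (proj₁ (position k))))))
        (≡.sym (Vec.lookup∘tabulate _ k))))

  ranking : SignedPermutation r → List (Sign × Fin r)
  ranking (ε , σ) = tabulate λ i → ε (σ ⟨$⟩ˡ i) , σ ⟨$⟩ˡ i

  -- Two lists without repetitions that have the same elements are permutations of each other.
  ranking-↭ : ∀ w → List.map proj₂ (ranking w) ↭ allFin r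
  ranking-↭ (ε , σ) = ↭-trans (↭-reflexive (List.map-tabulate _ proj₂)) (∼bag⇒↭ (unique∧set⇒bag
    (Unique.tabulate⁺ (λ {i} {j} eq → ≡.trans (≡.sym (inverseʳ σ))
        (≡.trans (≡.cong (σ ⟨$⟩ʳ_) eq) (inverseʳ σ))))
    (Unique.allFin⁺ r)
    (λ {k} → mk⇔ (λ _ → ∈-allFin k) (λ _ → ≡.subst (_∈ tabulate (σ ⟨$⟩ˡ_)) (inverseˡ σ)
        (∈-tabulate⁺ (σ ⟨$⟩ʳ k))))))

  rankExponent-ranking : ∀ c w → rankExponent c (ranking w) ≡ signedTop c w
  rankExponent-ranking c w@(ε , σ) = exponent-ext λ k → ≡.trans
    (≡.cong (Vec.lookup (rankExponent c (ranking w))) (≡.sym (≡.trans (≡.cong proj₂ (at k)) (inverseˡ σ))))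
    (≡.trans (lookup-rankExponent c distinct (i k))
    (≡.trans (≡.cong₂ (λ s m → s ℤ.◃ (c ℕ.+ 2 ℕ.* m)) (≡.trans (≡.cong proj₁ (at k)) (≡.cong ε (inverseˡ σ)))
        (≡.cong₂ (λ l j → l ℕ.∸ suc j) (List.length-tabulate entry)
            (Fin.toℕ-cast (≡.sym (List.length-tabulate entry)) (σ ⟨$⟩ʳ k))))
      (≡.sym (Vec.lookup∘tabulate _ k))))
    where
    entry : Fin r → Sign × Fin r
    entry i = ε (σ ⟨$⟩ˡ i) , σ ⟨$⟩ˡ i
    i : Fin r → Fin (length (ranking w))
    i k = cast (≡.sym (List.length-tabulate entry)) (σ ⟨$⟩ʳ k)
    at : ∀ k → lookup (ranking w) (i k) ≡ entry (σ ⟨$⟩ʳ k)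
    at k = List.lookup-tabulate entry (σ ⟨$⟩ʳ k)
    distinct : Distinct (ranking w)
    distinct = AllPairs.tabulate⁺ λ i≢j eq → i≢j
      (≡.trans (≡.sym (inverseʳ σ)) (≡.trans (≡.cong (σ ⟨$⟩ʳ_) eq) (inverseʳ σ)))

-- Monotone permutations are trivial.

strictlyMonotone⇒≤ : ∀ {m n} (f : Fin n → Fin m) → (∀ {i j} → i Fin.< j → f i Fin.< f j) →
                     ∀ i → i Fin.≤ f i
strictlyMonotone⇒≤ f mono zero    = ℕ.z≤n
strictlyMonotone⇒≤ f mono (suc i) = ℕ.≤-<-trans
  (strictlyMonotone⇒≤ (f ∘ inject₁) (λ {i} {j} i<j →
    mono (≡.subst₂ ℕ._<_ (≡.sym (Fin.toℕ-inject₁ i)) (≡.sym (Fin.toℕ-inject₁ j)) i<j)) i)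
  (mono (ℕ.≤-reflexive (≡.cong suc (Fin.toℕ-inject₁ i))))

-- Both σ and its inverse are strictly monotone, so neither takes any element below itself.
monotone⇒≡ : ∀ {n} (σ : Permutation′ n) → (∀ {i j} → i Fin.≤ j → σ ⟨$⟩ʳ i Fin.≤ σ ⟨$⟩ʳ j) →
             ∀ i → σ ⟨$⟩ʳ i ≡ i
monotone⇒≡ σ mono i = Fin.≤-antisym
  (≡.subst (σ ⟨$⟩ʳ i Fin.≤_) (inverseˡ σ) (strictlyMonotone⇒≤ (σ ⟨$⟩ˡ_) strictˡ (σ ⟨$⟩ʳ i)))
  (strictlyMonotone⇒≤ (σ ⟨$⟩ʳ_) strictʳ i)
  where
  strictˡ : ∀ {i j} → i Fin.< j → σ ⟨$⟩ˡ i Fin.< σ ⟨$⟩ˡ j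
  strictˡ {i} {j} i<j = ℕ.≰⇒> λ j≤i → ℕ.<⇒≱ i<j
    (≡.subst₂ Fin._≤_ (inverseʳ σ) (inverseʳ σ) (mono j≤i))
  strictʳ : ∀ {i j} → i Fin.< j → σ ⟨$⟩ʳ i Fin.< σ ⟨$⟩ʳ j
  strictʳ {i} {j} i<j = Fin.≤∧≢⇒< (mono (ℕ.<⇒≤ i<j)) λ eq → Fin.<⇒≢ i<j
    (≡.trans (≡.sym (inverseˡ σ)) (≡.trans (≡.cong (σ ⟨$⟩ˡ_) eq) (inverseˡ σ)))

-- The orbit polytope: it contains the zonotope, and its vertices are the orbit.

module Vertices {c ℓ₁ ℓ₂ ℓ₃} (F : OrderedField c ℓ₁ ℓ₂ ℓ₃) (r : ℕ) (t : ℕ) where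
  open OrderedField F hiding (zero)
  open OrderedFieldProperties F
  open Polytope F r
  open Convexity F r
  open Ranking F r
  open Zonotopes F r
  open SignedRankings {r}

  private variable
    ℓ : Level
    p q v x y : Point
    n : ℕ

  N : ℕ
  N = t ℕ.+ r ℕ.* 2

  ∑-tabulate : ∀ f (g : Fin n → Fin r) → ∑ (f ∘ g) ≋ ∑ₗ f (tabulate g)
  ∑-tabulate {zero}  f g k = refl
  ∑-tabulate {suc n} f g k = +-congˡ (∑-tabulate f (g ∘ suc) k)

  -- The zonotope of the remaining vectors is resolved first; each generator of the resulting hull
  -- is then extended by the first vector.
  zonotope⇒ranked : ∀ c (g : Fin n → Fin r) → (∀ {i j} → g i ≡ g j → i ≡ j) →
    Zonotope (fromℤ (+ c)) (e ∘ g) p → Hull (Ranked c (tabulate g)) p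
  zonotope⇒ranked {zero} c g g-inj (a , b , (_ , _ , a≋) , (_ , _ , b≋) , p≋) =
    hull-return ([] , ↭-refl , λ k → trans (p≋ k) (trans (+-cong (a≋ k) (b≋ k)) (+-identityˡ _)))
  zonotope⇒ranked {suc n} {p} c g g-inj p∈ with uncons {u = e ∘ g} p∈
  ... | x , y , q , x∈ , y∈ , q∈ , p≋ = hull-resp (λ k → trans (+-comm _ _) (trans
      (+-assoc _ _ _) (sym (p≋ k))))
    (hull-bind (x +ₚ ∑ y) inserted (zonotope⇒ranked c (g ∘ suc) (Fin.suc-injective ∘ g-inj) q∈))
    where
    -- The generators list the vectors in varying orders, so the contributions y are indexed by
    -- coordinate instead of by l. The default 0 off the image of g never enters the sum.
    f : Fin r → Point
    f k with Fin.any? (λ l → g (suc l) Fin.≟ k)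
    ... | yes (l , _) = y l
    ... | no  _       = 0ₚ

    f∘g : ∀ l → f (g (suc l)) ≡ y l
    f∘g l with Fin.any? (λ l′ → g (suc l′) Fin.≟ g (suc l))
    ... | yes (l′ , eq) = ≡.cong y (Fin.suc-injective (g-inj eq))
    ... | no  ∄         = contradiction (l , ≡.refl) ∄

    inserted : ∀ {z} → Ranked c (tabulate (g ∘ suc)) z → Hull (Ranked c (tabulate g)) (z +ₚ (x +ₚ ∑ y))
    inserted {z} (L , perm , z≋) = hull-mono
      (λ { (L′ , perm′ , eq) → L′ , ↭-trans perm′ (prep _ perm) , eq })
      (hull-resp (λ k → +-cong (sym (z≋ k)) (+-congˡ (trans (∑ₗ-↭ f perm k)
          (trans (sym (∑-tabulate f (g ∘ suc) k))
              (sum-cong-≋ (λ l → reflexive (≡.cong (λ p → p k) (f∘g l))))))))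
        (insert-ranked c (g zero) x f L x∈ f∈))
      where
      f∈ : ∀ o → o ∈ L → PairSegments (e (g zero)) (e (proj₂ o)) (f (proj₂ o))
      f∈ o o∈L with ∈-tabulate⁻ (∈-resp-↭ perm (∈-map⁺ proj₂ o∈L))
      ... | l , eq = ≡.subst (λ k → PairSegments (e (g zero)) (e k) (f k)) (≡.sym eq)
        (≡.subst (PairSegments (e (g zero)) (e (g (suc l)))) (≡.sym (f∘g l)) (y∈ l))

  rank≋rankExponent : ∀ c L → rank c L ≋ fromExponent (rankExponent c L)
  rank≋rankExponent c []      k = reflexive (≡.cong fromℤ (≡.sym (Vec.lookup-replicate k (+ 0))))
  rank≋rankExponent c (o ∷ L) k = sym (trans
    (reflexive (≡.cong fromℤ (lookup-rankExponent-∷ c o L k)))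
    (trans (fromℤ-+ (+ (c ℕ.+ 2 ℕ.* length L) ℤ.* Vec.lookup (unit o) k) _)
      (+-cong (fromℤ-* (+ (c ℕ.+ 2 ℕ.* length L)) _) (sym (rank≋rankExponent c L k)))))

  top-entry : ∀ (i : Fin r) → + N ℤ.- + (2 ℕ.* toℕ i ℕ.+ 1) ≡ + topEntry (t ℕ.+ 1) i
  top-entry i = ≡.trans (≡.cong (λ n → + n ℤ.- + j) split)
    (≡.trans (≡.cong (ℤ._- + j) (ℤ.+-comm (+ m) (+ j)))
    (≡.trans (ℤ.+-assoc (+ j) (+ m) (ℤ.- + j))
    (≡.trans (≡.cong (ℤ._+_ (+ j)) (ℤ.+-comm (+ m) (ℤ.- + j)))
    (≡.trans (≡.sym (ℤ.+-assoc (+ j) (ℤ.- + j) (+ m)))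
    (≡.trans (≡.cong (ℤ._+ + m) (ℤ.+-inverseʳ (+ j))) (ℤ.+-identityˡ (+ m)))))))
    where
    j = 2 ℕ.* toℕ i ℕ.+ 1
    d = r ℕ.∸ suc (toℕ i)
    m = topEntry (t ℕ.+ 1) i
    open Data.Nat.Solver.+-*-Solver using () renaming
        (solve to solveℕ; _:=_ to _:=ℕ_; _:+_ to _:+ℕ_; _:*_ to _:*ℕ_; con to conℕ)
    split : N ≡ m ℕ.+ j
    split = ≡.trans (≡.cong (λ s → t ℕ.+ s ℕ.* 2) (≡.sym (ℕ.m+[n∸m]≡n (Fin.toℕ<n i))))
      (solveℕ 3 (λ t i d → t :+ℕ (conℕ 1 :+ℕ i :+ℕ d) :*ℕ conℕ 2 :=ℕ
                  (t :+ℕ conℕ 1 :+ℕ conℕ 2 :*ℕ d) :+ℕ (conℕ 2 :*ℕ i :+ℕ conℕ 1)) ≡.refl t (toℕ i) d)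

  top≈ : ∀ i → top N i ≈ fromℤ (+ topEntry (t ℕ.+ 1) i)
  top≈ i = reflexive (≡.cong fromℤ (top-entry i))

  signed-cong : ∀ ε {a b} → a ≈ b → signed ε a ≈ signed ε b
  signed-cong Sign.+ a≈b = a≈b
  signed-cong Sign.- a≈b = -‿cong a≈b

  fromℤ-◃ : ∀ ε m → fromℤ (ε ℤ.◃ m) ≈ signed ε (fromℤ (+ m))
  fromℤ-◃ Sign.+ m = reflexive (≡.cong fromℤ (ℤ.+◃n≡+n m))
  fromℤ-◃ Sign.- m = trans (reflexive (≡.cong fromℤ (ℤ.-◃n≡-n m))) (fromℤ-neg (+ m))

  signedTop≋ : ∀ w → fromExponent (signedTop (t ℕ.+ 1) w) ≋ w • top N
  signedTop≋ w@(ε , σ) k = trans (reflexive (≡.cong fromℤ (Vec.lookup∘tabulate _ k)))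
    (trans (fromℤ-◃ (ε k) (topEntry (t ℕ.+ 1) (σ ⟨$⟩ʳ k))) (signed-cong (ε k) (sym (top≈ (σ ⟨$⟩ʳ k)))))

  zonotope⊆orbit : zonotope t p → Hull (orbit (top N)) p
  zonotope⊆orbit p∈ = hull-mono ranked⇒orbit (zonotope⇒ranked (t ℕ.+ 1) id id p∈)
    where
    ranked⇒orbit : Ranked (t ℕ.+ 1) (allFin r) p → orbit (top N) p
    ranked⇒orbit (L , perm , p≋) with ranking⇒signedPermutation (t ℕ.+ 1) perm
    ... | w , eq = w , λ k → trans (p≋ k) (trans (rank≋rankExponent (t ℕ.+ 1) L k)
      (trans (reflexive (≡.cong (λ m → fromExponent m k) eq)) (signedTop≋ w k)))

  ⟨⟩-congʳ : x ≋ y → ⟨ v , x ⟩ ≈ ⟨ v , y ⟩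
  ⟨⟩-congʳ x≋y = sum-cong-≋ λ k → *-congˡ (x≋y k)

  ⟨⟩-linear : ∀ v w x q → ⟨ v , w · x +ₚ q ⟩ ≈ w * ⟨ v , x ⟩ + ⟨ v , q ⟩
  ⟨⟩-linear v w x q = trans
    (sum-cong-≋ λ k → solve 4 (λ v w x q → v :* (w :* x :+ q) := w :* (v :* x) :+ v :* q) refl (v k) w
        (x k) (q k))
    (trans (∑-distrib-+ (λ k → w * (v k * x k)) (λ k → v k * q k))
      (+-congʳ (sym (*-distribˡ-sum w (λ k → v k * x k)))))

  ⟨⟩-zeroʳ : ∀ v → q ≋ 0ₚ → ⟨ v , q ⟩ ≈ 0#
  ⟨⟩-zeroʳ {q} v q≋0 = trans (sum-cong-≋ λ k → trans (*-congˡ (q≋0 k))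
      (solve 1 (λ v → v :* con (+ 0) := con (+ 0) :* v) refl (v k)))
    (trans (sym (*-distribˡ-sum 0# v)) (zeroˡ _))

  distance : ∀ v x → ⟨ v -ₚ x , v -ₚ x ⟩ + two * ⟨ v , x ⟩ ≈ ⟨ v , v ⟩ + ⟨ x , x ⟩
  distance v x = trans (+-congˡ (*-distribˡ-sum two (λ k → v k * x k)))
    (trans (sym (∑-distrib-+ (λ k → (v k - x k) * (v k - x k)) (λ k → two * (v k * x k))))
    (trans (sum-cong-≋ λ k → solve 2 (λ v x → (v :- x) :* (v :- x) :+ con (+ 2) :* (v :* x) := v :* v :+ x
        :* x) refl (v k) (x k))
      (∑-distrib-+ (λ k → v k * v k) (λ k → x k * x k))))

  norm : ∀ w x → ⟨ w • x , w • x ⟩ ≈ ⟨ x , x ⟩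
  norm (ε , σ) x = trans (sum-cong-≋ λ k → square (ε k) (x (σ ⟨$⟩ʳ k)))
    (sym (CommutativeMonoidSum.sum-permute +-commutativeMonoid (λ k → x k * x k) σ))
    where
    open CommutativeRing (commutativeRing heytingField) using (+-commutativeMonoid)
    square : ∀ s a → signed s a * signed s a ≈ a * a
    square Sign.+ a = refl
    square Sign.- a = solve 1 (λ a → :- a :* :- a := a :* a) refl a

  module _ (w : SignedPermutation r) where
    private
      v₀ = w • top N
      -- Twice the deficit of ⟨v₀, ·⟩. Scaling the maximum by the weight α makes it additive over
      -- the terms of a `Cone`.
      gap : Carrier → Point → Carrier
      gap α p = two * (α * ⟨ v₀ , v₀ ⟩ - ⟨ v₀ , p ⟩)

    -- All points of the orbit lie on a sphere, so 2 (⟨v,v⟩ - ⟨v,x⟩) = |v - x|².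
    orbit-gap : orbit (top N) x → ∀ w′ β q → gap (w′ + β) (w′ · x +ₚ q) ≈ w′ * ⟨ v₀ -ₚ x , v₀ -ₚ x ⟩ + gap β q
    orbit-gap {x} (w₁ , x≋) w′ β q = trans
      (*-congˡ (+-congˡ (-‿cong (⟨⟩-linear v₀ w′ x q))))
      (trans (solve 5 (λ w b V X Q → con (+ 2) :* ((w :+ b) :* V :- (w :* X :+ Q)) :=
          w :* (V :+ V :- con (+ 2) :* X) :+ con (+ 2) :* (b :* V :- Q)) refl w′ β _ _ _)
        (+-congʳ (*-congˡ (trans (+-congʳ (trans (+-congˡ same-norm) (sym (distance v₀ x))))
          (solve 2 (λ d X → d :+ X :- X := d) refl _ _)))))
      where
      same-norm : ⟨ v₀ , v₀ ⟩ ≈ ⟨ x , x ⟩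
      same-norm = trans (norm w (top N)) (trans (sym (norm w₁ (top N)))
        (sum-cong-≋ λ k → *-cong (sym (x≋ k)) (sym (x≋ k))))

    gap-resp : ∀ {α β} → α ≈ β → p ≋ q → gap α p ≈ gap β q
    gap-resp {p} {q} α≈β p≋q = *-congˡ (+-cong (*-congʳ α≈β) (-‿cong (⟨⟩-congʳ {v = v₀} p≋q)))

    gap-nonNeg : ∀ {α} → Cone (orbit (top N)) α p → 0# ≤ gap α p
    gap-nonNeg {p} {α} (nil α≈0 p≋0) = ≈⇒≤ (sym (trans
      (*-congˡ (+-cong (trans (*-congʳ α≈0) (zeroˡ _)) (-‿cong (⟨⟩-zeroʳ v₀ p≋0))))
      (solve 0 (con (+ 2) :* (con (+ 0) :- con (+ 0)) := con (+ 0)) refl)))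
    gap-nonNeg (cons {β = β} {q = q} {w = w′} {x = x} 0≤w x∈ C α≈ p≋) = ≤-respʳ
      (sym (trans (gap-resp α≈ p≋) (orbit-gap x∈ w′ β q)))
      (+-nonNeg (*-nonNeg 0≤w (sum-nonNeg {x = λ k → (v₀ k - x k) * (v₀ k - x k)} λ k → 0≤x² _))
          (gap-nonNeg C))

    -- All contributions w |v₀ - x|² are nonnegative and so vanish. Whether w = 0 or x = v₀ cannot
    -- be decided, but (w d_k)² = 0 already yields w · x = w · v₀, which is all the sum needs.
    gap≈0 : ∀ {α} → Cone (orbit (top N)) α p → gap α p ≈ 0# → p ≋ α · v₀
    gap≈0 (nil α≈0 p≋0) _ k = trans (p≋0 k) (sym (trans (*-congʳ α≈0) (zeroˡ _)))
    gap≈0 {p} (cons {β = β} {q = q} {w = w′} {x = x} 0≤w x∈ C α≈ p≋) eq k = trans (p≋ k)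
      (trans (+-cong same (gap≈0 C (x+y≈0⇒x≈0 (gap-nonNeg C) 0≤d (trans (+-comm _ _) total)) k))
        (trans (sym (distribʳ (v₀ k) w′ β)) (*-congʳ (sym α≈))))
      where
      d = v₀ -ₚ x
      0≤d = *-nonNeg 0≤w (sum-nonNeg λ k → 0≤x² (d k))
      total : w′ * ⟨ d , d ⟩ + gap β q ≈ 0#
      total = trans (sym (trans (gap-resp α≈ p≋) (orbit-gap x∈ w′ β q))) eq
      wd²≈0 : w′ * (d k * d k) ≈ 0#
      wd²≈0 = sum≈0⇒≈0 (λ k → *-nonNeg 0≤w (0≤x² (d k)))
        (trans (sym (*-distribˡ-sum w′ (λ k → d k * d k))) (x+y≈0⇒x≈0 0≤d (gap-nonNeg C) total)) k
      same : w′ * x k ≈ w′ * v₀ k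
      same = trans (solve 3 (λ w x v → w :* x := w :* v :- w :* (v :- x)) refl w′ (x k) (v₀ k))
        (trans (+-congˡ (-‿cong (x²≈0⇒x≈0 (trans
          (solve 2 (λ w d → w :* d :* (w :* d) := w :* (w :* (d :* d))) refl w′ (d k))
          (trans (*-congˡ wd²≈0) (zeroʳ w′))))))
        (solve 1 (λ x → x :- con (+ 0) := x) refl _))

    orbit-vertex : ∀ {P : Pred Point ℓ} → (∀ {x} → orbit (top N) x → P x) →
      (∀ {p} → P p → Hull (orbit (top N)) p) → IsVertex P v₀
    orbit-vertex orbit⊆P P⊆hull = orbit⊆P (w , λ _ → refl) , v₀ , λ p Pp →
      let C = P⊆hull Pp in
      (λ V<p → gap-nonNeg C (<-unshift (<-respʳ
          (solve 2 (λ V X → con (+ 2) :* (X :- V) := con (+ 0) :- con (+ 2) :* (con (+ 1) :* V :- X)) refl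
              _ _)
          (*-pos 0<two (<-shift V<p))))) ,
      λ eq k → trans (gap≈0 C (trans (*-congˡ (+-congˡ (-‿cong eq)))
          (solve 1 (λ V → con (+ 2) :* (con (+ 1) :* V :- V) := con (+ 0)) refl _)) k) (*-identityˡ _)

  module _ {S : Pred Point ℓ} (y : Point) (M : Carrier) (S≤M : ∀ {x} → S x → ⟨ y , x ⟩ ≤ M) where
    private
      slack : ∀ α w β x q → α ≈ w + β → p ≋ w · x +ₚ q →
        α * M - ⟨ y , p ⟩ ≈ w * (M - ⟨ y , x ⟩) + (β * M - ⟨ y , q ⟩)
      slack α w β x q α≈ p≋ = trans
        (+-cong (*-congʳ α≈) (-‿cong (trans (⟨⟩-congʳ {v = y} p≋) (⟨⟩-linear y w x q))))
        (solve 5 (λ w β M X Q → (w :+ β) :* M :- (w :* X :+ Q) := w :* (M :- X) :+ (β :* M :- Q)) refl w β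
            M _ _)

    cone-bounded : ∀ {α} → Cone S α p → 0# ≤ α * M - ⟨ y , p ⟩
    cone-bounded (nil α≈0 p≋0) = ≈⇒≤ (sym (trans
      (+-cong (trans (*-congʳ α≈0) (zeroˡ _)) (-‿cong (⟨⟩-zeroʳ y p≋0))) (-‿inverseʳ 0#)))
    cone-bounded (cons {β = β} {q = q} {w = w} {x = x} 0≤w Sx C α≈ p≋) = ≤-respʳ
      (sym (slack _ w β x q α≈ p≋)) (+-nonNeg (*-nonNeg 0≤w (≤⇒0≤- (S≤M Sx))) (cone-bounded C))

    -- A generator has to be exhibited. Cotransitivity of α # 0 at the remaining weight β either
    -- makes the first weight invertible, so that its slack must vanish, or sends the search to the
    -- rest.
    cone-attains : ∀ {α} → Cone S α p → α # 0# → α * M - ⟨ y , p ⟩ ≈ 0# → ∃ λ x → S x × ⟨ y , x ⟩ ≈ M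
    cone-attains (nil α≈0 _) α#0 _ = contradiction α#0 (#-irrefl α≈0)
    cone-attains {α = α} (cons {β = β} {q = q} {w = w} {x = x} 0≤w Sx C α≈ p≋) α#0 eq = case #-cotrans α#0 β of λ where
        (inj₂ β#0) → cone-attains C β#0 (x+y≈0⇒x≈0 (cone-bounded C) 0≤s (trans (+-comm _ _) total))
        (inj₁ α#β) → case #0⇒inverse (#-congʳ (trans (+-congʳ α≈)
            (solve 2 (λ w β → w :+ β :- β := w) refl w β)) (#⇒-#0 α#β)) of λ where
          (w⁻¹ , ww⁻¹≈1) → x , Sx , trans (solve 3 (λ X M g → X := M :- con (+ 1) :* (M :- X)) refl _ M w⁻¹)
            (trans (+-congˡ (-‿cong (trans (*-congʳ (sym ww⁻¹≈1)) (trans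
              (solve 3 (λ w g s → w :* g :* s := g :* (w :* s)) refl w w⁻¹ _)
              (trans (*-congˡ (x+y≈0⇒x≈0 0≤s (cone-bounded C) total)) (zeroʳ w⁻¹))))))
              (solve 1 (λ M → M :- con (+ 0) := M) refl M))
      where
      0≤s = *-nonNeg 0≤w (≤⇒0≤- (S≤M Sx))
      total : w * (M - ⟨ y , x ⟩) + (β * M - ⟨ y , q ⟩) ≈ 0#
      total = trans (sym (slack α w β x q α≈ p≋)) eq

  -- The maximum of the defining functional at v is also attained at an orbit point, and v is its
  -- only maximiser.
  vertex-orbit : ∀ {P : Pred Point ℓ} → (∀ {x} → orbit (top N) x → P x) →
    (∀ {p} → P p → Hull (orbit (top N)) p) → IsVertex P v → orbit (top N) v
  vertex-orbit {v = v} orbit⊆P P⊆hull (Pv , y , y-max)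
    with cone-attains y ⟨ y , v ⟩ (λ x∈ → proj₁ (y-max _ (orbit⊆P x∈))) (P⊆hull Pv) 1#0
           (solve 1 (λ V → con (+ 1) :* V :- V := con (+ 0)) refl _)
  ... | x , x∈@(w , x≋) , eq = w , λ k → trans (sym (proj₂ (y-max x (orbit⊆P x∈)) eq k)) (x≋ k)

  fromℤ-injective : ∀ {i j} → fromℤ i ≈ fromℤ j → i ≡ j
  fromℤ-injective {i} {j} eq = scalar-injective (trans (sym (fromℤ≈scalar i)) (trans eq (fromℤ≈scalar j)))

  topEntry-nonZero : ∀ i → ℕ.NonZero (topEntry (t ℕ.+ 1) i)
  topEntry-nonZero i rewrite ℕ.+-comm t 1 = _

  topEntry-injective : ∀ {i j} → topEntry (t ℕ.+ 1) i ≡ topEntry (t ℕ.+ 1) j → i ≡ j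
  topEntry-injective {i} {j} eq = Fin.toℕ-injective
      (ℕ.suc-injective (ℕ.∸-cancelˡ-≡ (Fin.toℕ<n i) (Fin.toℕ<n j)
    (ℕ.*-cancelˡ-≡ _ _ 2 (ℕ.+-cancelˡ-≡ (t ℕ.+ 1) _ _ eq))))

  -- The entries of `top` are nonzero and distinct: absolute values determine the permutation, signs
  -- the signs.
  orbit-injective : ∀ w w′ → w • top N ≋ w′ • top N → ∀ k →
    (proj₁ w k , proj₂ w ⟨$⟩ʳ k) ≡ (proj₁ w′ k , proj₂ w′ ⟨$⟩ʳ k)
  orbit-injective w w′ eq k = ≡.cong₂ _,_
    (ℤ.sign-cong {{topEntry-nonZero i}} {{topEntry-nonZero j}} entries)
    (topEntry-injective (ℤ.abs-cong entries))
    where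
    i = proj₂ w ⟨$⟩ʳ k
    j = proj₂ w′ ⟨$⟩ʳ k
    entries : proj₁ w k ℤ.◃ topEntry (t ℕ.+ 1) i ≡ proj₁ w′ k ℤ.◃ topEntry (t ℕ.+ 1) j
    entries = ≡.trans (≡.sym (Vec.lookup∘tabulate _ k)) (≡.trans
      (fromℤ-injective (trans (signedTop≋ w k) (trans (eq k) (sym (signedTop≋ w′ k)))))
      (Vec.lookup∘tabulate _ k))

  identity : SignedPermutation r
  identity = (λ _ → Sign.+) , Perm.id

  fromℕ-mono-≤ : ∀ {m n} → m ℕ.≤ n → fromℤ (+ m) ≤ fromℤ (+ n)
  fromℕ-mono-≤ {m} {n} m≤n = 0≤-⇒≤ (≤-respʳ
    (trans (solve 2 (λ m d → d := m :+ d :- m) refl _ _)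
      (+-congʳ (trans (sym (fromℤ-+ (+ m) (+ (n ℕ.∸ m))))
          (reflexive (≡.cong (λ k → fromℤ (+ k)) (ℕ.m+[n∸m]≡n m≤n))))))
    (fromℕ-nonNeg (n ℕ.∸ m)))

  fromℕ-cancel-≤ : ∀ {m n} → fromℤ (+ m) ≤ fromℤ (+ n) → m ℕ.≤ n
  fromℕ-cancel-≤ {m} {n} m≤n = ℤ.drop‿+≤+ (scalar-cancel-≤
    (≤-respʳ (fromℤ≈scalar (+ n)) (≤-respˡ (fromℤ≈scalar (+ m)) m≤n)))

  top-dominant : Dominant (top N)
  top-dominant =
    (λ k l k≤l → ≤-respˡ (sym (top≈ l)) (≤-respʳ (sym (top≈ k))
      (fromℕ-mono-≤ (ℕ.+-monoʳ-≤ (t ℕ.+ 1) (ℕ.*-monoʳ-≤ 2 (ℕ.∸-monoʳ-≤ r (s≤s k≤l))))))) ,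
    λ k → ≤-respʳ (sym (top≈ k)) (fromℕ-nonNeg (topEntry (t ℕ.+ 1) k))

  topEntry-cancel-≤ : ∀ {i j} → topEntry (t ℕ.+ 1) i ℕ.≤ topEntry (t ℕ.+ 1) j → j Fin.≤ i
  topEntry-cancel-≤ {i} {j} p = ℕ.s≤s⁻¹ (ℕ.∸-cancelʳ-≤ (Fin.toℕ<n j)
    (ℕ.*-cancelˡ-≤ 2 (ℕ.+-cancelˡ-≤ (t ℕ.+ 1) _ _ p)))

  -- The entries of `top` are positive, so dominance excludes every sign change; what is left is a
  -- monotone permutation.
  orbit-dominant : ∀ w → Dominant (w • top N) → w • top N ≋ top N
  orbit-dominant w@(ε , σ) (decreasing , nonNeg) k =
    trans (positive k) (reflexive (≡.cong (top N) (monotone⇒≡ σ monotone k)))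
    where
    top-pos : ∀ i → 0# < top N i
    top-pos i = <-respʳ (sym (top≈ i)) (≡.subst (λ m → 0# < fromℤ (+ m))
      (ℕ.suc-pred (topEntry (t ℕ.+ 1) i) {{topEntry-nonZero i}}) (fromℕ-pos (ℕ.pred (topEntry (t ℕ.+ 1) i))))

    positive′ : ∀ s {a} → 0# < a → 0# ≤ signed s a → signed s a ≈ a
    positive′ Sign.+ 0<a _    = refl
    positive′ Sign.- 0<a 0≤-a = contradiction
      (<-unshift (<-respʳ (solve 1 (λ a → a := con (+ 0) :- :- a) refl _) 0<a)) 0≤-a

    positive : ∀ k → (w • top N) k ≈ top N (σ ⟨$⟩ʳ k)
    positive k = positive′ (ε k) (top-pos (σ ⟨$⟩ʳ k)) (nonNeg k)

    monotone : ∀ {k l} → k Fin.≤ l → σ ⟨$⟩ʳ k Fin.≤ σ ⟨$⟩ʳ l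
    monotone {k} {l} k≤l = topEntry-cancel-≤ (fromℕ-cancel-≤
      (≤-respˡ (trans (positive l) (top≈ _)) (≤-respʳ (trans (positive k) (top≈ _)) (decreasing k l k≤l))))

-- Laurent polynomials form a commutative ring.

module LaurentRing {a ℓ₁ ℓ₂} (K : HeytingField a ℓ₁ ℓ₂) (r : ℕ) where
  open HeytingField K hiding (zero)
  open HeytingFieldProperties K
  open IntegerScalars (commutativeRing K)
    using (solve; _:=_; _:+_; _:*_; _:-_; :-_; con)
  open Laurent K r
  open RawRing rawRing using () renaming (_*_ to _*ₗ_; -_ to -ₗ_; 1# to 1ₗ; 0# to 0ₗ)

  _⊹_ : Exponent r → Exponent r → Exponent r
  _⊹_ = Vec.zipWith ℤ._+_

  -- The value on f of the linear functional that takes z^n to φ n.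
  pair : LaurentPoly → (Exponent r → Carrier) → Carrier
  pair []            φ = 0#
  pair ((a , n) ∷ f) φ = a * φ n + pair f φ

  infix 4 _≈ₗ_
  -- Stronger on its face than equality of coefficients, and obviously a
  -- congruence for multiplication.
  _≈ₗ_ : Rel LaurentPoly (a ⊔ ℓ₁)
  f ≈ₗ g = ∀ φ → pair f φ ≈ pair g φ

  private variable
    f g : LaurentPoly
    φ ψ : Exponent r → Carrier

  pair-cong : ∀ f → (∀ n → φ n ≈ ψ n) → pair f φ ≈ pair f ψ
  pair-cong []            φ≈ψ = refl
  pair-cong ((a , n) ∷ f) φ≈ψ = +-cong (*-congˡ (φ≈ψ n)) (pair-cong f φ≈ψ)

  pair-++ : ∀ f g φ → pair (f ++ g) φ ≈ pair f φ + pair g φ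
  pair-++ []            g φ = sym (+-identityˡ _)
  pair-++ ((a , n) ∷ f) g φ = trans (+-congˡ (pair-++ f g φ)) (sym (+-assoc _ _ _))

  pair-neg : ∀ f φ → pair (-ₗ f) φ ≈ - pair f φ
  pair-neg []            φ = solve 0 (con (+ 0) := :- con (+ 0)) refl
  pair-neg ((a , n) ∷ f) φ = trans (+-congˡ (pair-neg f φ))
    (solve 3 (λ a x p → :- a :* x :+ :- p := :- (a :* x :+ p)) refl a (φ n) _)

  pair-map : ∀ a n g φ → pair (List.map (λ (b , m) → a * b , n ⊹ m) g) φ ≈ a * pair g (λ m → φ (n ⊹ m))
  pair-map a n []            φ = sym (zeroʳ a)
  pair-map a n ((b , m) ∷ g) φ = trans (+-congˡ (pair-map a n g φ))
    (solve 4 (λ a b x p → a :* b :* x :+ a :* p := a :* (b :* x :+ p)) refl a b _ _)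

  -- Turns a product into an iterated sum, so that the laws of multiplication follow from those of
  -- `⊹` and from the exchange of two sums.
  pair-* : ∀ f g φ → pair (f *ₗ g) φ ≈ pair f (λ n → pair g (λ m → φ (n ⊹ m)))
  pair-* []            g φ = refl
  pair-* ((a , n) ∷ f) g φ = trans (pair-++ (List.map _ g) (f *ₗ g) φ)
    (+-cong (pair-map a n g φ) (pair-* f g φ))

  pair-+ᵠ : ∀ f φ ψ → pair f (λ n → φ n + ψ n) ≈ pair f φ + pair f ψ
  pair-+ᵠ []            φ ψ = sym (+-identityˡ 0#)
  pair-+ᵠ ((a , n) ∷ f) φ ψ = trans (+-congˡ (pair-+ᵠ f φ ψ))
    (solve 5 (λ a x y p q → a :* (x :+ y) :+ (p :+ q) := a :* x :+ p :+ (a :* y :+ q)) refl a (φ n) (ψ n) _ _)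

  pair-*ᵠ : ∀ f b φ → pair f (λ n → b * φ n) ≈ b * pair f φ
  pair-*ᵠ []            b φ = sym (zeroʳ b)
  pair-*ᵠ ((a , n) ∷ f) b φ = trans (+-congˡ (pair-*ᵠ f b φ))
    (solve 4 (λ a b x p → a :* (b :* x) :+ b :* p := b :* (a :* x :+ p)) refl a b (φ n) _)

  pair-0ᵠ : ∀ f → pair f (λ _ → 0#) ≈ 0#
  pair-0ᵠ []            = refl
  pair-0ᵠ ((a , n) ∷ f) = trans (+-cong (zeroʳ a) (pair-0ᵠ f)) (+-identityˡ 0#)

  pair-comm : ∀ f g (φ : Exponent r → Exponent r → Carrier) →
    pair f (λ n → pair g (φ n)) ≈ pair g (λ m → pair f (λ n → φ n m))
  pair-comm []            g φ = sym (pair-0ᵠ g)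
  pair-comm ((a , n) ∷ f) g φ = trans (+-cong (sym (pair-*ᵠ g a (φ n))) (pair-comm f g φ))
    (sym (pair-+ᵠ g _ _))

  0ᵉ : Exponent r
  0ᵉ = Vec.replicate r (+ 0)

  pair-1 : ∀ φ → pair 1ₗ φ ≈ φ 0ᵉ
  pair-1 φ = solve 1 (λ x → con (+ 1) :* x :+ con (+ 0) := x) refl (φ 0ᵉ)

  *ₗ-cong : ∀ {f f′ g g′} → f ≈ₗ f′ → g ≈ₗ g′ → (f *ₗ g) ≈ₗ (f′ *ₗ g′)
  *ₗ-cong {f} {f′} {g} {g′} f≈ g≈ φ = trans (pair-* f g φ)
    (trans (pair-cong f (λ n → g≈ (λ m → φ (n ⊹ m)))) (trans (f≈ _) (sym (pair-* f′ g′ φ))))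

  *ₗ-assoc : ∀ f g h → ((f *ₗ g) *ₗ h) ≈ₗ (f *ₗ (g *ₗ h))
  *ₗ-assoc f g h φ = trans (pair-* (f *ₗ g) h φ) (trans (pair-* f g _)
    (trans (pair-cong f (λ n → trans
        (pair-cong g (λ m → pair-cong h (λ l → reflexive (≡.cong φ (Vec.zipWith-assoc ℤ.+-assoc n m l)))))
        (sym (pair-* g h (λ k → φ (n ⊹ k))))))
      (sym (pair-* f (g *ₗ h) φ))))

  *ₗ-comm : ∀ f g → (f *ₗ g) ≈ₗ (g *ₗ f)
  *ₗ-comm f g φ = trans (pair-* f g φ) (trans
    (pair-cong f (λ n → pair-cong g (λ m → reflexive (≡.cong φ (Vec.zipWith-comm ℤ.+-comm n m)))))
    (trans (pair-comm f g _) (sym (pair-* g f φ))))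

  *ₗ-identityˡ : ∀ f → (1ₗ *ₗ f) ≈ₗ f
  *ₗ-identityˡ f φ = trans (pair-* 1ₗ f φ) (trans (pair-1 λ n → pair f (λ m → φ (n ⊹ m)))
    (pair-cong f (λ m → reflexive (≡.cong φ (Vec.zipWith-identityˡ ℤ.+-identityˡ m)))))

  *ₗ-distribʳ : ∀ h f g → ((f ++ g) *ₗ h) ≈ₗ (f *ₗ h ++ g *ₗ h)
  *ₗ-distribʳ h f g φ = trans (pair-* (f ++ g) h φ) (trans (pair-++ f g _)
    (trans (+-cong (sym (pair-* f h φ)) (sym (pair-* g h φ))) (sym (pair-++ (f *ₗ h) (g *ₗ h) φ))))

  isCommutativeRing′ : IsCommutativeRing _≈ₗ_ _++_ _*ₗ_ -ₗ_ 0ₗ 1ₗ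
  isCommutativeRing′ = record
    { isRing = record
      { +-isAbelianGroup = record
        { isGroup = record
          { isMonoid = record
            { isSemigroup = record
              { isMagma = record
                { isEquivalence = record
                  { refl  = λ φ → refl
                  ; sym   = λ f≈g φ → sym (f≈g φ)
                  ; trans = λ f≈g g≈h φ → trans (f≈g φ) (g≈h φ)
                  }
                ; ∙-cong = λ {f} {f′} {g} {g′} f≈ g≈ φ →
                    trans (pair-++ f g φ) (trans (+-cong (f≈ φ) (g≈ φ)) (sym (pair-++ f′ g′ φ)))
                }
              ; assoc = λ f g h φ → trans (pair-++ (f ++ g) h φ) (trans (+-congʳ (pair-++ f g φ))
                  (trans (+-assoc _ _ _) (sym (trans (pair-++ f (g ++ h) φ) (+-congˡ (pair-++ g h φ))))))
              }
            ; identity = (λ f φ → refl) , λ f φ → trans (pair-++ f [] φ) (+-identityʳ _)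
            }
          ; inverse =
              (λ f φ → trans (pair-++ (-ₗ f) f φ) (trans (+-congʳ (pair-neg f φ)) (-‿inverseˡ _))) ,
              (λ f φ → trans (pair-++ f (-ₗ f) φ) (trans (+-congˡ (pair-neg f φ)) (-‿inverseʳ _)))
          ; ⁻¹-cong = λ {f} {g} f≈g φ → trans (pair-neg f φ) (trans (-‿cong (f≈g φ)) (sym (pair-neg g φ)))
          }
        ; comm = λ f g φ → trans (pair-++ f g φ) (trans (+-comm _ _) (sym (pair-++ g f φ)))
        }
      ; *-cong = λ {f} {f′} {g} {g′} → *ₗ-cong {f} {f′} {g} {g′}
      ; *-assoc = *ₗ-assoc
      ; *-identity = *ₗ-identityˡ , λ f φ → trans (*ₗ-comm f 1ₗ φ) (*ₗ-identityˡ f φ)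
      ; distrib =
          (λ h f g φ → trans (*ₗ-comm h (f ++ g) φ) (trans (*ₗ-distribʳ h f g φ)
            (trans (pair-++ (f *ₗ h) (g *ₗ h) φ) (trans (+-cong (*ₗ-comm f h φ) (*ₗ-comm g h φ))
              (sym (pair-++ (h *ₗ f) (h *ₗ g) φ)))))) ,
          *ₗ-distribʳ
      }
    ; *-comm = *ₗ-comm
    }

  δ : Exponent r → Exponent r → Carrier
  δ m n = if does (Vec.≡-dec ℤ._≟_ n m) then 1# else 0#

  -- Taking the coefficient at m is one of the functionals tested by `≈ₗ`; this leads back to the
  -- coefficients in which `Newt` is defined.
  coeff≈pair : ∀ f m → coeff f m ≈ pair f (δ m)
  coeff≈pair []            m = refl
  coeff≈pair ((a , n) ∷ f) m = +-cong (indicator (does (Vec.≡-dec ℤ._≟_ n m))) (coeff≈pair f m)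
    where
    indicator : ∀ b → (if b then a else 0#) ≈ a * (if b then 1# else 0#)
    indicator true  = sym (*-identityʳ a)
    indicator false = sym (zeroʳ a)

  coeff-cong : f ≈ₗ g → ∀ m → coeff f m ≈ coeff g m
  coeff-cong {f} {g} f≈g m = trans (coeff≈pair f m) (trans (f≈g (δ m)) (sym (coeff≈pair g m)))

-- The Vandermonde determinant over a commutative ring.

module Vandermonde {a ℓ ℓ′} (R : RawRing a ℓ) (_∼_ : Rel (RawRing.Carrier R) ℓ′)
  (isCommutativeRing : IsCommutativeRing _∼_ (RawRing._+_ R) (RawRing._*_ R) (RawRing.-_ R) (RawRing.0# R)
      (RawRing.1# R))
  where

  -- The operations are those of `R`, in which `det` is formed, while equality is `∼`: for Laurent
  -- polynomials the ring laws are available for `≈ₗ`.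
  ring : CommutativeRing a ℓ′
  ring = record { isCommutativeRing = isCommutativeRing }

  open CommutativeRing ring hiding (ring; isCommutativeRing; zero)
  open IntegerScalars ring using (solve; _:=_; _:+_; _:*_; _:-_; :-_; con)
  open Determinant R
  open RawSemiringOps (RawRing.rawSemiring R) using (_^_)
  open import Algebra.Properties.Semiring.Sum semiring
    using (sum; sum-cong-≋; sum-replicate-zero; ∑-distrib-+; *-distribˡ-sum; sum-init-last)

  private variable
    n : ℕ

  Matrix : ℕ → Set a
  Matrix n = Vector (Vector Carrier n) n

  minor : Matrix (suc n) → Fin (suc n) → Matrix n
  minor A j i k = A (suc i) (punchIn j k)

  cofactor : Matrix (suc n) → Vector Carrier (suc n)
  cofactor A j = (- 1#) ^ toℕ j * A zero j * det (minor A j)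

  det-cong : ∀ {n} {A B : Matrix n} → (∀ i j → A i j ≈ B i j) → det A ≈ det B
  det-cong {zero}  A≈B = refl
  det-cong {suc n} A≈B = sum-cong-≋ λ j → *-cong (*-congˡ {(- 1#) ^ toℕ j} (A≈B zero j))
    (det-cong λ i k → A≈B (suc i) (punchIn j k))

  sum-zero : ∀ {n} {t : Vector Carrier n} → (∀ i → t i ≈ 0#) → sum t ≈ 0#
  sum-zero {n} t≈0 = trans (sum-cong-≋ t≈0) (sum-replicate-zero n)

  -- In the expansion along the first row, the term j = p is linear through its entry and every
  -- other term through its minor.
  det-linear : ∀ {n} (p : Fin n) s (A B C : Matrix n) →
    (∀ i j → ¬ j ≡ p → A i j ≈ C i j) → (∀ i j → ¬ j ≡ p → B i j ≈ C i j) →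
    (∀ i → C i p ≈ A i p + s * B i p) → det C ≈ det A + s * det B
  det-linear {suc n} p s A B C A≈C B≈C Cp = trans (sum-cong-≋ term)
    (trans (∑-distrib-+ (cofactor A) (λ j → s * cofactor B j))
      (+-congˡ (sym (*-distribˡ-sum s (cofactor B)))))
    where
    term : ∀ j → cofactor C j ≈ cofactor A j + s * cofactor B j
    term j with j Fin.≟ p
    ... | yes ≡.refl = trans (*-congʳ (*-congˡ (Cp zero)))
      (trans (solve 5 (λ σ a s b D → σ :* (a :+ s :* b) :* D := σ :* a :* D :+ s :* (σ :* b :* D)) refl _ _
          s _ _)
        (+-cong (*-congˡ (det-cong λ i k → sym (A≈C (suc i) _ (Fin.punchInᵢ≢i p k))))
          (*-congˡ (*-congˡ (det-cong λ i k → sym (B≈C (suc i) _ (Fin.punchInᵢ≢i p k)))))))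
    ... | no j≢p = trans (*-congˡ (det-linear p′ s (minor A j) (minor B j) (minor C j)
          (λ i k k≢p′ → A≈C (suc i) _ (k≢p′ ∘ unpunch))
          (λ i k k≢p′ → B≈C (suc i) _ (k≢p′ ∘ unpunch))
          (λ i → ≡.subst (λ q → C (suc i) q ≈ A (suc i) q + s * B (suc i) q)
              (≡.sym (Fin.punchIn-punchOut j≢p)) (Cp (suc i)))))
      (trans (solve 5 (λ σ c s D E → σ :* c :* (D :+ s :* E) := σ :* c :* D :+ s :* (σ :* c :* E)) refl _ _
          s _ _)
        (+-cong (*-congʳ (*-congˡ (sym (A≈C zero j j≢p))))
            (*-congˡ (*-congʳ (*-congˡ (sym (B≈C zero j j≢p)))))))
      where
      p′ = punchOut j≢p
      unpunch : ∀ {k} → punchIn j k ≡ p → k ≡ p′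
      unpunch {k} eq = Fin.punchIn-injective j k p′ (≡.trans eq (≡.sym (Fin.punchIn-punchOut j≢p)))

  sum-cancel : ∀ {n} (t : Vector Carrier (suc n)) (p : Fin n) → t (inject₁ p) + t (suc p) ≈ 0# →
    (∀ j → ¬ j ≡ inject₁ p → ¬ j ≡ suc p → t j ≈ 0#) → sum t ≈ 0#
  sum-cancel {suc n} t zero    eq rest = trans (sym (+-assoc _ _ _))
    (trans (+-cong eq (sum-zero λ j → rest (suc (suc j)) (λ ()) (λ ()))) (+-identityˡ 0#))
  sum-cancel {suc n} t (suc p) eq rest = trans
    (+-cong (rest zero (λ ()) (λ ()))
      (sum-cancel (t ∘ suc) p eq (λ j j≢ j≢′ → rest (suc j) (j≢ ∘ Fin.suc-injective)
          (j≢′ ∘ Fin.suc-injective))))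
    (+-identityˡ 0#)

  punchIn-adjacent : ∀ {n} (j : Fin (suc (suc n))) (p : Fin (suc n)) → ¬ j ≡ inject₁ p → ¬ j ≡ suc p →
    ∃ λ q → punchIn j (inject₁ q) ≡ inject₁ p × punchIn j (suc q) ≡ suc p
  punchIn-adjacent zero zero j≢ j≢′ = contradiction ≡.refl j≢
  punchIn-adjacent zero (suc p) j≢ j≢′ = p , ≡.refl , ≡.refl
  punchIn-adjacent (suc zero) zero j≢ j≢′ = contradiction ≡.refl j≢′
  punchIn-adjacent {suc n} (suc (suc j)) zero j≢ j≢′ = zero , ≡.refl , ≡.refl
  punchIn-adjacent {suc n} (suc j) (suc p) j≢ j≢′
    with punchIn-adjacent j p (j≢ ∘ ≡.cong suc) (j≢′ ∘ ≡.cong suc)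
  ... | q , eq , eq′ = suc q , ≡.cong suc eq , ≡.cong suc eq′

  punchIn-inject₁-suc : ∀ {n} (p k : Fin n) (f : Fin (suc n) → Carrier) → f (inject₁ p) ≈ f (suc p) →
    f (punchIn (inject₁ p) k) ≈ f (punchIn (suc p) k)
  punchIn-inject₁-suc zero    zero    f eq = sym eq
  punchIn-inject₁-suc zero    (suc k) f eq = refl
  punchIn-inject₁-suc (suc p) zero    f eq = refl
  punchIn-inject₁-suc (suc p) (suc k) f eq = punchIn-inject₁-suc p k (f ∘ suc) eq

  -- The two columns have equal minors and opposite signs, and in every other minor they are still
  -- adjacent. Adjacent columns are the only case that the reduction uses.
  det-adjacent : ∀ {n} (A : Matrix (suc n)) (p : Fin n) → (∀ i → A i (inject₁ p) ≈ A i (suc p)) → det A ≈ 0#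
  det-adjacent {suc n} A p eq = sum-cancel (cofactor A) p opposite-terms
    λ j j≢ j≢′ → case punchIn-adjacent j p j≢ j≢′ of λ where
      (q , eq₁ , eq₂) → trans (*-congˡ (det-adjacent (minor A j) q λ i →
        ≡.subst₂ (λ k l → A (suc i) k ≈ A (suc i) l) (≡.sym eq₁) (≡.sym eq₂) (eq (suc i))))
            (zeroʳ ((- 1#) ^ toℕ j * A zero j))
    where
    opposite-terms : (- 1#) ^ toℕ (inject₁ p) * A zero (inject₁ p) * det (minor A (inject₁ p)) +
                     (- 1#) ^ toℕ (suc p) * A zero (suc p) * det (minor A (suc p)) ≈ 0#
    opposite-terms = trans
      (+-congʳ (*-cong (*-cong (reflexive (≡.cong ((- 1#) ^_) (Fin.toℕ-inject₁ p))) (eq zero))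
        (det-cong λ i k → punchIn-inject₁-suc p k (A (suc i)) (eq (suc i)))))
      (solve 3 (λ σ a D → σ :* a :* D :+ :- con (+ 1) :* σ :* a :* D := con (+ 0)) refl _ _ _)

  module _ {n : ℕ} (a : Fin (suc n) → ℕ → Carrier) (s : Carrier) where
    -- From each of the first q columns, s times the original next column is subtracted.
    reduced : ℕ → Fin (suc n) → ℕ → Carrier
    reduced q i j = if does (j ℕ.<? q) then a i j - s * a i (suc j) else a i j

    reduced-< : ∀ {q j} → j ℕ.< q → ∀ i → reduced q i j ≡ a i j - s * a i (suc j)
    reduced-< {q} {j} j<q i = ≡.cong (if_then a i j - s * a i (suc j) else a i j) (dec-true (j ℕ.<? q) j<q)

    reduced-≮ : ∀ {q j} → ¬ j ℕ.< q → ∀ i → reduced q i j ≡ a i j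
    reduced-≮ {q} {j} j≮q i = ≡.cong (if_then a i j - s * a i (suc j) else a i j) (dec-false (j ℕ.<? q) j≮q)

    reduce : ℕ → Matrix (suc n)
    reduce q i j = reduced q i (toℕ j)

    -- Only column q changes, by -s times column q + 1, which is still the original one. B has that
    -- column twice and determinant 0.
    det-reduce-suc : ∀ (q : Fin n) → det (reduce (suc (toℕ q))) ≈ det (reduce (toℕ q))
    det-reduce-suc q = trans
      (det-linear (inject₁ q) (- s) (reduce (toℕ q)) B (reduce (suc (toℕ q)))
        (λ i j j≢ → reflexive (other i j j≢)) (λ i j j≢ → reflexive (≡.trans (B-other i j j≢) (other i j j≢)))
        λ i → trans (reflexive (reduced-< (≡.subst (ℕ._< suc (toℕ q)) (≡.sym (Fin.toℕ-inject₁ q)) ℕ.≤-refl)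
            i))
          (trans (+-cong (reflexive (≡.sym (reduced-≮ (λ p → ℕ.<-irrefl (Fin.toℕ-inject₁ q) p) i)))
             (-‿cong (*-congˡ (reflexive (≡.trans (≡.cong (a i ∘ suc) (Fin.toℕ-inject₁ q))
                 (≡.sym (B-same i)))))))
            (solve 3 (λ x s b → x :+ :- (s :* b) := x :+ :- s :* b) refl _ _ _)))
      (trans (+-congˡ (*-congˡ (det-adjacent B q λ i → reflexive (≡.trans (B-same i)
          (≡.sym (≡.trans (B-other i (suc q) (suc≢ q)) (reduced-≮ (λ p → ℕ.<-asym p ℕ.≤-refl) i)))))))
        (solve 2 (λ x s → x :+ :- s :* con (+ 0) := x) refl _ _))
      where
      B : Matrix (suc n)
      B i j = if does (j Fin.≟ inject₁ q) then a i (suc (toℕ q)) else reduce (toℕ q) i j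
      B-same : ∀ i → B i (inject₁ q) ≡ a i (suc (toℕ q))
      B-same i = ≡.cong (if_then a i (suc (toℕ q)) else reduce (toℕ q) i (inject₁ q))
          (dec-true (inject₁ q Fin.≟ inject₁ q) ≡.refl)
      B-other : ∀ i j → ¬ j ≡ inject₁ q → B i j ≡ reduce (toℕ q) i j
      B-other i j j≢ = ≡.cong (if_then a i (suc (toℕ q)) else reduce (toℕ q) i j)
          (dec-false (j Fin.≟ inject₁ q) j≢)
      suc≢ : ∀ {n} (q : Fin n) → ¬ suc q ≡ inject₁ q
      suc≢ (suc q) eq = suc≢ q (Fin.suc-injective eq)
      other : ∀ i j → ¬ j ≡ inject₁ q → reduce (toℕ q) i j ≡ reduce (suc (toℕ q)) i j
      other i j j≢ with toℕ j ℕ.<? toℕ q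
      ... | yes j<q = ≡.trans (reduced-< j<q i) (≡.sym (reduced-< (ℕ.m<n⇒m<1+n j<q) i))
      ... | no j≮q = ≡.trans (reduced-≮ j≮q i) (≡.sym (reduced-≮ (λ j<1+q → j≢ (Fin.toℕ-injective
              (≡.trans (ℕ.≤-antisym (ℕ.s≤s⁻¹ j<1+q) (ℕ.≮⇒≥ j≮q)) (≡.sym (Fin.toℕ-inject₁ q))))) i))

    det-reduce : ∀ q → q ℕ.≤ n → det (reduce q) ≈ det (reduce 0)
    det-reduce zero    q≤n = refl
    det-reduce (suc q) q<n = trans
      (≡.subst (λ k → det (reduce (suc k)) ≈ det (reduce k)) (Fin.toℕ-fromℕ< q<n)
          (det-reduce-suc (Fin.fromℕ< q<n)))
      (det-reduce q (ℕ.<⇒≤ q<n))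

  det-scale-rows : ∀ {n} (d : Vector Carrier n) (A : Matrix n) →
    det (λ i j → d i * A i j) ≈ Vector.foldr _*_ 1# d * det A
  det-scale-rows {zero}  d A = sym (*-identityˡ 1#)
  det-scale-rows {suc n} d A = trans
    (sum-cong-≋ λ j → trans (*-congˡ (det-scale-rows (d ∘ suc) (minor A j)))
      (solve 5 (λ σ d a P D → σ :* (d :* a) :* (P :* D) := d :* P :* (σ :* a :* D)) refl ((- 1#) ^ toℕ j)
          (d zero) (A zero j) _ _))
    (sym (*-distribˡ-sum (d zero * Vector.foldr _*_ 1# (d ∘ suc)) (cofactor A)))

  punchIn-fromℕ : ∀ {n} (k : Fin n) → punchIn (fromℕ n) k ≡ inject₁ k
  punchIn-fromℕ zero    = ≡.refl
  punchIn-fromℕ (suc k) = ≡.cong suc (punchIn-fromℕ k)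

  det-last-column : ∀ {n} (A : Matrix (suc n)) → (∀ j → A zero (inject₁ j) ≈ 0#) → A zero (fromℕ n) ≈ 1# →
    det A ≈ (- 1#) ^ n * det (λ i j → A (suc i) (inject₁ j))
  det-last-column {n} A zeros one = trans (sum-init-last (cofactor A)) (trans
    (+-cong (sum-zero λ j → trans (*-congʳ (trans (*-congˡ {(- 1#) ^ toℕ (inject₁ j)} (zeros j))
        (zeroʳ _))) (zeroˡ (det (minor A (inject₁ j)))))
      (*-cong (*-cong (reflexive (≡.cong ((- 1#) ^_) (Fin.toℕ-fromℕ n))) one)
        (det-cong λ i j → reflexive (≡.cong (A (suc i)) (punchIn-fromℕ j)))))
    (solve 2 (λ σ D → con (+ 0) :+ σ :* con (+ 1) :* D := σ :* D) refl _ _))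

  product : List Carrier → Carrier
  product = List.foldr _*_ 1#

  vandermonde : List Carrier → Carrier
  vandermonde []       = 1#
  vandermonde (x ∷ xs) = product (List.map (λ y → x - y) xs) * vandermonde xs

  -- The sign from the expansion at the last column reverses each of the n differences.
  signed-product : ∀ {n} x (y : Vector Carrier n) →
    (- 1#) ^ n * Vector.foldr _*_ 1# (λ i → y i - x) ≈ product (List.map (λ y → x - y) (List.tabulate y))
  signed-product {zero}  x y = *-identityˡ 1#
  signed-product {suc n} x y = trans
    (solve 4 (λ σ y x P → :- con (+ 1) :* σ :* ((y :- x) :* P) := (x :- y) :* (σ :* P)) refl ((- 1#) ^ n)
        (y zero) x _)
    (*-congˡ (signed-product x (y ∘ suc)))

  -- Subtracting x₀ times the next column clears the first row up to its last entry x₀^0 = 1 and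
  -- puts the factor x_i - x₀ into the other entries of row i. A smaller Vandermonde matrix remains.
  det-vandermonde : ∀ {n} (x : Vector Carrier n) →
    det (λ i j → x i ^ toℕ (opposite j)) ≈ vandermonde (List.tabulate x)
  det-vandermonde {zero}  x = refl
  det-vandermonde {suc n} x = trans
    (det-cong λ i j → reflexive (≡.cong (x i ^_) (≡.trans (Fin.opposite-prop j) ≡.refl)))
    (trans (sym (det-reduce power (x zero) n ℕ.≤-refl))
    (trans (det-last-column (reduce power (x zero) n)
        (λ j → trans (factored zero j) (trans (*-congʳ (-‿inverseʳ (x zero))) (zeroˡ _)))
        (reflexive (≡.trans (reduced-≮ power (x zero) (λ p → ℕ.<-irrefl (Fin.toℕ-fromℕ n) p) zero)
          (≡.cong (x zero ^_) (≡.trans (≡.cong (n ℕ.∸_) (Fin.toℕ-fromℕ n)) (ℕ.n∸n≡0 n))))))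
    (trans (*-congˡ (trans (det-cong λ i j → factored (suc i) j)
        (trans (det-scale-rows (λ i → x (suc i) - x zero) _) (*-congˡ (det-vandermonde (x ∘ suc))))))
    (trans (sym (*-assoc _ _ _)) (*-congʳ (signed-product (x zero) (x ∘ suc)))))))
    where
    power : Fin (suc n) → ℕ → Carrier
    power i k = x i ^ (n ℕ.∸ k)

    factored : ∀ i (j : Fin n) → reduce power (x zero) n i (inject₁ j) ≈ (x i - x zero) * x i ^ toℕ
        (opposite j)
    factored i j = trans (reflexive (≡.trans (≡.cong (reduced power (x zero) n i) (Fin.toℕ-inject₁ j))
        (reduced-< power (x zero) (Fin.toℕ<n j) i)))
      -- Since j < n, the exponent n - j is positive and one factor x_i splits off.
      (trans (+-congʳ (reflexive (≡.cong (x i ^_)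
          (≡.trans (≡.sym (ℕ.suc-pred (n ℕ.∸ toℕ j) {{ℕ.>-nonZero (ℕ.m<n⇒0<n∸m (Fin.toℕ<n j))}}))
          (≡.cong suc (ℕ.pred[m∸n]≡m∸[1+n] n (toℕ j)))))))
      (trans (solve 3 (λ x y P → x :* P :- y :* P := (x :- y) :* P) refl (x i) (x zero) _)
        (*-congˡ (reflexive (≡.cong (x i ^_) (≡.sym (Fin.opposite-prop j)))))))

  product-↭ : ∀ {xs ys} → xs ↭ ys → product xs ≈ product ys
  product-↭ ↭.refl        = refl
  product-↭ (prep x p)    = *-congˡ (product-↭ p)
  product-↭ (swap x y p)  = trans (*-congˡ (*-congˡ (product-↭ p)))
    (solve 3 (λ x y P → x :* (y :* P) := y :* (x :* P)) refl x y _)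
  product-↭ (↭.trans p q) = trans (product-↭ p) (product-↭ q)

  -- A transposition of neighbours reverses one difference. The sign is not tracked, as it does not
  -- affect whether a coefficient is apart from 0.
  vandermonde-↭ : ∀ {xs ys} → xs ↭ ys →
    vandermonde xs ≈ vandermonde ys ⊎ vandermonde xs ≈ - vandermonde ys
  vandermonde-↭ ↭.refl = inj₁ refl
  vandermonde-↭ (prep x p) with product-↭ (map⁺ (λ y → x - y) p) | vandermonde-↭ p
  ... | eq | inj₁ eq′ = inj₁ (*-cong eq eq′)
  ... | eq | inj₂ eq′ = inj₂ (trans (*-cong eq eq′) (solve 2 (λ P V → P :* :- V := :- (P :* V)) refl _ _))
  vandermonde-↭ {x ∷ y ∷ xs} {y ∷ x ∷ ys} (swap x y p)
    with product-↭ (map⁺ (λ z → x - z) p) | product-↭ (map⁺ (λ z → y - z) p) | vandermonde-↭ p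
  ... | eqx | eqy | inj₁ eq = inj₂ (trans (*-cong (*-congˡ eqx) (*-cong eqy eq))
    (solve 5 (λ x y P Q V → (x :- y) :* P :* (Q :* V) := :- ((y :- x) :* Q :* (P :* V))) refl x y _ _ _))
  ... | eqx | eqy | inj₂ eq = inj₁ (trans (*-cong (*-congˡ eqx) (*-cong eqy eq))
    (solve 5 (λ x y P Q V → (x :- y) :* P :* (Q :* :- V) := (y :- x) :* Q :* (P :* V)) refl x y _ _ _))
  vandermonde-↭ (↭.trans p q) with vandermonde-↭ p | vandermonde-↭ q
  ... | inj₁ eq | inj₁ eq′ = inj₁ (trans eq eq′)
  ... | inj₁ eq | inj₂ eq′ = inj₂ (trans eq eq′)
  ... | inj₂ eq | inj₁ eq′ = inj₂ (trans eq (-‿cong eq′))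
  ... | inj₂ eq | inj₂ eq′ = inj₁ (trans eq (trans (-‿cong eq′) (solve 1 (λ V → :- :- V := V) refl _)))

-- Leading terms of the Vandermonde product with respect to a linear functional.

module LeadingTerms {a ℓ₁ ℓ₂} (K : HeytingField a ℓ₁ ℓ₂) (r : ℕ) where
  open HeytingField K hiding (zero)
  open HeytingFieldProperties K
  open Laurent K r
  open LaurentRing K r
  open SignedRankings {r}
  open Vandermonde rawRing _≈ₗ_ isCommutativeRing′ using (vandermonde; product; vandermonde-↭)
  open RawRing rawRing using () renaming (_*_ to _*ₗ_; -_ to -ₗ_; 1# to 1ₗ)
  open IntegerScalars (commutativeRing K)
    using (solve; _:=_; _:+_; _:*_; _:-_; :-_; con)

  Term : Set a
  Term = Carrier × Exponent r

  monomial : Term → LaurentPoly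
  monomial x = x ∷ []

  difference : Term → Term → LaurentPoly
  difference (a , m) (b , n) = (a , m) ∷ (- b , n) ∷ []

  differences : Term → List Term → LaurentPoly
  differences x ys = product (List.map (difference x) ys)

  vandermondeₘ : List Term → LaurentPoly
  vandermondeₘ ys = vandermonde (List.map monomial ys)

  differences≡ : ∀ x ys → product (List.map (λ y → monomial x ++ (-ₗ y)) (List.map monomial ys)) ≡
      differences x ys
  differences≡ x ys = ≡.cong product (≡.sym (List.map-∘ ys))

  vandermondeₘ-∷ : ∀ x ys → vandermondeₘ (x ∷ ys) ≡ differences x ys *ₗ vandermondeₘ ys
  vandermondeₘ-∷ x ys = ≡.cong (_*ₗ vandermondeₘ ys) (differences≡ x ys)

  constants : List Carrier → List Term
  constants = List.map (_, 0ᵉ)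

  -- The sign of o decides which of z_k and its inverse is listed first, so that the list can follow
  -- the order imposed by a functional.
  pairs : List (Sign × Fin r) → List Term
  pairs []      = []
  pairs (o ∷ L) = (1# , unit o) ∷ (1# , unit (Sign.opposite (proj₁ o) , proj₂ o)) ∷ pairs L

  plusPairs : List (Fin r) → List Term
  plusPairs ks = pairs (List.map (Sign.+ ,_) ks)

  pairs-↭ : ∀ L → pairs L ↭ plusPairs (List.map proj₂ L)
  pairs-↭ []               = ↭-refl
  pairs-↭ ((Sign.+ , k) ∷ L) = prep _ (prep _ (pairs-↭ L))
  pairs-↭ ((Sign.- , k) ∷ L) = swap _ _ (pairs-↭ L)

  plusPairs-↭ : ∀ {ks ls} → ks ↭ ls → plusPairs ks ↭ plusPairs ls
  plusPairs-↭ ↭.refl        = ↭-refl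
  plusPairs-↭ (prep k p)    = prep _ (prep _ (plusPairs-↭ p))
  plusPairs-↭ (swap k l p)  = shifts (_ ∷ _ ∷ []) (_ ∷ _ ∷ []) {plusPairs _} ⟨↭⟩ zoomₗ
    where
    infixr 5 _⟨↭⟩_
    _⟨↭⟩_ = ↭-trans
    zoomₗ = prep _ (prep _ (prep _ (prep _ (plusPairs-↭ p))))
  plusPairs-↭ (↭.trans p q) = ↭-trans (plusPairs-↭ p) (plusPairs-↭ q)

  neg-unit : ∀ (o : Sign × Fin r) → unit (Sign.opposite (proj₁ o) , proj₂ o) ≡ Vec.map ℤ.-_ (unit o)
  neg-unit (Sign.+ , k) = ≡.refl
  neg-unit (Sign.- , k) = ≡.trans (≡.sym (Vec.map-id (basis k)))
      (≡.trans (Vec.map-cong (λ i → ≡.sym (ℤ.neg-involutive i)) (basis k))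
    (Vec.map-∘ ℤ.-_ ℤ.-_ (basis k)))

  unit-cancel : ∀ o → unit o ⊹ unit (Sign.opposite (proj₁ o) , proj₂ o) ≡ 0ᵉ
  unit-cancel o = ≡.trans (≡.cong (unit o ⊹_) (neg-unit o)) (exponent-ext λ k → ≡.trans
    (Vec.lookup-zipWith ℤ._+_ k (unit o) (Vec.map ℤ.-_ (unit o)))
        (≡.trans (≡.cong (ℤ._+_ (Vec.lookup (unit o) k)) (Vec.lookup-map k ℤ.-_ (unit o)))
      (≡.trans (ℤ.+-inverseʳ (Vec.lookup (unit o) k)) (≡.sym (Vec.lookup-replicate k (+ 0))))))

  ⊹-identityˡ : ∀ m → 0ᵉ ⊹ m ≡ m
  ⊹-identityˡ = Vec.zipWith-identityˡ ℤ.+-identityˡ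

  ⊹-assoc : ∀ m n k → (m ⊹ n) ⊹ k ≡ m ⊹ (n ⊹ k)
  ⊹-assoc = Vec.zipWith-assoc ℤ.+-assoc

  -- Products of formal sums are not collected: every listed exponent is a sum of listed exponents
  -- of the factors.
  All-*ₗ : ∀ {p q s} {P : Exponent r → Set p} {Q : Exponent r → Set q} {S : Exponent r → Set s} {f g} →
    (∀ {m n} → P m → Q n → S (m ⊹ n)) → All (P ∘ proj₂) f → All (Q ∘ proj₂) g → All (S ∘ proj₂) (f *ₗ g)
  All-*ₗ h []         qs = []
  All-*ₗ h (p ∷ ps) qs = All.++⁺ (All.map⁺ (All.map (h p) qs)) (All-*ₗ h ps qs)

  module _ (h : Exponent r → ℤ) (h-⊹ : ∀ m n → h (m ⊹ n) ≡ h m ℤ.+ h n) where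

    -- The expansion is only up to `≈ₗ`, because f may list the leading exponent several times, as
    -- in the difference of two constants.
    record HasLead (f : LaurentPoly) (m : Exponent r) : Set (a ⊔ ℓ₁ ⊔ ℓ₂) where
      constructor lead
      field
        coefficient   : Carrier
        coefficient#0 : coefficient # 0#
        tail          : LaurentPoly
        tail-below    : All (λ y → h (proj₂ y) ℤ.< h m) tail
        expansion     : f ≈ₗ (coefficient , m) ∷ tail

    hasLead-resp : ∀ {f g m} → f ≈ₗ g → HasLead f m → HasLead g m
    hasLead-resp f≈g (lead c c#0 t below eq) = lead c c#0 t below λ φ → trans (sym (f≈g φ)) (eq φ)

    hasLead-1 : HasLead 1ₗ 0ᵉ
    hasLead-1 = lead 1# 1#0 [] [] λ φ → refl

    hasLead-* : ∀ {f g m n} → HasLead f m → HasLead g n → HasLead (f *ₗ g) (m ⊹ n)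
    hasLead-* {f} {g} {m} {n} (lead c c#0 s s< eq) (lead d d#0 t t< eq′) = lead (c * d) (x#0y#0→xy#0 c#0 d#0)
      (List.map (λ (b , k) → c * b , m ⊹ k) t ++ s *ₗ ((d , n) ∷ t))
      (All.++⁺ (All.map⁺ (All.map (λ {y} k<n → ≡.subst₂ ℤ._<_ (≡.sym (h-⊹ m (proj₂ y))) (≡.sym (h-⊹ m n))
          (ℤ.+-monoʳ-< (h m) k<n)) t<))
        (All-*ₗ (λ {k} {l} k<m l≤n → ≡.subst₂ ℤ._<_ (≡.sym (h-⊹ k l)) (≡.sym (h-⊹ m n))
            (ℤ.+-mono-<-≤ k<m l≤n)) s<
          (ℤ.≤-refl ∷ All.map ℤ.<⇒≤ t<)))
      (*ₗ-cong {f} {(c , m) ∷ s} {g} {(d , n) ∷ t} eq eq′)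

    hasLead-neg : ∀ {f m} → HasLead f m → HasLead (-ₗ f) m
    hasLead-neg {f} {m} (lead c c#0 t t< eq) = lead (- c) (-‿#0 c#0) (-ₗ t) (All.map⁺ t<)
      λ φ → trans (pair-neg f φ) (trans (-‿cong (eq φ)) (sym (pair-neg ((c , m) ∷ t) φ)))

    coeff-∉ : ∀ {m} g → All (λ y → h (proj₂ y) ℤ.< h m) g → coeff g m ≈ 0#
    coeff-∉ []            []         = refl
    coeff-∉ {m} ((b , n) ∷ g) (n<m ∷ g<) = trans (+-cong
      (reflexive (≡.cong (if_then b else 0#) (dec-false (Vec.≡-dec ℤ._≟_ n m) λ
          { ≡.refl → ℤ.<-irrefl ≡.refl n<m })))
      (coeff-∉ g g<)) (+-identityˡ 0#)

    hasLead-coeff : ∀ {f m} → HasLead f m → coeff f m # 0#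
    hasLead-coeff {f} {m} (lead c c#0 t t< eq) = #-congʳ (sym (trans (coeff-cong {f} {(c , m) ∷ t} eq m)
      (trans (+-cong (reflexive (≡.cong (if_then c else 0#) (dec-true (Vec.≡-dec ℤ._≟_ m m) ≡.refl)))
          (coeff-∉ t t<))
        (+-identityʳ c)))) c#0

    difference-leadˡ : ∀ {x y} → proj₁ x # 0# → h (proj₂ y) ℤ.< h (proj₂ x) → HasLead (difference x y)
        (proj₂ x)
    difference-leadˡ x#0 y<x = lead _ x#0 _ (y<x ∷ []) λ φ → refl

    difference-leadʳ : ∀ {x y} → proj₁ y # 0# → h (proj₂ x) ℤ.< h (proj₂ y) → HasLead (difference x y)
        (proj₂ y)
    difference-leadʳ {x} {y} y#0 x<y = lead _ (-‿#0 y#0) _ (x<y ∷ []) λ φ →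
      solve 2 (λ a b → a :+ (b :+ con (+ 0)) := b :+ (a :+ con (+ 0))) refl _ _

    difference-lead-≡ : ∀ {a b m} → a # b → HasLead (difference (a , m) (b , m)) m
    difference-lead-≡ {a} {b} {m} a#b = lead (a - b) (#⇒-#0 a#b) [] [] λ φ →
      solve 3 (λ a b x → a :* x :+ (:- b :* x :+ con (+ 0)) := (a :- b) :* x :+ con (+ 0)) refl a b (φ m)

    hasLead-≡ : ∀ {f m n} → m ≡ n → HasLead f m → HasLead f n
    hasLead-≡ ≡.refl l = l

    h-0 : h 0ᵉ ≡ + 0
    h-0 = ℤGroup.∙-cancelˡ (h 0ᵉ) _ _ (≡.trans (≡.sym (h-⊹ 0ᵉ 0ᵉ))
        (≡.trans (≡.cong h (⊹-identityˡ 0ᵉ)) (≡.sym (ℤ.+-identityʳ _))))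

    h-opposite : ∀ o → h (unit (Sign.opposite (proj₁ o) , proj₂ o)) ≡ ℤ.- h (unit o)
    h-opposite o = ℤGroup.∙-cancelˡ (h (unit o)) _ _ (≡.trans (≡.sym (h-⊹ _ _))
      (≡.trans (≡.cong h (unit-cancel o)) (≡.trans h-0 (≡.sym (ℤ.+-inverseʳ (h (unit o)))))))

    Positive : Sign × Fin r → Set
    Positive o = + 0 ℤ.< h (unit o)

    opposite-negative : ∀ o → Positive o → h (unit (Sign.opposite (proj₁ o) , proj₂ o)) ℤ.< + 0
    opposite-negative o 0<o = ≡.subst (ℤ._< + 0) (≡.sym (h-opposite o)) (ℤ.neg-mono-< 0<o)

    total : List (Sign × Fin r) → Exponent r
    total []      = 0ᵉ
    total (o ∷ L) = unit o ⊹ total L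

    -- Of the two factors belonging to o, one is led by the variable, whose exponent is positive
    -- under h, the other by the constant b.
    constant-pairs : ∀ {b} L → b # 0# → All Positive L → HasLead (differences (b , 0ᵉ) (pairs L)) (total L)
    constant-pairs []      b#0 []         = hasLead-1
    constant-pairs (o ∷ L) b#0 (0<o ∷ 0<L) = hasLead-*
      (difference-leadʳ 1#0 (≡.subst (ℤ._< h (unit o)) (≡.sym h-0) 0<o))
      (hasLead-≡ (⊹-identityˡ _) (hasLead-*
        (difference-leadˡ b#0 (≡.subst (h (unit (Sign.opposite (proj₁ o) , proj₂ o)) ℤ.<_) (≡.sym h-0)
            (opposite-negative o 0<o)))
        (constant-pairs L b#0 0<L)))

    constant-constants : ∀ {b} cs ys {m} → All (b #_) cs → HasLead (differences (b , 0ᵉ) ys) m →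
      HasLead (differences (b , 0ᵉ) (constants cs ++ ys)) m
    constant-constants []       ys []         l = l
    constant-constants (c ∷ cs) ys (b#c ∷ b#cs) l = hasLead-≡ (⊹-identityˡ _)
      (hasLead-* (difference-lead-≡ b#c) (constant-constants cs ys b#cs l))

    multiple : ℕ → Exponent r → Exponent r
    multiple n = Vec.map (+ n ℤ.*_)

    multiple-0 : ∀ u → multiple 0 u ≡ 0ᵉ
    multiple-0 u = exponent-ext λ k → ≡.trans (Vec.lookup-map k (+ 0 ℤ.*_) u)
      (≡.sym (Vec.lookup-replicate k (+ 0)))

    multiple-suc : ∀ n u → u ⊹ multiple n u ≡ multiple (suc n) u
    multiple-suc n u = exponent-ext λ k → ≡.trans (Vec.lookup-zipWith ℤ._+_ k u (multiple n u))
      (≡.trans (≡.cong (ℤ._+_ (Vec.lookup u k)) (Vec.lookup-map k (+ n ℤ.*_) u))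
        (≡.trans (≡.sym (ℤ.suc-* (+ n) (Vec.lookup u k))) (≡.sym (Vec.lookup-map k (+ suc n ℤ.*_) u))))

    -- The variable z^u dominates every other one and its inverse, so it leads all 2 |L| factors.
    largest-pairs : ∀ u L → All Positive L → All (λ o → h (unit o) ℤ.< h u) L →
      HasLead (differences (1# , u) (pairs L)) (multiple (2 ℕ.* length L) u)
    largest-pairs u []      []          []          = hasLead-≡ (≡.sym (multiple-0 u)) hasLead-1
    largest-pairs u (o ∷ L) (0<o ∷ 0<L) (o<u ∷ L<u) = hasLead-≡
      (≡.trans (≡.cong (u ⊹_) (multiple-suc (2 ℕ.* length L) u))
          (≡.trans (multiple-suc (suc (2 ℕ.* length L)) u)
          (≡.cong (λ n → multiple n u) (≡.sym (ℕ.*-suc 2 (length L))))))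
      (hasLead-* (difference-leadˡ 1#0 o<u) (hasLead-*
        (difference-leadˡ 1#0 (ℤ.<-trans (opposite-negative o 0<o) (ℤ.<-trans 0<o o<u)))
        (largest-pairs u L 0<L L<u)))

    -- The inverse of the largest variable leads no factor; the leading exponents o′ and -o′ cancel
    -- in pairs.
    smallest-pairs : ∀ o L → All Positive L → All (λ o′ → h (unit o′) ℤ.< h (unit o)) L →
      HasLead (differences (1# , unit (Sign.opposite (proj₁ o) , proj₂ o)) (pairs L)) 0ᵉ
    smallest-pairs o []       []            []            = hasLead-1
    smallest-pairs o (o′ ∷ L) (0<o′ ∷ 0<L) (o′<o ∷ L<o) = hasLead-≡
      (≡.trans (≡.sym (⊹-assoc _ _ 0ᵉ)) (≡.trans (≡.cong (_⊹ 0ᵉ) (unit-cancel o′)) (⊹-identityˡ 0ᵉ)))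
      (hasLead-* (difference-leadʳ 1#0 (ℤ.<-trans (opposite-negative o (ℤ.<-trans 0<o′ o′<o)) 0<o′))
          (hasLead-*
        (difference-leadʳ 1#0 (≡.subst₂ ℤ._<_ (≡.sym (h-opposite o)) (≡.sym (h-opposite o′))
            (ℤ.neg-mono-< o′<o)))
        (smallest-pairs o L 0<L L<o)))

    -- The vector o is selected once by the factor with its own inverse and 2 |L| times by the later
    -- pairs. This is the coefficient 1 + 2 |L|.
    pairs-lead : ∀ L → All Positive L → AllPairs (λ o o′ → h (unit o′) ℤ.< h (unit o)) L →
      HasLead (vandermondeₘ (pairs L)) (rankExponent 1 L)
    pairs-lead []      []          []              = hasLead-1
    pairs-lead (o ∷ L) (0<o ∷ 0<L) (L<o ∷ sorted) = ≡.subst (λ f → HasLead f (rankExponent 1 (o ∷ L)))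
      (≡.sym (≡.trans (vandermondeₘ-∷ _ (_ ∷ pairs L))
          (≡.cong (differences _ (_ ∷ pairs L) *ₗ_) (vandermondeₘ-∷ _ (pairs L)))))
      (hasLead-≡ (≡.cong₂ _⊹_ (multiple-suc (2 ℕ.* length L) (unit o)) (⊹-identityˡ (rankExponent 1 L)))
        (hasLead-* (hasLead-* (difference-leadˡ 1#0 (ℤ.<-trans (opposite-negative o 0<o) 0<o))
            (largest-pairs (unit o) L 0<L L<o))
          (hasLead-* (smallest-pairs o L 0<L L<o) (pairs-lead L 0<L sorted))))

    -- The effect of one more constant: it raises each coefficient by 1, so that t constants take
    -- the smallest coefficient from 1 to t + 1.
    total-rankExponent : ∀ c L → total L ⊹ rankExponent c L ≡ rankExponent (suc c) L
    total-rankExponent c []      = ⊹-identityˡ 0ᵉ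
    total-rankExponent c (o ∷ L) = ≡.trans
      (exponent-ext λ k → ≡.trans (lookup-⊹ k (unit o ⊹ total L) (m ⊹ R))
          (≡.trans (≡.cong₂ ℤ._+_ (lookup-⊹ k (unit o) (total L)) (lookup-⊹ k m R))
        (≡.trans (ℤ-interchange (Vec.lookup (unit o) k) (Vec.lookup (total L) k) (Vec.lookup m k)
            (Vec.lookup R k)) (≡.sym (≡.trans (lookup-⊹ k (unit o ⊹ m) (total L ⊹ R))
            (≡.cong₂ ℤ._+_ (lookup-⊹ k (unit o) m) (lookup-⊹ k (total L) R)))))))
      (≡.cong₂ _⊹_ (multiple-suc (c ℕ.+ 2 ℕ.* length L) (unit o)) (total-rankExponent c L))
      where
      m = multiple (c ℕ.+ 2 ℕ.* length L) (unit o)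
      R = rankExponent c L
      lookup-⊹ : ∀ k m n → Vec.lookup (m ⊹ n) k ≡ Vec.lookup m k ℤ.+ Vec.lookup n k
      lookup-⊹ k m n = Vec.lookup-zipWith ℤ._+_ k m n
      open Data.Integer.Solver.+-*-Solver using () renaming (solve to solveℤ; _:=_ to _:=ℤ_; _:+_ to _:+ℤ_)
      ℤ-interchange : ∀ x y z w → (x ℤ.+ y) ℤ.+ (z ℤ.+ w) ≡ (x ℤ.+ z) ℤ.+ (y ℤ.+ w)
      ℤ-interchange = solveℤ 4 (λ x y z w → (x :+ℤ y) :+ℤ (z :+ℤ w) :=ℤ (x :+ℤ z) :+ℤ (y :+ℤ w)) ≡.refl

    vandermonde-lead : ∀ cs L → All (_# 0#) cs → AllPairs _#_ cs →
      All Positive L → AllPairs (λ o o′ → h (unit o′) ℤ.< h (unit o)) L →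
      HasLead (vandermondeₘ (constants cs ++ pairs L)) (rankExponent (suc (length cs)) L)
    vandermonde-lead []       L []          []              0<L sorted = pairs-lead L 0<L sorted
    vandermonde-lead (c ∷ cs) L (c#0 ∷ cs#0) (c# ∷ distinct) 0<L sorted =
      ≡.subst (λ f → HasLead f (rankExponent (suc (length (c ∷ cs))) L))
          (≡.sym (vandermondeₘ-∷ _ (constants cs ++ pairs L)))
      (hasLead-≡ (total-rankExponent (suc (length cs)) L)
        (hasLead-* (constant-constants cs (pairs L) c# (constant-pairs L c#0 0<L))
          (vandermonde-lead cs L cs#0 distinct 0<L sorted)))

  hasLead-vandermondeₘ-↭ : ∀ h h-⊹ {xs ys m} → xs ↭ ys →
    HasLead h h-⊹ (vandermondeₘ ys) m → HasLead h h-⊹ (vandermondeₘ xs) m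
  hasLead-vandermondeₘ-↭ h h-⊹ {xs} {ys} p l with vandermonde-↭ (map⁺ monomial p)
  ... | inj₁ eq = hasLead-resp h h-⊹ {vandermondeₘ ys} {vandermondeₘ xs} (λ φ → sym (eq φ)) l
  ... | inj₂ eq = hasLead-resp h h-⊹ { -ₗ vandermondeₘ ys} {vandermondeₘ xs} (λ φ → sym (eq φ))
      (hasLead-neg h h-⊹ l)

  dot : ∀ {n} → (Fin n → ℤ) → Vec ℤ n → ℤ
  dot y Vec.[]      = + 0
  dot y (x Vec.∷ m) = y zero ℤ.* x ℤ.+ dot (y ∘ suc) m

  dot-+ : ∀ {n} (y : Fin n → ℤ) m m′ → dot y (Vec.zipWith ℤ._+_ m m′) ≡ dot y m ℤ.+ dot y m′
  dot-+ y Vec.[]      Vec.[]        = ≡.refl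
  dot-+ y (x Vec.∷ m) (x′ Vec.∷ m′) = ≡.trans (≡.cong (ℤ._+_ (y zero ℤ.* (x ℤ.+ x′))) (dot-+ (y ∘ suc) m m′))
    (solveℤ 5 (λ y x x′ d d′ → y :*ℤ (x :+ℤ x′) :+ℤ (d :+ℤ d′) :=ℤ (y :*ℤ x :+ℤ d) :+ℤ (y :*ℤ x′ :+ℤ d′))
        ≡.refl
      (y zero) x x′ (dot (y ∘ suc) m) (dot (y ∘ suc) m′))
    where open Data.Integer.Solver.+-*-Solver using () renaming (solve to solveℤ; _:=_ to _:=ℤ_; _:+_ to _:+ℤ_; _:*_ to _:*ℤ_)

  dot-neg : ∀ {n} (y : Fin n → ℤ) m → dot y (Vec.map ℤ.-_ m) ≡ ℤ.- dot y m
  dot-neg y Vec.[]      = ≡.refl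
  dot-neg y (x Vec.∷ m) = ≡.trans (≡.cong (ℤ._+_ (y zero ℤ.* (ℤ.- x))) (dot-neg (y ∘ suc) m))
    (solveℤ 3 (λ y x d → y :*ℤ (:-ℤ x) :+ℤ (:-ℤ d) :=ℤ :-ℤ (y :*ℤ x :+ℤ d)) ≡.refl (y zero) x
        (dot (y ∘ suc) m))
    where open Data.Integer.Solver.+-*-Solver using () renaming (solve to solveℤ; _:=_ to _:=ℤ_; _:+_ to _:+ℤ_; _:*_ to _:*ℤ_; :-_ to :-ℤ_)

  dot-zero : ∀ {n} (y : Fin n → ℤ) → dot y (Vec.tabulate λ _ → + 0) ≡ + 0
  dot-zero {zero}  y = ≡.refl
  dot-zero {suc n} y = ≡.cong₂ ℤ._+_ (ℤ.*-zeroʳ (y zero)) (dot-zero (y ∘ suc))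

  dot-basis : ∀ {n} (y : Fin n → ℤ) k → dot y (basis k) ≡ y k
  dot-basis y zero    = ≡.trans (≡.cong₂ ℤ._+_ (ℤ.*-identityʳ (y zero)) (dot-zero (y ∘ suc)))
      (ℤ.+-identityʳ (y zero))
  dot-basis y (suc k) = ≡.trans (≡.cong₂ ℤ._+_ (ℤ.*-zeroʳ (y zero)) (dot-basis (y ∘ suc) k))
      (ℤ.+-identityˡ (y (suc k)))

  sign-self : ∀ ε v {y : Fin r → ℤ} {k} → y k ≡ ε ℤ.◃ v → dot y (unit (ε , k)) ≡ + v
  sign-self Sign.+ v {y} {k} eq = ≡.trans (dot-basis y k) (≡.trans eq (ℤ.+◃n≡+n v))
  sign-self Sign.- v {y} {k} eq = ≡.trans (dot-neg y (basis k)) (≡.trans (≡.cong ℤ.-_ (≡.trans (dot-basis y k)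
    (≡.trans eq (ℤ.-◃n≡-n v)))) (ℤ.neg-involutive (+ v)))

  vandermonde-coeff : ∀ cs → All (_# 0#) cs → AllPairs _#_ cs → ∀ w →
    coeff (vandermondeₘ (constants cs ++ plusPairs (allFin r))) (signedTop (length cs ℕ.+ 1) w) # 0#
  vandermonde-coeff cs cs#0 distinct w@(ε , σ) = hasLead-coeff h h-⊹
    (hasLead-vandermondeₘ-↭ h h-⊹
      (++⁺ˡ (constants cs) (↭-trans (plusPairs-↭ (↭-sym (ranking-↭ w))) (↭-sym (pairs-↭ (ranking w)))))
      (hasLead-≡ h h-⊹ (≡.trans (rankExponent-ranking (suc (length cs)) w)
          (≡.cong (λ c → signedTop c w) (ℕ.+-comm 1 (length cs))))
        (vandermonde-lead h h-⊹ cs (ranking w) cs#0 distinct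
          (All.tabulate⁺ λ i → ≡.subst (+ 0 ℤ.<_) (≡.sym (h-entry i)) (ℤ.+<+ (ℕ.m<n⇒0<n∸m (Fin.toℕ<n i))))
          (AllPairs.tabulate⁺-< λ {i} {j} i<j → ≡.subst₂ ℤ._<_ (≡.sym (h-entry j)) (≡.sym (h-entry i))
            (ℤ.+<+ (ℕ.∸-monoʳ-< i<j (ℕ.<⇒≤ (Fin.toℕ<n j))))))))
    where
    entry : Fin r → ℕ
    entry i = r ℕ.∸ toℕ i
    -- The functional takes the value r - i at vector i of `ranking w`, counted from 0: the values
    -- are positive and strictly decreasing, as the leading-term lemmas require.
    y : Fin r → ℤ
    y k = ε k ℤ.◃ entry (σ ⟨$⟩ʳ k)
    h = dot y
    h-⊹ = dot-+ y
    h-entry : ∀ i → h (unit (ε (σ ⟨$⟩ˡ i) , σ ⟨$⟩ˡ i)) ≡ + entry i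
    h-entry i = sign-self (ε (σ ⟨$⟩ˡ i)) (entry i) (≡.cong (λ j → ε (σ ⟨$⟩ˡ i) ℤ.◃ entry j) (inverseʳ σ))

-- Convexity of zonotopes.

module Convex {c ℓ₁ ℓ₂ ℓ₃} (F : OrderedField c ℓ₁ ℓ₂ ℓ₃) (r : ℕ) where
  open OrderedField F hiding (zero)
  open OrderedFieldProperties F
  open Polytope F r
  open Zonotopes F r

  private variable
    ℓ ℓ′ : Level
    n : ℕ

  Convex : Pred Point ℓ → Set _
  Convex S = ∀ {n} (w : Vector Carrier n) (x : Vector Point n) → (∀ i → 0# ≤ w i) → sum w ≈ 1# →
    (∀ i → S (x i)) → S (∑ (λ i → w i · x i))

  segment-convex : ∀ a b → Convex (segment a b)
  segment-convex a b w x 0≤w Σw≈1 x∈ = sum ws , sum-nonNeg (λ i → *-nonNeg (0≤w i) (0≤s i)) ,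
    0≤-⇒≤ (≤-respʳ complement (sum-nonNeg λ i → *-nonNeg (0≤w i) (≤⇒0≤- (s≤1 i)))) ,
    λ k → trans (sum-cong-≋ λ i → trans (*-congˡ (x≋ i k))
        (solve 4 (λ w s a b → w :* ((con (+ 1) :- s) :* a :+ s :* b) := w :* (con (+ 1) :- s) :* a :+ w :*
            s :* b) refl (w i) (s i) (a k) (b k)))
      (trans (∑-distrib-+ (λ i → w i * (1# - s i) * a k) (λ i → ws i * b k))
        (+-cong (trans (sym (*-distribʳ-sum (a k) (λ i → w i * (1# - s i)))) (*-congʳ complement))
            (sym (*-distribʳ-sum (b k) ws))))
    where
    s : _ → Carrier
    s i = proj₁ (x∈ i)
    0≤s : ∀ i → 0# ≤ s i
    0≤s i = proj₁ (proj₂ (x∈ i))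
    s≤1 : ∀ i → s i ≤ 1#
    s≤1 i = proj₁ (proj₂ (proj₂ (x∈ i)))
    x≋ : ∀ i → x i ≋ ((1# - s i) · a) +ₚ (s i · b)
    x≋ i = proj₂ (proj₂ (proj₂ (x∈ i)))
    ws : _ → Carrier
    ws i = w i * s i
    complement : sum (λ i → w i * (1# - s i)) ≈ 1# - sum ws
    complement = trans (solve 2 (λ x y → x := x :+ y :- y) refl _ (sum ws)) (+-congʳ (trans
      (sym (∑-distrib-+ (λ i → w i * (1# - s i)) ws))
      (trans (sum-cong-≋ λ i → solve 2 (λ w s → w :* (con (+ 1) :- s) :+ w :* s := w) refl (w i) (s i))
          Σw≈1)))

  ⊕-convex : {S : Pred Point ℓ} {T : Pred Point ℓ′} → Convex S → Convex T → Convex (S ⊕ T)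
  ⊕-convex {S = S} {T} S-convex T-convex w x 0≤w Σw≈1 x∈ =
    ∑ (λ i → w i · a i) , ∑ (λ i → w i · b i) ,
    S-convex w a 0≤w Σw≈1 (λ i → proj₁ (proj₂ (proj₂ (x∈ i)))) ,
    T-convex w b 0≤w Σw≈1 (λ i → proj₁ (proj₂ (proj₂ (proj₂ (x∈ i))))) ,
    λ k → trans (sum-cong-≋ λ i → trans (*-congˡ (proj₂ (proj₂ (proj₂ (proj₂ (x∈ i)))) k))
        (solve 3 (λ w a b → w :* (a :+ b) := w :* a :+ w :* b) refl (w i) (a i k) (b i k)))
      (∑-distrib-+ (λ i → w i * a i k) (λ i → w i * b i k))
    where
    a b : _ → Point
    a i = proj₁ (x∈ i)
    b i = proj₁ (proj₂ (x∈ i))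

  ⨁-convex : {A : Fin n → Pred Point ℓ} → (∀ l → Convex (A l)) → Convex (⨁ A)
  ⨁-convex A-convex w x 0≤w Σw≈1 x∈ =
    (λ l → ∑ (λ i → w i · a i l)) ,
    (λ l → A-convex l w (λ i → a i l) 0≤w Σw≈1 (λ i → proj₁ (proj₂ (x∈ i)) l)) ,
    λ k → trans (sum-cong-≋ λ i → trans (*-congˡ (proj₂ (proj₂ (x∈ i)) k))
        (*-distribˡ-sum (w i) (λ l → a i l k)))
      (∑-comm (λ i l → w i * a i l k))
    where
    a : _ → _ → Point
    a i = proj₁ (x∈ i)

  zonotope-convex : ∀ τ (u : Vector Point n) → Convex (Zonotope τ u)
  zonotope-convex τ u = ⊕-convex {S = ⨁ box} {T = ⨁ λ l → ⨁ (pairs l)}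
    (⨁-convex {A = box} λ k → segment-convex (-ₚ (τ · u k)) (τ · u k))
    (⨁-convex {A = λ l → ⨁ (pairs l)} λ l → ⨁-convex {A = pairs l} λ k′ →
      pairSegments-convex (u (inject {i = l} k′)) (u l))
    where
    box : Fin _ → Pred Point _
    box k = segment (-ₚ (τ · u k)) (τ · u k)
    pairs : (l : Fin _) → Fin′ l → Pred Point _
    pairs l k′ = PairSegments (u (inject {i = l} k′)) (u l)
    pairSegments-convex : ∀ x y → Convex (PairSegments x y)
    pairSegments-convex x y = ⊕-convex {S = segment (-ₚ (x -ₚ y)) (x -ₚ y)}
        {T = segment (-ₚ (x +ₚ y)) (x +ₚ y)}
      (segment-convex (-ₚ (x -ₚ y)) (x -ₚ y)) (segment-convex (-ₚ (x +ₚ y)) (x +ₚ y))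

-- The support of the Vandermonde product lies in the zonotope.

module Support {a a₁ a₂ c ℓ₁ ℓ₂ ℓ₃} (K : HeytingField a a₁ a₂) (F : OrderedField c ℓ₁ ℓ₂ ℓ₃) (r : ℕ) where
  open OrderedField F hiding (zero)
  open OrderedFieldProperties F
  open Polytope F r
  open Convexity F r using (0ₚ)
  open Ranking F r
  open Zonotopes F r
  open LaurentRing K r using (0ᵉ; _⊹_)
  open LeadingTerms K r
  open Laurent K r using (LaurentPoly; rawRing)
  open RawRing rawRing using () renaming (_*_ to _*ₗ_)

  private variable
    ℓ ℓ′ ℓ″ : Level
    p q u v x y : Point
    n : ℕ
    S : Pred Point ℓ
    T : Pred Point ℓ′
    U : Pred Point ℓ″

  -- Concerns the listed terms, whether or not they cancel, and therefore passes to products by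
  -- Minkowski addition.
  SupportedIn : Pred Point ℓ → LaurentPoly → Set _
  SupportedIn S = All (λ y → S (fromExponent (proj₂ y)))

  fromExponent-⊹ : ∀ m n → fromExponent (m ⊹ n) ≋ fromExponent m +ₚ fromExponent n
  fromExponent-⊹ m n k = trans (reflexive (≡.cong fromℤ (Vec.lookup-zipWith ℤ._+_ k m n)))
    (fromℤ-+ (Vec.lookup m k) (Vec.lookup n k))

  fromExponent-0 : fromExponent 0ᵉ ≋ 0ₚ
  fromExponent-0 k = reflexive (≡.cong fromℤ (Vec.lookup-replicate k (+ 0)))

  supported-* : ∀ {f g} → SupportedIn S f → SupportedIn T g →
    (∀ {p x y} → S x → T y → p ≋ x +ₚ y → U p) → SupportedIn U (f *ₗ g)
  supported-* {S = S} {T = T} {U = U} Sf Tg h = All-*ₗ {P = λ m → S (fromExponent m)}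
      {Q = λ m → T (fromExponent m)}
    {S = λ m → U (fromExponent m)} (λ {m} {n} Sm Tn → h Sm Tn (fromExponent-⊹ m n)) Sf Tg

  segment-resp : ∀ {u′ v′ p′} → u ≋ u′ → v ≋ v′ → p ≋ p′ → segment u v p → segment u′ v′ p′
  segment-resp u≋ v≋ p≋ (s , 0≤s , s≤1 , eq) = s , 0≤s , s≤1 , λ k →
    trans (sym (p≋ k)) (trans (eq k) (+-cong (*-congˡ (u≋ k)) (*-congˡ (v≋ k))))

  -- Symmetric segments are easier to add in the parameter κ = 2s - 1, which runs from -1 to 1.
  segment-symmetric⁺ : ∀ κ d → 0# ≤ 1# + κ → 0# ≤ 1# - κ → p ≋ κ · d → segment (-ₚ d) d p
  segment-symmetric⁺ {p = p} κ d 0≤1+κ 0≤1-κ p≋ = s , *-nonNeg 0≤½ 0≤1+κ ,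
    0≤-⇒≤ (≤-respʳ (trans (solve 2 (λ x y → x := x :+ y :- y) refl (½ * (1# - κ)) s) (+-congʳ halves))
      (*-nonNeg 0≤½ 0≤1-κ)) ,
    λ k → trans (p≋ k) (sym (trans
      (solve 2 (λ s d → (con (+ 1) :- s) :* (:- d) :+ s :* d := (s :+ s :- con (+ 1)) :* d) refl s (d k))
      (*-congʳ doubled)))
    where
    ½ = proj₁ (pos⇒inverse 0<two)
    2½≈1 : two * ½ ≈ 1#
    2½≈1 = proj₁ (proj₂ (pos⇒inverse 0<two))
    0≤½ : 0# ≤ ½
    0≤½ = proj₂ (proj₂ (pos⇒inverse 0<two))
    s = ½ * (1# + κ)
    halves : ½ * (1# - κ) + s ≈ 1#
    halves = trans (solve 2 (λ x κ → x :* (con (+ 1) :- κ) :+ x :* (con (+ 1) :+ κ) := con (+ 2) :* x) refl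
        ½ κ) 2½≈1
    doubled : s + s - 1# ≈ κ
    doubled = trans (+-congʳ (solve 2 (λ x y → x :* y :+ x :* y := con (+ 2) :* x :* y) refl ½ (1# + κ)))
      (trans (+-congʳ (*-congʳ 2½≈1)) (solve 1 (λ κ → con (+ 1) :* (con (+ 1) :+ κ) :- con (+ 1) := κ) refl
          κ))

  segment-symmetric⁻ : ∀ d → segment (-ₚ d) d p → ∃ λ κ → 0# ≤ 1# + κ × 0# ≤ 1# - κ × p ≋ κ · d
  segment-symmetric⁻ d (s , 0≤s , s≤1 , p≋) = s + s - 1# ,
    ≤-respʳ (solve 1 (λ s → s :+ s := con (+ 1) :+ (s :+ s :- con (+ 1))) refl s) (+-nonNeg 0≤s 0≤s) ,
    ≤-respʳ (solve 1 (λ s → con (+ 1) :- s :+ (con (+ 1) :- s) := con (+ 1) :- (s :+ s :- con (+ 1))) refl s)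
      (+-nonNeg (≤⇒0≤- s≤1) (≤⇒0≤- s≤1)) ,
    λ k → trans (p≋ k) (solve 2 (λ s d → (con (+ 1) :- s) :* (:- d) :+ s :* d := (s :+ s :- con (+ 1)) :*
        d) refl s (d k))

  -- The sum is (s′ - s)(u - v): two opposite segments amount to one segment centred at the origin.
  segment-opposite : ∀ u v → segment u v x → segment (-ₚ u) (-ₚ v) y → p ≋ x +ₚ y →
    segment (-ₚ (u -ₚ v)) (u -ₚ v) p
  segment-opposite u v (s , 0≤s , s≤1 , x≋) (s′ , 0≤s′ , s′≤1 , y≋) p≋ = segment-symmetric⁺ (s′ - s) (u -ₚ v)
    (≤-respʳ (solve 2 (λ s s′ → con (+ 1) :- s :+ s′ := con (+ 1) :+ (s′ :- s)) refl s s′)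
        (+-nonNeg (≤⇒0≤- s≤1) 0≤s′))
    (≤-respʳ (solve 2 (λ s s′ → con (+ 1) :- s′ :+ s := con (+ 1) :- (s′ :- s)) refl s s′)
        (+-nonNeg (≤⇒0≤- s′≤1) 0≤s))
    λ k → trans (p≋ k) (trans (+-cong (x≋ k) (y≋ k))
      (solve 4 (λ s s′ u v → (con (+ 1) :- s) :* u :+ s :* v :+
          ((con (+ 1) :- s′) :* (:- u) :+ s′ :* (:- v)) := (s′ :- s) :* (u :- v))
        refl s s′ (u k) (v k)))

  ⨁-cons : {A : Fin (suc n) → Pred Point ℓ} → A zero x → ⨁ (A ∘ suc) y → p ≋ x +ₚ y → ⨁ A p
  ⨁-cons x∈ (ys , ys∈ , y≋) p≋ = (λ { zero → _ ; (suc i) → ys i }) , (λ { zero → x∈ ; (suc i) → ys∈ i }) ,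
    λ k → trans (p≋ k) (+-congˡ (y≋ k))

  difference-supported : ∀ x y → SupportedIn (segment (fromExponent (proj₂ x)) (fromExponent (proj₂ y)))
      (difference x y)
  difference-supported x y =
    (0# , 0≤0 , 0≤1 , λ k → solve 2 (λ a b → a := (con (+ 1) :- con (+ 0)) :* a :+ con (+ 0) :* b) refl _ _) ∷
    (1# , 0≤1 , ≈⇒≤ refl , λ k → solve 2 (λ a b → b := (con (+ 1) :- con (+ 1)) :* a :+ con (+ 1) :* b)
        refl _ _) ∷ []

  Box : Carrier → Vector Point n → Pred Point _
  Box τ u = ⨁ λ k → segment (-ₚ (τ · u k)) (τ · u k)

  -- The region for the exponents of the product, over all l, of the differences of z^u with the
  -- variable of exponent v_l and with its inverse.
  Cross : Point → Vector Point n → Pred Point _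
  Cross u v = ⨁ λ l → segment u (v l) ⊕ segment u (-ₚ v l)

  cross-resp : ∀ {u′} {v : Vector Point n} → u ≋ u′ → Cross u v p → Cross u′ v p
  cross-resp u≋ (x , x∈ , p≋) = x , (λ l → let (a , b , a∈ , b∈ , eq) = x∈ l in
    a , b , segment-resp u≋ (λ _ → refl) (λ _ → refl) a∈ , segment-resp u≋ (λ _ → refl) (λ _ → refl) b∈ ,
        eq) , p≋

  cross-supported : ∀ x (g : Fin n → Fin r) →
    SupportedIn (Cross (fromExponent (proj₂ x)) (e ∘ g)) (differences x (plusPairs (tabulate g)))
  cross-supported {n = zero}  x g = ((λ ()) , (λ ()) , fromExponent-0) ∷ []
  cross-supported {n = suc n} x g =
    supported-* {S = segment m (e (g zero))} {T = S₁ ⊕ S₂} {U = Cross m (e ∘ g)}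
      (difference-supported x (1ᴷ , unit (Sign.+ , g zero)))
      (supported-* {S = S₁} {T = S₂} {U = S₁ ⊕ S₂}
        (difference-supported x (1ᴷ , unit (Sign.- , g zero))) (cross-supported x (g ∘ suc))
        λ {_} {a} {b} a∈ b∈ eq → a , b , a∈ , b∈ , eq)
      λ { {p} {a} a∈ (b , c , b∈ , c∈ , eq) p≋ → ⨁-cons
          {A = λ l → segment m (e (g l)) ⊕ segment m (-ₚ e (g l))}
        (a , b , a∈ , segment-resp (λ _ → refl) (vec-neg (Sign.+ , g zero)) (λ _ → refl) b∈ , λ k → refl) c∈
        λ k → trans (p≋ k) (trans (+-congˡ (eq k)) (sym (+-assoc _ _ _))) }
    where
    open HeytingField K using () renaming (1# to 1ᴷ)
    m = fromExponent (proj₂ x)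
    S₁ = segment m (vec (Sign.- , g zero))
    S₂ = Cross m (e ∘ g ∘ suc)

  -- The case of a constant: [0, v] and [0, -v] add up to [-v, v].
  cross⇒box : ∀ {u} {v : Vector Point n} → u ≋ 0ₚ → Cross u v p → Box 1# v p
  cross⇒box {u = u} {v} u≋0 (y , y∈ , p≋) = y , (λ l →
    let (a , b , (s , 0≤s , s≤1 , a≋) , (s′ , 0≤s′ , s′≤1 , b≋) , eq) = y∈ l in
    segment-symmetric⁺ (s - s′) (1# · v l)
      (≤-respʳ (solve 2 (λ s s′ → s :+ (con (+ 1) :- s′) := con (+ 1) :+ (s :- s′)) refl s s′)
          (+-nonNeg 0≤s (≤⇒0≤- s′≤1)))
      (≤-respʳ (solve 2 (λ s s′ → s′ :+ (con (+ 1) :- s) := con (+ 1) :- (s :- s′)) refl s s′)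
          (+-nonNeg 0≤s′ (≤⇒0≤- s≤1)))
      λ k → trans (eq k) (trans (+-cong (a≋ k) (b≋ k)) (trans
        (+-cong (+-congʳ (*-congˡ (u≋0 k))) (+-congʳ (*-congˡ (u≋0 k))))
        (solve 3 (λ s s′ v → (con (+ 1) :- s) :* con (+ 0) :+ s :* v :+
            ((con (+ 1) :- s′) :* con (+ 0) :+ s′ :* (:- v)) :=
          (s :- s′) :* (con (+ 1) :* v)) refl s s′ (v l k))))) , p≋

  -- Of the four segments for u and v_l, those from u to v and from -u to -v combine along u - v,
  -- the other two along u + v.
  cross-cross⇒pairs : ∀ {u} {v : Vector Point n} → Cross u v x → Cross (-ₚ u) v y →
    ∃ λ z → (∀ l → PairSegments u (v l) (z l)) × x +ₚ y ≋ ∑ z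
  cross-cross⇒pairs {u = u} {v} (x , x∈ , x≋) (y , y∈ , y≋) = (λ l → x l +ₚ y l) , (λ l →
      let (a , b , a∈ , b∈ , eq) = x∈ l
          (a′ , b′ , a′∈ , b′∈ , eq′) = y∈ l in
      a +ₚ b′ , b +ₚ a′ , segment-opposite u (v l) a∈ b′∈ (λ _ → refl) ,
      segment-resp (λ k → -‿cong (minus-neg u (v l) k)) (minus-neg u (v l)) (λ _ → refl)
        (segment-opposite u (-ₚ v l) b∈
          (segment-resp (λ _ → refl) (λ k → solve 1 (λ v → v := :- :- v) refl _) (λ _ → refl) a′∈)
              (λ _ → refl)) ,
      λ k → trans (+-cong (eq k) (eq′ k)) (solve 4 (λ a b c d → a :+ b :+ (c :+ d) := a :+ d :+ (b :+ c))
          refl _ _ _ _)) ,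
    λ k → trans (+-cong (x≋ k) (y≋ k)) (sym (∑-distrib-+ (λ l → x l k) (λ l → y l k)))
    where
    minus-neg : ∀ u v → u -ₚ -ₚ v ≋ u +ₚ v
    minus-neg u v k = solve 2 (λ u v → u :- :- v := u :+ v) refl (u k) (v k)

  pairs-supported : (g : Fin n → Fin r) → SupportedIn (Zonotope 1# (e ∘ g))
      (vandermondeₘ (plusPairs (tabulate g)))
  pairs-supported {n = zero}  g = (0ₚ , 0ₚ , ((λ ()) , (λ ()) , λ _ → refl) , ((λ ()) , (λ ()) , λ _ → refl) ,
    λ k → trans (fromExponent-0 k) (sym (+-identityˡ 0#))) ∷ []
  pairs-supported {n = suc n} g = ≡.subst (SupportedIn (Zonotope 1# (e ∘ g)))
    (≡.sym (≡.trans (vandermondeₘ-∷ z (z⁻ ∷ rest))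
        (≡.cong (differences z (z⁻ ∷ rest) *ₗ_) (vandermondeₘ-∷ z⁻ rest))))
    (supported-* {S = S₁ ⊕ S₂} {T = S₃ ⊕ S₄} {U = Zonotope 1# (e ∘ g)}
      (supported-* {S = S₁} {T = S₂} {U = S₁ ⊕ S₂} (difference-supported z z⁻) (cross-supported z (g ∘ suc))
        λ {_} {x} {y} x∈ y∈ eq → x , y , x∈ , y∈ , eq)
      (supported-* {S = S₃} {T = S₄} {U = S₃ ⊕ S₄} (cross-supported z⁻ (g ∘ suc)) (pairs-supported (g ∘ suc))
        λ {_} {x} {y} x∈ y∈ eq → x , y , x∈ , y∈ , eq)
      λ { (x , y , (s , 0≤s , s≤1 , x≋) , y∈ , xy≋) (y′ , q , y′∈ , q∈ , yq≋) p≋ →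
        let (w , w∈ , yy′≋) = cross-cross⇒pairs y∈ (cross-resp (vec-neg (Sign.+ , g zero)) y′∈) in
        cons-zonotope {u = e ∘ g}
          -- The factor z - 1/z has its exponents on the segment from e₀ to -e₀, where parameter s
          -- is the point (1 - 2s) e₀.
          (segment-symmetric⁺ (1# - s - s) (1# · e₀)
            (≤-respʳ (solve 1 (λ s → con (+ 1) :- s :+ (con (+ 1) :- s) := con (+ 1) :+
                (con (+ 1) :- s :- s)) refl s) (+-nonNeg (≤⇒0≤- s≤1) (≤⇒0≤- s≤1)))
            (≤-respʳ (solve 1 (λ s → s :+ s := con (+ 1) :- (con (+ 1) :- s :- s)) refl s) (+-nonNeg 0≤s 0≤s))
            λ k → trans (x≋ k) (trans (+-congˡ (*-congˡ (vec-neg (Sign.+ , g zero) k)))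
              (solve 2 (λ s e → (con (+ 1) :- s) :* e :+ s :* (:- e) := (con (+ 1) :- s :- s) :*
                  (con (+ 1) :* e)) refl s (e₀ k))))
          w∈ q∈
          λ k → trans (p≋ k) (trans (+-cong (xy≋ k) (yq≋ k))
            (trans (solve 4 (λ x y y′ q → x :+ y :+ (y′ :+ q) := x :+ (y :+ y′ :+ q)) refl _ _ _ _)
              (+-congˡ (+-congʳ (yy′≋ k))))) })
    where
    open HeytingField K using () renaming (1# to 1ᴷ)
    e₀ = e (g zero)
    z = 1ᴷ , unit (Sign.+ , g zero)
    z⁻ = 1ᴷ , unit (Sign.- , g zero)
    rest = plusPairs (tabulate (g ∘ suc))
    S₁ = segment e₀ (vec (Sign.- , g zero))
    S₂ = Cross e₀ (e ∘ g ∘ suc)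
    S₃ = Cross (vec (Sign.- , g zero)) (e ∘ g ∘ suc)
    S₄ = Zonotope 1# (e ∘ g ∘ suc)

  -- Adding [-u, u] and [-τu, τu] gives the multiple α + βτ of u, rescaled by the inverse of 1 + τ.
  box-zonotope : ∀ {τ τ′} {u : Vector Point n} → 0# ≤ τ → τ′ ≈ 1# + τ → Box 1# u x → Zonotope τ u y →
    p ≋ x +ₚ y → Zonotope τ′ u p
  box-zonotope {τ = τ} {τ′} {u} 0≤τ τ′≈ (xs , xs∈ , x≋) (a , b , (as , as∈ , a≋) , b∈ , y≋) p≋ =
    _ , b , ((λ l → xs l +ₚ as l) , merged , λ _ → refl) , b∈ ,
    λ k → trans (p≋ k) (trans (+-cong (x≋ k) (trans (y≋ k) (+-congʳ (a≋ k))))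
      (trans (sym (+-assoc _ _ _)) (+-congʳ (sym (∑-distrib-+ (λ l → xs l k) (λ l → as l k))))))
    where
    inv = pos⇒inverse (<-respʳ (trans (+-comm τ 1#) (sym τ′≈)) (+-nonNeg-pos 0≤τ 0<1))
    g = proj₁ inv
    τ′g≈1 = proj₁ (proj₂ inv)
    0≤g = proj₂ (proj₂ inv)
    merged : ∀ l → segment (-ₚ (τ′ · u l)) (τ′ · u l) (xs l +ₚ as l)
    merged l = let (α , 0≤1+α , 0≤1-α , xs≋) = segment-symmetric⁻ (1# · u l) (xs∈ l)
                   (β , 0≤1+β , 0≤1-β , as≋) = segment-symmetric⁻ (τ · u l) (as∈ l) in
      segment-symmetric⁺ (g * (α + β * τ)) (τ′ · u l)
      (≤-respʳ (trans (solve 4 (λ g α β τ → g :* (con (+ 1) :+ α :+ τ :* (con (+ 1) :+ β)) :=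
          (con (+ 1) :+ τ) :* g :+ g :* (α :+ β :* τ)) refl g α β τ)
          (+-congʳ (trans (*-congʳ (sym τ′≈)) τ′g≈1)))
        (*-nonNeg 0≤g (+-nonNeg 0≤1+α (*-nonNeg 0≤τ 0≤1+β))))
      (≤-respʳ (trans (solve 4 (λ g α β τ → g :* (con (+ 1) :- α :+ τ :* (con (+ 1) :- β)) :=
          (con (+ 1) :+ τ) :* g :- g :* (α :+ β :* τ)) refl g α β τ)
          (+-congʳ (trans (*-congʳ (sym τ′≈)) τ′g≈1)))
        (*-nonNeg 0≤g (+-nonNeg 0≤1-α (*-nonNeg 0≤τ 0≤1-β))))
      λ k → trans (+-cong (xs≋ k) (as≋ k)) (trans
        (solve 4 (λ α β τ u → α :* (con (+ 1) :* u) :+ β :* (τ :* u) := con (+ 1) :* ((α :+ β :* τ) :* u))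
            refl α β τ (u l k))
        (trans (*-congʳ (sym τ′g≈1)) (solve 4 (λ t g x u → t :* g :* (x :* u) := g :* x :* (t :* u)) refl
            τ′ g _ (u l k))))

  constants-supported : ∀ b cs ys → SupportedIn S (differences (b , 0ᵉ) ys) → (∀ {p q} → p ≋ q → S p → S q) →
    SupportedIn S (differences (b , 0ᵉ) (constants cs ++ ys))
  constants-supported b []       ys supported resp = supported
  constants-supported {S = S} b (c ∷ cs) ys supported resp = supported-* {S = λ p → p ≋ 0ₚ} {T = S} {U = S}
    (fromExponent-0 ∷ fromExponent-0 ∷ []) (constants-supported {S = S} b cs ys supported resp)
    λ x≋0 Sy p≋ → resp (λ k → sym (trans (p≋ k) (trans (+-congʳ (x≋0 k)) (+-identityˡ _)))) Sy

  vandermonde-supported : ∀ cs (g : Fin n → Fin r) →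
    SupportedIn (Zonotope (fromℤ (+ (length cs ℕ.+ 1))) (e ∘ g))
        (vandermondeₘ (constants cs ++ plusPairs (tabulate g)))
  vandermonde-supported [] g = All.map
    (λ p∈ → zonotope-resp (sym (+-identityʳ 1#)) p∈) (pairs-supported g)
    where
    zonotope-resp : ∀ {τ τ′} {u : Vector Point n} → τ ≈ τ′ → Zonotope τ u p → Zonotope τ′ u p
    zonotope-resp τ≈ (a , b , (as , as∈ , a≋) , b∈ , p≋) = a , b ,
      (as , (λ k → segment-resp (λ i → -‿cong (*-congʳ τ≈)) (λ i → *-congʳ τ≈) (λ _ → refl) (as∈ k)) , a≋)
          , b∈ , p≋
  vandermonde-supported (c ∷ cs) g = ≡.subst (SupportedIn
      (Zonotope (fromℤ (+ (suc (length cs) ℕ.+ 1))) (e ∘ g)))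
    (≡.sym (vandermondeₘ-∷ (c , 0ᵉ) (constants cs ++ plusPairs (tabulate g))))
    (supported-* {S = Box 1# (e ∘ g)} {T = Zonotope (fromℤ (+ (length cs ℕ.+ 1))) (e ∘ g)}
      {U = Zonotope (fromℤ (+ (suc (length cs) ℕ.+ 1))) (e ∘ g)}
      (constants-supported {S = Box 1# (e ∘ g)} c cs (plusPairs (tabulate g))
        (All.map (cross⇒box fromExponent-0) (cross-supported (c , 0ᵉ) g))
        λ p≋q (xs , xs∈ , p≋) → xs , xs∈ , λ k → trans (sym (p≋q k)) (p≋ k))
      (vandermonde-supported cs g)
      (box-zonotope (fromℕ-nonNeg (length cs ℕ.+ 1)) refl))

-- Counting signed permutations.

module Enumeration where
  -- The factorial number system: the first digit is the image of 0, the other digits encode the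
  -- permutation that remains.
  finToPermutation : ∀ n → Fin (n !) → Permutation′ n
  finToPermutation zero    c = Perm.id
  finToPermutation (suc n) c = let (i , d) = remQuot {suc n} (n !) c in
    Perm.insert zero i (finToPermutation n d)

  finToPermutation-injective : ∀ n {c d} →
    (∀ k → finToPermutation n c ⟨$⟩ʳ k ≡ finToPermutation n d ⟨$⟩ʳ k) → c ≡ d
  finToPermutation-injective zero {zero} {zero} eq = ≡.refl
  finToPermutation-injective (suc n) {c} {d} eq = ≡.trans (≡.sym (Fin.combine-remQuot {suc n} (n !) c))
    (≡.trans (≡.cong₂ combine first rest) (Fin.combine-remQuot {suc n} (n !) d))
    where
    i  = proj₁ (remQuot {suc n} (n !) c)
    j  = proj₁ (remQuot {suc n} (n !) d)
    c′ = proj₂ (remQuot {suc n} (n !) c)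
    d′ = proj₂ (remQuot {suc n} (n !) d)
    first : i ≡ j
    first = eq zero
    rest : c′ ≡ d′
    rest = finToPermutation-injective n λ k → Fin.punchIn-injective i _ _
      (≡.trans (≡.sym (Perm.insert-punchIn zero i (finToPermutation n c′) k)) (≡.trans (eq (suc k))
        (≡.trans (Perm.insert-punchIn zero j (finToPermutation n d′) k)
          (≡.cong (λ m → punchIn m (finToPermutation n d′ ⟨$⟩ʳ k)) (≡.sym first)))))

  finToPermutation-surjective : ∀ n (σ : Permutation′ n) →
    ∃ λ c → ∀ k → finToPermutation n c ⟨$⟩ʳ k ≡ σ ⟨$⟩ʳ k
  finToPermutation-surjective zero    σ = zero , λ ()
  finToPermutation-surjective (suc n) σ with finToPermutation-surjective n (Perm.remove zero σ)
  ... | d , eq = combine (σ ⟨$⟩ʳ zero) d , λ k → ≡.trans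
    (≡.cong (λ (i , d) → Perm.insert zero i (finToPermutation n d) ⟨$⟩ʳ k)
        (Fin.remQuot-combine (σ ⟨$⟩ʳ zero) d)) (at k)
    where
    at : ∀ k → Perm.insert zero (σ ⟨$⟩ʳ zero) (finToPermutation n d) ⟨$⟩ʳ k ≡ σ ⟨$⟩ʳ k
    at zero    = ≡.refl
    at (suc k) = ≡.trans (Perm.insert-punchIn zero (σ ⟨$⟩ʳ zero) (finToPermutation n d) k)
      (≡.trans (≡.cong (punchIn (σ ⟨$⟩ʳ zero)) (eq k)) (≡.sym (Perm.punchIn-permute σ zero k)))

  finToSign : Fin 2 → Sign
  finToSign zero    = Sign.+
  finToSign (suc _) = Sign.-

  signToFin : Sign → Fin 2
  signToFin Sign.+ = zero
  signToFin Sign.- = suc zero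

  signToFin∘finToSign : ∀ i → signToFin (finToSign i) ≡ i
  signToFin∘finToSign zero       = ≡.refl
  signToFin∘finToSign (suc zero) = ≡.refl

  finToSign∘signToFin : ∀ s → finToSign (signToFin s) ≡ s
  finToSign∘signToFin Sign.+ = ≡.refl
  finToSign∘signToFin Sign.- = ≡.refl

  funToFin-cong : ∀ {m n} {f g : Fin m → Fin n} → (∀ i → f i ≡ g i) → funToFin f ≡ funToFin g
  funToFin-cong {zero}  eq = ≡.refl
  funToFin-cong {suc m} eq = ≡.cong₂ combine (eq zero) (funToFin-cong (eq ∘ suc))

  enumerate : ∀ n → Fin (2 ℕ.^ n ℕ.* n !) → SignedPermutation n
  enumerate n c = let (i , d) = remQuot {2 ℕ.^ n} (n !) c in
    finToSign ∘ finToFun i , finToPermutation n d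

  act : ∀ {n} → SignedPermutation n → Fin n → Sign × Fin n
  act (ε , σ) k = ε k , σ ⟨$⟩ʳ k

  enumerate-injective : ∀ n {c d} → (∀ k → act (enumerate n c) k ≡ act (enumerate n d) k) → c ≡ d
  enumerate-injective n {c} {d} eq = ≡.trans (≡.sym (Fin.combine-remQuot {2 ℕ.^ n} (n !) c))
    (≡.trans (≡.cong₂ combine signs permutations) (Fin.combine-remQuot {2 ℕ.^ n} (n !) d))
    where
    i = proj₁ (remQuot {2 ℕ.^ n} (n !) c)
    j = proj₁ (remQuot {2 ℕ.^ n} (n !) d)
    signs : i ≡ j
    signs = ≡.trans (≡.sym (Fin.funToFin-finToFin {n} {2} i)) (≡.trans
      (funToFin-cong λ k → ≡.trans (≡.sym (signToFin∘finToSign _))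
        (≡.trans (≡.cong (signToFin ∘ proj₁) (eq k)) (signToFin∘finToSign _)))
      (Fin.funToFin-finToFin {n} {2} j))
    permutations : _
    permutations = finToPermutation-injective n (≡.cong proj₂ ∘ eq)

  enumerate-surjective : ∀ n w → ∃ λ c → ∀ k → act (enumerate n c) k ≡ act w k
  enumerate-surjective n (ε , σ) with finToPermutation-surjective n σ
  ... | d , eq = combine i d , λ k → ≡.trans
    (≡.cong (λ (i , d) → finToSign (finToFun i k) , finToPermutation n d ⟨$⟩ʳ k) (Fin.remQuot-combine i d))
    (≡.cong₂ _,_ (≡.trans (≡.cong finToSign (Fin.finToFun-funToFin (signToFin ∘ ε) k))
        (finToSign∘signToFin (ε k))) (eq k))
    where i = funToFin (signToFin ∘ ε)

open import Data.Nat.Base using (_+_; _*_; _^_; _≤_)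
open import Relation.Binary.PropositionalEquality using (setoid)

-- Lists of concatenated vectors.

module _ {a} {A : Set a} where
  tabulate-++ : ∀ m {n} (xs : Vector A m) (ys : Vector A n) →
    tabulate (xs Vector.++ ys) ≡ tabulate xs ++ tabulate ys
  tabulate-++ zero    xs ys = ≡.refl
  tabulate-++ (suc m) xs ys = ≡.cong (xs zero ∷_) (≡.trans
    (List.tabulate-cong tail-++) (tabulate-++ m (xs ∘ suc) ys))
    where
    tail-++ : ∀ i → (xs Vector.++ ys) (suc i) ≡ ((xs ∘ suc) Vector.++ ys) i
    tail-++ i with splitAt m i
    ... | inj₁ _ = ≡.refl
    ... | inj₂ _ = ≡.refl

  tabulate-concat : ∀ {m} n (xss : Vector (Vector A m) n) →
    tabulate (Vector.concat xss) ≡ List.concat (tabulate (tabulate ∘ xss))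
  tabulate-concat     zero    xss = ≡.refl
  tabulate-concat {m} (suc n) xss = ≡.trans (List.tabulate-cong split) (≡.trans
    (tabulate-++ m (xss zero) (Vector.concat (xss ∘ suc)))
    (≡.cong (tabulate (xss zero) ++_) (tabulate-concat n (xss ∘ suc))))
    where
    split : ∀ i → Vector.concat xss i ≡ (xss zero Vector.++ Vector.concat (xss ∘ suc)) i
    split i with splitAt m i
    ... | inj₁ _ = ≡.refl
    ... | inj₂ _ = ≡.refl

-- N_δ as a Vandermonde product, and its coefficients on the orbit.

module Expansion {a ℓ₁ ℓ₂} (K : HeytingField a ℓ₁ ℓ₂) (r t : ℕ) where
  open HeytingField K using (Carrier; _≈_; _#_; 0#; refl; sym; trans; reflexive; #-sym; *-identityˡ;
      *-assoc; *-congˡ; +-congˡ; -‿cong)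
    renaming (_*_ to _*ᴷ_)
  open IntegerScalars (commutativeRing K) using (solve; _:=_; _:*_; _:-_; con)
  open HeytingFieldProperties K
  open Laurent K r
  open LaurentRing K r
  open LeadingTerms K r
  open Vandermonde rawRing _≈ₗ_ isCommutativeRing′ using (det-vandermonde)
  open RootOfUnity K using (IsPrimitiveRoot) renaming (_^_ to _^ᴷ_)

  powers : Carrier → List Carrier
  powers ζ = tabulate {n = t} (λ i → ζ ^ᴷ toℕ i)

  variables-list : ∀ ζ → tabulate (variables t ζ) ≡
    List.map monomial (constants (powers ζ) ++ plusPairs (allFin r))
  variables-list ζ = ≡.trans (tabulate-++ t _ _) (≡.trans
    (≡.cong₂ _++_
      (≡.sym (≡.trans (≡.cong (List.map monomial) (List.map-tabulate _ _)) (List.map-tabulate _ monomial)))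
      (≡.trans (tabulate-concat r (λ k → z k Vector.∷ z⁻¹ k Vector.∷ Vector.[])) (pairs-list id)))
    (≡.sym (List.map-++ monomial (constants (powers ζ)) (plusPairs (allFin r)))))
    where
    pairs-list : ∀ {n} (g : Fin n → Fin r) →
      List.concat (tabulate λ k → z (g k) ∷ z⁻¹ (g k) ∷ []) ≡ List.map monomial (plusPairs (tabulate g))
    pairs-list {zero}  g = ≡.refl
    pairs-list {suc n} g = ≡.cong (λ fs → z (g zero) ∷ z⁻¹ (g zero) ∷ fs) (pairs-list (g ∘ suc))

  expansion : Carrier → LaurentPoly
  expansion ζ = vandermondeₘ (constants (powers ζ) ++ plusPairs (allFin r))

  Nδ-expansion : ∀ ζ m → coeff (Nδ t ζ) m ≈ coeff (expansion ζ) m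
  Nδ-expansion ζ = coeff-cong {Nδ t ζ} {expansion ζ} λ φ → trans
    (det-vandermonde (variables t ζ) φ)
    (reflexive (≡.cong (λ xs → pair (vandermonde xs) φ) (variables-list ζ)))
    where open Vandermonde rawRing _≈ₗ_ isCommutativeRing′ using (vandermonde)

  module _ {ζ : Carrier} (isPrimitive : IsPrimitiveRoot t ζ) where
    power-+ : ∀ m n → ζ ^ᴷ (m + n) ≈ ζ ^ᴷ m *ᴷ ζ ^ᴷ n
    power-+ zero    n = sym (*-identityˡ _)
    power-+ (suc m) n = trans (*-congˡ (power-+ m n)) (sym (*-assoc _ _ _))

    -- The inverse is ζ^(t - m).
    power#0 : ∀ {m} → m ≤ t → ζ ^ᴷ m # 0#
    power#0 {m} m≤t = inverse⇒#0 (trans (sym (power-+ m (t ℕ.∸ m)))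
      (trans (reflexive (≡.cong (ζ ^ᴷ_) (ℕ.m+[n∸m]≡n m≤t))) (proj₁ isPrimitive)))

    -- The difference is ζ^i (1 - ζ^(j - i)), and primitivity applies because 0 < j - i < t.
    power#power : ∀ {i j : Fin t} → i Fin.< j → ζ ^ᴷ toℕ i # ζ ^ᴷ toℕ j
    power#power {i} {j} i<j = -#0⇒# (#-congʳ
      (trans (solve 2 (λ x y → x :* (con (+ 1) :- y) := x :- x :* y) refl (ζ ^ᴷ toℕ i) (ζ ^ᴷ d))
        (+-congˡ (-‿cong (trans (sym (power-+ (toℕ i) d))
            (reflexive (≡.cong (ζ ^ᴷ_) (ℕ.m+[n∸m]≡n (ℕ.<⇒≤ i<j))))))))
      (x#0y#0→xy#0 (power#0 (ℕ.<⇒≤ (Fin.toℕ<n i)))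
        (#⇒-#0 (#-sym (proj₂ isPrimitive d (ℕ.m<n⇒0<n∸m i<j)
            (ℕ.≤-<-trans (ℕ.m∸n≤m (toℕ j) (toℕ i)) (Fin.toℕ<n j)))))))
      where d = toℕ j ℕ.∸ toℕ i

    Nδ-coeff : ∀ w → coeff (Nδ t ζ) (SignedRankings.signedTop (t + 1) w) # 0#
    Nδ-coeff w = #-congʳ (sym (Nδ-expansion ζ _)) (≡.subst
      (λ n → coeff (expansion ζ) (SignedRankings.signedTop (n + 1) w) # 0#) (List.length-tabulate {n = t} _)
      (vandermonde-coeff (powers ζ) (All.tabulate⁺ λ i → power#0 (ℕ.<⇒≤ (Fin.toℕ<n i)))
        (AllPairs.tabulate⁺-< power#power) w))

-- The three inclusions and the vertices of the Newton polytope.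

module NewtonPolytope {a a₁ a₂ c ℓ₁ ℓ₂ ℓ₃} (K : HeytingField a a₁ a₂) (F : OrderedField c ℓ₁ ℓ₂ ℓ₃)
  (t r : ℕ) (ζ : HeytingField.Carrier K) (isPrimitive : RootOfUnity.IsPrimitiveRoot K t ζ) where
  open Polytope F r
  open Convexity F r
  open Convex F r
  open Ranking F r
  open Zonotopes F r
  open Vertices F r t
  open Support K F r
  open Expansion K r t
  open Enumeration
  open Laurent K r using (coeff; Nδ)
  open HeytingField K using (_#_; 0#; #-irrefl; +-identityˡ)
  open HeytingFieldProperties K using (#-congʳ)
  module F = OrderedField F

  P : Pred Point _
  P = Newt K (Nδ t ζ)

  ExponentPoint : Pred Point _
  ExponentPoint p = ∃ λ m → coeff (Nδ t ζ) m # 0# × p ≋ fromExponent m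

  -- Terms with other exponents contribute 0 to the coefficient, so one with exponent m must be
  -- listed.
  supported-coeff : ∀ {ℓ} {S : Pred Point ℓ} {f m} → SupportedIn S f → coeff f m # 0# → S (fromExponent m)
  supported-coeff {S = S} {f = []} [] 0#0 = contradiction 0#0 (#-irrefl (HeytingField.refl K))
  supported-coeff {S = S} {f = (a , n) ∷ f} {m} (Sn ∷ Sf) p with Vec.≡-dec ℤ._≟_ n m
  ... | yes ≡.refl = Sn
  ... | no  _      = supported-coeff {S = S} Sf (#-congʳ (+-identityˡ _) p)

  -- Convexity of the zonotope reduces this to exponents with nonzero coefficient, which stay
  -- nonzero in the product expansion and hence are listed there.
  newt⊆zonotope : ∀ {p} → P p → zonotope t p
  newt⊆zonotope (n , w , q , 0≤w , Σw≈1 , q∈ , p≋) = zonotope-resp-≋ (λ k → F.sym (p≋ k))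
    (zonotope-convex (fromℤ (+ (t + 1))) e w q 0≤w Σw≈1 λ i →
      let (m , m#0 , q≋) = q∈ i in zonotope-resp-≋ (λ k → F.sym (q≋ k)) (exponent∈ m m#0))
    where
    zonotope-resp-≋ : ∀ {p q} → p ≋ q → zonotope t p → zonotope t q
    zonotope-resp-≋ p≋q (a , b , a∈ , b∈ , p≋) = a , b , a∈ , b∈ , λ k → F.trans (F.sym (p≋q k)) (p≋ k)

    exponent∈ : ∀ m → coeff (Nδ t ζ) m # 0# → zonotope t (fromExponent m)
    exponent∈ m m#0 = ≡.subst (λ n → Zonotope (fromℤ (+ (n + 1))) e (fromExponent m))
        (List.length-tabulate {n = t} _)
      (supported-coeff {S = Zonotope (fromℤ (+ (length (powers ζ) + 1))) e}
          (vandermonde-supported (powers ζ) id) (#-congʳ (Nδ-expansion ζ m) m#0))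

  orbit⊆newt : ∀ {p} → orbit (top N) p → P p
  orbit⊆newt (w , p≋) = hull⇒conv {S = ExponentPoint}
      (hull-return (SignedRankings.signedTop (t + 1) w , Nδ-coeff isPrimitive w ,
    λ k → F.trans (p≋ k) (F.sym (signedTop≋ w k))))

  hull⊆newt : ∀ {p} → Hull (orbit (top N)) p → P p
  hull⊆newt p∈ = hull⇒conv {S = ExponentPoint}
      (hull-join (λ x∈ → conv⇒hull {S = ExponentPoint} (orbit⊆newt x∈)) p∈)

  newt⊆hull : ∀ {p} → P p → Hull (orbit (top N)) p
  newt⊆hull = zonotope⊆orbit ∘ newt⊆zonotope

  isVertex : ∀ w → IsVertex P (w • top N)
  isVertex w = orbit-vertex w {P = P} orbit⊆newt newt⊆hull

  isOrbit : ∀ {v} → IsVertex P v → orbit (top N) v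
  isOrbit = vertex-orbit {P = P} orbit⊆newt newt⊆hull

  •-cong : ∀ w w′ → (∀ k → act w k ≡ act w′ k) → w • top N ≋ w′ • top N
  •-cong w w′ eq k = F.reflexive (≡.cong (λ (ε , i) → signed ε (top N i)) (eq k))

  signedPermutations⤖vertices : Bijection (signedPermutations r) (vertices P)
  signedPermutations⤖vertices = record
    { to        = λ w → w • top N , isVertex w
    ; cong      = λ {w} {w′} → •-cong w w′
    ; bijective = (λ {w} {w′} → orbit-injective w w′) , λ (v , v-vertex) →
        let (w , v≋) = isOrbit v-vertex in
        w , λ {w′} eq k → F.trans (•-cong w′ w eq k) (F.sym (v≋ k))
    }

  enumeratedVertex : Fin (2 ^ r * r !) → Point
  enumeratedVertex c = enumerate r c • top N

  enumeratedVertex-cong : ∀ {c d} → c ≡ d → enumeratedVertex c ≋ enumeratedVertex d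
  enumeratedVertex-cong eq k = F.reflexive (≡.cong (λ c → enumeratedVertex c k) eq)

  enumeratedVertex-injective : ∀ {c d} → enumeratedVertex c ≋ enumeratedVertex d → c ≡ d
  enumeratedVertex-injective {c} {d} eq =
    enumerate-injective r (orbit-injective (enumerate r c) (enumerate r d) eq)

  enumeratedVertex-surjective : ∀ {v} → orbit (top N) v → ∃ λ c → enumeratedVertex c ≋ v
  enumeratedVertex-surjective (w , v≋) = let (c , eq) = enumerate-surjective r w in
    c , λ k → F.trans (•-cong (enumerate r c) w eq k) (F.sym (v≋ k))

  Fin⤖vertices : Bijection (setoid (Fin (2 ^ r * r !))) (vertices P)
  Fin⤖vertices = record
    { to        = λ c → enumeratedVertex c , isVertex (enumerate r c)
    ; cong      = enumeratedVertex-cong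
    ; bijective = enumeratedVertex-injective , λ (v , v-vertex) →
        let (c , c≋v) = enumeratedVertex-surjective (isOrbit v-vertex) in
        c , λ eq k → F.trans (enumeratedVertex-cong eq k) (c≋v k)
    }

  top-isDominantVertex : IsDominantVertex P (top N)
  top-isDominantVertex = isVertex identity , top-dominant , λ u u-vertex (decreasing , nonNeg) →
    let (w , u≋) = isOrbit u-vertex in
    λ k → F.trans (u≋ k) (orbit-dominant w
      ((λ k l k≤l x<y → decreasing k l k≤l (<-resp (F.sym (u≋ k)) (F.sym (u≋ l)) x<y)) ,
       (λ k x<0 → nonNeg k (<-resp (F.sym (u≋ k)) F.refl x<0))) k)
    where
    open OrderedFieldProperties F using (<-respˡ; <-respʳ)
    <-resp : ∀ {x x′ y y′} → x F.≈ x′ → y F.≈ y′ → x F.< y → x′ F.< y′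
    <-resp x≈ y≈ = <-respˡ x≈ ∘ <-respʳ y≈

proposition7p1 :
    ∀ {a a₁ a₂ c ℓ₁ ℓ₂ ℓ₃}
    (K : HeytingField a a₁ a₂) (F : OrderedField c ℓ₁ ℓ₂ ℓ₃)
    (t r : ℕ) → 2 ≤ t → 1 ≤ r →
    (ζ : HeytingField.Carrier K) → RootOfUnity.IsPrimitiveRoot K t ζ →
    let open Polytope F r
        N = t + r * 2
        P = Newt K (Laurent.Nδ K r t ζ)
    in
      P ≐ zonotope t
    × ( P ≐ conv (orbit (top N))
      × Bijection (setoid (Fin (2 ^ r * r !))) (vertices P)
      × Σ (Bijection (signedPermutations r) (vertices P)) (λ b →
          ∀ w → proj₁ (Bijection.to b w) ≋ w • top N))
    × IsDominantVertex P (top N)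
proposition7p1 K F t r _ _ ζ isPrimitive =
  (newt⊆zonotope , hull⊆newt ∘ zonotope⊆orbit) ,
  ((hull⇒conv ∘ newt⊆hull , hull⊆newt ∘ conv⇒hull) , Fin⤖vertices ,
    signedPermutations⤖vertices , λ w k → F.refl) ,
  top-isDominantVertex
  where
  open NewtonPolytope K F t r ζ isPrimitive
  open Convexity F r
  open Vertices F r t using (zonotope⊆orbit)
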